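{- There exists a label-invariant property of distributions such that any adaptive testing algorithm for it must use at least $\Omega(\sqrt{\log\log n})$ conditional samples for some fixed $\epsilon$. That is, there exist constants $\epsilon>0$, $c>0$ and, for every $n$, a label-invariant set $\mathcal P_n$ of distributions over $[n]$, such that for all sufficiently large $n$ every adaptive distribution tester for $\mathcal P_n$, with distance parameter $\epsilon$ and error bound $\delta=\frac13$, must use at least $c\sqrt{\log\log n}$ conditional samples.
   Context: $[n]=\{1,\ldots,n\}$; the variation distance is $d(\mu,\mu')=\frac12\sum_{i=1}^n|\mu(i)-\mu'(i)|$. A property is a set of distributions over $[n]$; it is label-invariant if it is closed under permutations of the domain $[n]$. $\mu$ is $\epsilon$-far from $\mathcal P$ if $d(\mu,\mu')\ge\epsilon$ for every $\mu'\in\mathcal P$. A conditional sampling oracle for $\mu$ takes a nonempty set $A\subseteq[n]$ and returns $j\in A$ with probability $\mu(j)/\mu(A)$ if $\mu(A)>0$, and a uniformly random member of $A$ if $\mu(A)=0$, independently of all previous samples. An adaptive distribution tester for $\mathcal P$ (with parameters $\epsilon,\delta,n$) is a randomized algorithm that in each phase chooses a conditioning set based on the previously received samples and its internal coin tosses and receives the oracle's answer, and finally accepts or rejects based on the received samples and its coin tosses. It must accept with probability at least $1-\delta$ if $\mu\in\mathcal P$ and reject with probability at least $1-\delta$ if $\mu$ is $\epsilon$-far from $\mathcal P$. -}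

module Defs where

open import Level using (0ℓ)
open import Algebra.Bundles.Raw using (RawMonoid)
import Algebra.Definitions.RawMonoid as RawSum
open import Data.Bool using (Bool; true; false; if_then_else_)
open import Data.Fin using (Fin)
open import Data.Fin.Permutation using (Permutation′; _⟨$⟩ʳ_)
open import Data.Fin.Subset using (Subset; Nonempty; ∣_∣; _∈_; _∉_)
open import Data.Integer as ℤ using (+_)
import Data.Integer.Properties as ℤ
open import Data.Nat as ℕ using (ℕ; zero; suc; _≥_; s≤s; z≤n)
import Data.Nat.Properties as ℕ
open import Data.Nat.Logarithm using (⌈log₂_⌉)
open import Data.Nat.Tactic.RingSolver using (solve-∀)
open import Data.Product using (∃; ∃-syntax; _×_; _,_; proj₁; proj₂)
open import Data.Rational as ℚ using (ℚ; mkℚ; 0ℚ; 1ℚ; ½; Positive; NonNegative; *≤*; toℚᵘ)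
import Data.Rational.Properties as ℚ
open import Data.Rational.Solver using (module +-*-Solver)
import Data.Rational.Unnormalised as ℚᵘ
import Data.Rational.Unnormalised.Properties as ℚᵘ
open import Data.Sum using (inj₁; inj₂)
open import Data.Vec using (lookup)
open import Relation.Binary.PropositionalEquality using (_≡_; refl; sym; trans; cong; cong₂; subst; subst₂)
open import Relation.Nullary using (yes; no)
open import Relation.Unary using (Pred)

------------------------------------------------------------------------
-- Real numbers: Cauchy sequences of rationals, with equality _≃_

Cauchy : (ℕ → ℚ) → Set
Cauchy f = ∀ ε → 0ℚ ℚ.< ε → ∃[ N ] ∀ m n → m ≥ N → n ≥ N → ℚ.∣ f m ℚ.- f n ∣ ℚ.≤ ε

record ℝ : Set where
  constructor mkℝ
  field
    approx : ℕ → ℚ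
    cauchy : Cauchy approx

open ℝ public

infix 4 _≃_ _≤_ _<_

_≃_ : ℝ → ℝ → Set
x ≃ y = ∀ ε → 0ℚ ℚ.< ε →
        ∃[ N ] ∀ n → n ≥ N → ℚ.∣ approx x n ℚ.- approx y n ∣ ℚ.≤ ε

_≤_ : ℝ → ℝ → Set
x ≤ y = ∀ ε → 0ℚ ℚ.< ε → ∃[ N ] ∀ n → n ≥ N → approx x n ℚ.≤ approx y n ℚ.+ ε

_<_ : ℝ → ℝ → Set
x < y = ∃[ ε ] 0ℚ ℚ.< ε × ∃[ N ] ∀ n → n ≥ N → approx x n ℚ.+ ε ℚ.≤ approx y n

private
  halve : ∀ {ε} → 0ℚ ℚ.< ε → 0ℚ ℚ.< ½ ℚ.* ε
  halve {ε} 0<ε = subst (ℚ._< ½ ℚ.* ε) (ℚ.*-zeroʳ ½) (ℚ.*-monoʳ-<-pos ½ 0<ε)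

  halves : ∀ ε → ½ ℚ.* ε ℚ.+ ½ ℚ.* ε ≡ ε
  halves ε = trans (sym (ℚ.*-distribʳ-+ ε ½ ½)) (ℚ.*-identityˡ ε)

  ∣∣-bound : ∀ p {r} → p ℚ.≤ r → ℚ.- p ℚ.≤ r → ℚ.∣ p ∣ ℚ.≤ r
  ∣∣-bound p p≤r -p≤r with ℚ.∣p∣≡p∨∣p∣≡-p p
  ... | inj₁ eq rewrite eq = p≤r
  ... | inj₂ eq rewrite eq = -p≤r

  ≤+⇒-≤ : ∀ {p q r} → p ℚ.≤ q ℚ.+ r → p ℚ.- q ℚ.≤ r
  ≤+⇒-≤ {p} {q} {r} p≤q+r =
    subst (p ℚ.- q ℚ.≤_) (solve 2 (λ q r → q :+ r :- q := r) refl q r) (ℚ.+-monoˡ-≤ (ℚ.- q) p≤q+r)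
    where open +-*-Solver

  ∣-∣-comm : ∀ p q → ℚ.∣ p ℚ.- q ∣ ≡ ℚ.∣ q ℚ.- p ∣
  ∣-∣-comm p q = trans (cong ℚ.∣_∣ (solve 2 (λ p q → p :- q := :- (q :- p)) refl p q)) (ℚ.∣-p∣≡∣p∣ (q ℚ.- p))
    where open +-*-Solver

  ∣p∣≤∣q∣+∣p-q∣ : ∀ p q → ℚ.∣ p ∣ ℚ.≤ ℚ.∣ q ∣ ℚ.+ ℚ.∣ p ℚ.- q ∣
  ∣p∣≤∣q∣+∣p-q∣ p q =
    subst (λ t → ℚ.∣ t ∣ ℚ.≤ ℚ.∣ q ∣ ℚ.+ ℚ.∣ p ℚ.- q ∣)
      (solve 2 (λ p q → q :+ (p :- q) := p) refl p q) (ℚ.∣p+q∣≤∣p∣+∣q∣ q (p ℚ.- q))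
    where open +-*-Solver

  ∣-∣-bound : ∀ p q {r} → p ℚ.≤ q ℚ.+ r → q ℚ.≤ p ℚ.+ r → ℚ.∣ p ℚ.- q ∣ ℚ.≤ r
  ∣-∣-bound p q {r} p≤q+r q≤p+r = ∣∣-bound (p ℚ.- q) (≤+⇒-≤ p≤q+r)
    (subst (ℚ._≤ r) (solve 2 (λ p q → q :- p := :- (p :- q)) refl p q) (≤+⇒-≤ q≤p+r))
    where open +-*-Solver

  ∣∣-contract : ∀ p q → ℚ.∣ ℚ.∣ p ∣ ℚ.- ℚ.∣ q ∣ ∣ ℚ.≤ ℚ.∣ p ℚ.- q ∣
  ∣∣-contract p q = ∣-∣-bound ℚ.∣ p ∣ ℚ.∣ q ∣ (∣p∣≤∣q∣+∣p-q∣ p q)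
    (subst (λ t → ℚ.∣ q ∣ ℚ.≤ ℚ.∣ p ∣ ℚ.+ t) (∣-∣-comm q p) (∣p∣≤∣q∣+∣p-q∣ q p))

  max-≥ˡ : ∀ {M N n} → n ≥ M ℕ.⊔ N → n ≥ M
  max-≥ˡ {M} {N} = ℕ.≤-trans (ℕ.m≤m⊔n M N)

  max-≥ʳ : ∀ {M N n} → n ≥ M ℕ.⊔ N → n ≥ N
  max-≥ʳ {M} {N} = ℕ.≤-trans (ℕ.m≤n⊔m M N)

  eventually-bounded : ∀ x → ∃[ B ] Positive B × ∃[ N ] ∀ n → n ≥ N → ℚ.∣ approx x n ∣ ℚ.≤ B
  eventually-bounded x with cauchy x 1ℚ (ℚ.positive⁻¹ 1ℚ)
  ... | N , close = ℚ.∣ approx x N ∣ ℚ.+ 1ℚ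
    , ℚ.positive (ℚ.+-mono-≤-< (ℚ.0≤∣p∣ (approx x N)) (ℚ.positive⁻¹ 1ℚ))
    , N , λ n n≥N → ℚ.≤-trans (∣p∣≤∣q∣+∣p-q∣ (approx x n) (approx x N))
                      (ℚ.+-monoʳ-≤ ℚ.∣ approx x N ∣ (close n N n≥N ℕ.≤-refl))

  scale : ∀ B .{{_ : Positive B}} ε → 0ℚ ℚ.< ε → ∃[ η ] 0ℚ ℚ.< η × B ℚ.* η ≡ ε
  scale B ε 0<ε = B⁻¹ ℚ.* ε
    , subst (ℚ._< B⁻¹ ℚ.* ε) (ℚ.*-zeroʳ B⁻¹) (ℚ.*-monoʳ-<-pos B⁻¹ 0<ε)
    , trans (sym (ℚ.*-assoc B B⁻¹ ε)) (trans (cong (ℚ._* ε) (ℚ.*-inverseʳ B)) (ℚ.*-identityˡ ε))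
    where
    instance
      B≢0 = ℚ.pos⇒nonZero B
    B⁻¹ = ℚ.1/ B
    instance
      B⁻¹>0 = ℚ.1/pos⇒pos B

private
  abstract
    const-cauchy : ∀ p → Cauchy (λ _ → p)
    const-cauchy p ε 0<ε = 0 , λ _ _ _ _ →
      subst (ℚ._≤ ε) (cong ℚ.∣_∣ (sym (ℚ.+-inverseʳ p))) (ℚ.<⇒≤ 0<ε)

    +-cauchy : ∀ x y → Cauchy (λ n → approx x n ℚ.+ approx y n)
    +-cauchy x y ε 0<ε =
      let (M , closeˣ) = cauchy x (½ ℚ.* ε) (halve 0<ε)
          (N , closeʸ) = cauchy y (½ ℚ.* ε) (halve 0<ε)
      in M ℕ.⊔ N , λ m n m≥ n≥ →
        subst₂ ℚ._≤_
          (cong ℚ.∣_∣ (solve 4 (λ a b c d → (a :- c) :+ (b :- d) := (a :+ b) :- (c :+ d)) refl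
            (approx x m) (approx y m) (approx x n) (approx y n)))
          (halves ε)
          (ℚ.≤-trans (ℚ.∣p+q∣≤∣p∣+∣q∣ (approx x m ℚ.- approx x n) (approx y m ℚ.- approx y n))
            (ℚ.+-mono-≤ (closeˣ m n (max-≥ˡ m≥) (max-≥ˡ n≥)) (closeʸ m n (max-≥ʳ {M} m≥) (max-≥ʳ {M} n≥))))
      where open +-*-Solver

    neg-cauchy : ∀ x → Cauchy (λ n → ℚ.- approx x n)
    neg-cauchy x ε 0<ε =
      let (N , close) = cauchy x ε 0<ε
      in N , λ m n m≥ n≥ →
        subst (ℚ._≤ ε)
          (trans (∣-∣-comm (approx x m) (approx x n))
            (cong ℚ.∣_∣ (solve 2 (λ a b → b :- a := (:- a) :- (:- b)) refl (approx x m) (approx x n))))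
          (close m n m≥ n≥)
      where open +-*-Solver

    *-cauchy : ∀ x y → Cauchy (λ n → approx x n ℚ.* approx y n)
    *-cauchy x y ε 0<ε =
      let (A , A>0 , K , ∣x∣≤A) = eventually-bounded x
          (B , B>0 , L , ∣y∣≤B) = eventually-bounded y
          (α , 0<α , Aα≡) = scale A {{A>0}} (½ ℚ.* ε) (halve 0<ε)
          (β , 0<β , Bβ≡) = scale B {{B>0}} (½ ℚ.* ε) (halve 0<ε)
          (M , closeˣ) = cauchy x β 0<β
          (N , closeʸ) = cauchy y α 0<α
          0≤A = ℚ.nonNegative (ℚ.<⇒≤ (ℚ.positive⁻¹ A {{A>0}}))
          0≤B = ℚ.nonNegative (ℚ.<⇒≤ (ℚ.positive⁻¹ B {{B>0}}))
      in (K ℕ.⊔ L) ℕ.⊔ (M ℕ.⊔ N) , λ m n m≥ n≥ →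
        let a = approx x m
            b = approx y m
            c = approx x n
            d = approx y n
        in subst₂ ℚ._≤_
          (cong ℚ.∣_∣ (solve 4 (λ a b c d → a :* (b :- d) :+ d :* (a :- c) := a :* b :- c :* d) refl a b c d))
          (trans (cong₂ ℚ._+_ Aα≡ Bβ≡) (halves ε))
          (ℚ.≤-trans (ℚ.∣p+q∣≤∣p∣+∣q∣ (a ℚ.* (b ℚ.- d)) (d ℚ.* (a ℚ.- c)))
            (ℚ.+-mono-≤
              (∣*∣-bound 0≤A (∣x∣≤A m (max-≥ˡ {K} {L} (max-≥ˡ m≥)))
                (closeʸ m n (max-≥ʳ {M} (max-≥ʳ {K ℕ.⊔ L} m≥)) (max-≥ʳ {M} (max-≥ʳ {K ℕ.⊔ L} n≥))))
              (∣*∣-bound 0≤B (∣y∣≤B n (max-≥ʳ {K} (max-≥ˡ n≥)))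
                (closeˣ m n (max-≥ˡ {M} (max-≥ʳ {K ℕ.⊔ L} m≥)) (max-≥ˡ {M} (max-≥ʳ {K ℕ.⊔ L} n≥))))))
      where
      open +-*-Solver
      ∣*∣-bound : ∀ {p q r s} → NonNegative r → ℚ.∣ p ∣ ℚ.≤ r → ℚ.∣ q ∣ ℚ.≤ s → ℚ.∣ p ℚ.* q ∣ ℚ.≤ r ℚ.* s
      ∣*∣-bound {p} {q} {r} {s} 0≤r p≤r q≤s = subst (ℚ._≤ r ℚ.* s) (sym (ℚ.∣p*q∣≡∣p∣*∣q∣ p q))
        (ℚ.≤-trans (ℚ.*-monoʳ-≤-nonNeg ℚ.∣ q ∣ {{ℚ.nonNegative (ℚ.0≤∣p∣ q)}} p≤r)
          (ℚ.*-monoˡ-≤-nonNeg r {{0≤r}} q≤s))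

    ∣∣-cauchy : ∀ x → Cauchy (λ n → ℚ.∣ approx x n ∣)
    ∣∣-cauchy x ε 0<ε =
      let (N , close) = cauchy x ε 0<ε
      in N , λ m n m≥ n≥ → ℚ.≤-trans (∣∣-contract (approx x m) (approx x n)) (close m n m≥ n≥)

fromℚ : ℚ → ℝ
fromℚ p = mkℝ (λ _ → p) (const-cauchy p)

fromℕ : ℕ → ℝ
fromℕ n = fromℚ (+ n ℚ./ 1)

0ℝ 1ℝ : ℝ
0ℝ = fromℚ 0ℚ
1ℝ = fromℚ 1ℚ

infixl 6 _+_ _-_
infixl 7 _*_
infix 8 -_

_+_ : ℝ → ℝ → ℝ
x + y = mkℝ (λ n → approx x n ℚ.+ approx y n) (+-cauchy x y)

-_ : ℝ → ℝ
- x = mkℝ (λ n → ℚ.- approx x n) (neg-cauchy x)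

_-_ : ℝ → ℝ → ℝ
x - y = x + (- y)

_*_ : ℝ → ℝ → ℝ
x * y = mkℝ (λ n → approx x n ℚ.* approx y n) (*-cauchy x y)

∣_∣ℝ : ℝ → ℝ
∣ x ∣ℝ = mkℝ (λ n → ℚ.∣ approx x n ∣) (∣∣-cauchy x)

⌊√_⌋ : ℕ → ℕ
⌊√ zero ⌋ = 0
⌊√ suc n ⌋ with suc ⌊√ n ⌋ ℕ.* suc ⌊√ n ⌋ ℕ.≤? suc n
... | yes _ = suc ⌊√ n ⌋
... | no  _ = ⌊√ n ⌋

⌊√⌋-lower : ∀ n → ⌊√ n ⌋ ℕ.* ⌊√ n ⌋ ℕ.≤ n
⌊√⌋-lower zero = z≤n
⌊√⌋-lower (suc n) with suc ⌊√ n ⌋ ℕ.* suc ⌊√ n ⌋ ℕ.≤? suc n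
... | yes r²≤n = r²≤n
... | no  _    = ℕ.m≤n⇒m≤1+n (⌊√⌋-lower n)

⌊√⌋-upper : ∀ n → n ℕ.< suc ⌊√ n ⌋ ℕ.* suc ⌊√ n ⌋
⌊√⌋-upper zero = s≤s z≤n
⌊√⌋-upper (suc n) with suc ⌊√ n ⌋ ℕ.* suc ⌊√ n ⌋ ℕ.≤? suc n
... | yes _    = ℕ.≤-<-trans (⌊√⌋-upper n)
                   (ℕ.*-mono-< (ℕ.n<1+n (suc ⌊√ n ⌋)) (ℕ.n<1+n (suc ⌊√ n ⌋)))
... | no  r²≰n = ℕ.≰⇒> r²≰n

private
  √-approx : ℕ → ℕ → ℚ
  √-approx m k = + ⌊√ m ℕ.* (suc k ℕ.* suc k) ⌋ ℚ./ suc k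

  √-cross : ∀ m j k → ⌊√ m ℕ.* (suc j ℕ.* suc j) ⌋ ℕ.* suc k ℕ.≤ suc ⌊√ m ℕ.* (suc k ℕ.* suc k) ⌋ ℕ.* suc j
  √-cross m j k = ℕ.≮⇒≥ λ lt → ℕ.<-irrefl refl
    (ℕ.<-≤-trans (ℕ.*-mono-< lt lt) (begin
      (r ℕ.* suc k) ℕ.* (r ℕ.* suc k)          ≡⟨ interchange r (suc k) ⟩
      (r ℕ.* r) ℕ.* (suc k ℕ.* suc k)          ≤⟨ ℕ.*-monoˡ-≤ (suc k ℕ.* suc k) (⌊√⌋-lower (m ℕ.* (suc j ℕ.* suc j))) ⟩
      m ℕ.* (suc j ℕ.* suc j) ℕ.* (suc k ℕ.* suc k) ≡⟨ swap m (suc j ℕ.* suc j) (suc k ℕ.* suc k) ⟩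
      m ℕ.* (suc k ℕ.* suc k) ℕ.* (suc j ℕ.* suc j) ≤⟨ ℕ.*-monoˡ-≤ (suc j ℕ.* suc j) (ℕ.<⇒≤ (⌊√⌋-upper (m ℕ.* (suc k ℕ.* suc k)))) ⟩
      (suc s ℕ.* suc s) ℕ.* (suc j ℕ.* suc j)  ≡⟨ interchange (suc s) (suc j) ⟨
      (suc s ℕ.* suc j) ℕ.* (suc s ℕ.* suc j)  ∎))
    where
    open ℕ.≤-Reasoning
    r = ⌊√ m ℕ.* (suc j ℕ.* suc j) ⌋
    s = ⌊√ m ℕ.* (suc k ℕ.* suc k) ⌋
    interchange : ∀ a b → (a ℕ.* b) ℕ.* (a ℕ.* b) ≡ (a ℕ.* a) ℕ.* (b ℕ.* b)
    interchange = solve-∀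
    swap : ∀ a b c → a ℕ.* b ℕ.* c ≡ a ℕ.* c ℕ.* b
    swap = solve-∀

  toℚᵘ-/ : ∀ r k → toℚᵘ (+ r ℚ./ suc k) ℚᵘ.≃ ℚᵘ.mkℚᵘ (+ r) k
  toℚᵘ-/ r k = ℚ.toℚᵘ-fromℚᵘ (ℚᵘ.mkℚᵘ (+ r) k)

  √-step : ∀ m j k → √-approx m j ℚ.≤ √-approx m k ℚ.+ + 1 ℚ./ suc k
  √-step m j k = ℚ.toℚᵘ-cancel-≤ (begin
    toℚᵘ (+ r ℚ./ suc j)                            ≃⟨ toℚᵘ-/ r j ⟩
    ℚᵘ.mkℚᵘ (+ r) j                                 ≤⟨ ℚᵘ.*≤* cross ⟩
    ℚᵘ.mkℚᵘ (+ s) k ℚᵘ.+ ℚᵘ.mkℚᵘ (+ 1) k            ≃⟨ ℚᵘ.+-cong (toℚᵘ-/ s k) (toℚᵘ-/ 1 k) ⟨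
    toℚᵘ (+ s ℚ./ suc k) ℚᵘ.+ toℚᵘ (+ 1 ℚ./ suc k)  ≃⟨ ℚ.toℚᵘ-homo-+ (+ s ℚ./ suc k) (+ 1 ℚ./ suc k) ⟨
    toℚᵘ (+ s ℚ./ suc k ℚ.+ + 1 ℚ./ suc k)          ∎)
    where
    open ℚᵘ.≤-Reasoning
    r = ⌊√ m ℕ.* (suc j ℕ.* suc j) ⌋
    s = ⌊√ m ℕ.* (suc k ℕ.* suc k) ⌋
    left : ∀ a b → a ℕ.* b ℕ.* b ≡ a ℕ.* (b ℕ.* b)
    left = solve-∀
    right : ∀ a b c → suc a ℕ.* c ℕ.* b ≡ (a ℕ.* b ℕ.+ 1 ℕ.* b) ℕ.* c
    right = solve-∀
    cross : + r ℤ.* + (suc k ℕ.* suc k) ℤ.≤ (+ s ℤ.* + suc k ℤ.+ + 1 ℤ.* + suc k) ℤ.* + suc j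
    cross = subst₂ ℤ._≤_
      (ℤ.pos-* r (suc k ℕ.* suc k))
      (trans (ℤ.pos-* (s ℕ.* suc k ℕ.+ 1 ℕ.* suc k) (suc j))
        (cong (ℤ._* + suc j) (trans (ℤ.pos-+ (s ℕ.* suc k) (1 ℕ.* suc k))
          (cong₂ ℤ._+_ (ℤ.pos-* s (suc k)) (ℤ.pos-* 1 (suc k))))))
      (ℤ.+≤+ (subst₂ ℕ._≤_ (left r (suc k)) (right s (suc k) (suc j))
        (ℕ.*-monoˡ-≤ (suc k) (√-cross m j k))))

  archimedean : ∀ ε → 0ℚ ℚ.< ε → ∃[ N ] ∀ k → k ≥ N → + 1 ℚ./ suc k ℚ.≤ ε
  archimedean ε 0<ε = go ε (ℚ.positive 0<ε)
    where
    go : ∀ ε → Positive ε → ∃[ N ] ∀ k → k ≥ N → + 1 ℚ./ suc k ℚ.≤ ε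
    go ε@(mkℚ (+ suc p) d _) _ = d , λ k k≥d → ℚ.toℚᵘ-cancel-≤
      (ℚᵘ.≤-respˡ-≃ (ℚᵘ.≃-sym (toℚᵘ-/ 1 k))
        (ℚᵘ.*≤* (ℤ.+≤+ (ℕ.*-mono-≤ {1} {suc p} (s≤s z≤n) (s≤s k≥d)))))

  abstract
    √-cauchy : ∀ m → Cauchy (√-approx m)
    √-cauchy m ε 0<ε =
      let (N , small) = archimedean ε 0<ε
      in N , λ j k j≥N k≥N →
        ∣-∣-bound (√-approx m j) (√-approx m k)
          (ℚ.≤-trans (√-step m j k) (ℚ.+-monoʳ-≤ (√-approx m k) (small k k≥N)))
          (ℚ.≤-trans (√-step m k j) (ℚ.+-monoʳ-≤ (√-approx m j) (small j j≥N)))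

√_ : ℕ → ℝ
√ m = mkℝ (√-approx m) (√-cauchy m)

+-rawMonoid : RawMonoid 0ℓ 0ℓ
+-rawMonoid = record { Carrier = ℝ ; _≈_ = _≃_ ; _∙_ = _+_ ; ε = 0ℝ }

open RawSum +-rawMonoid public using (sum)

------------------------------------------------------------------------
-- Distributions and their properties

record Distribution (n : ℕ) : Set where
  field
    pr     : Fin n → ℝ
    pr-≥0  : ∀ i → 0ℝ ≤ pr i
    pr-sum : sum pr ≃ 1ℝ

open Distribution public

mass : ∀ {n} → Distribution n → Subset n → ℝ
mass μ A = sum λ i → if lookup A i then pr μ i else 0ℝ

distance : ∀ {n} → Distribution n → Distribution n → ℝ
distance μ ν = fromℚ ½ * sum λ i → ∣ pr μ i - pr ν i ∣ℝ

Property : ℕ → Set₁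
Property n = Pred (Distribution n) 0ℓ

-- The identity permutation also makes such a property independent of
-- the Cauchy sequences that represent the probabilities.
LabelInvariant : ∀ {n} → Property n → Set
LabelInvariant {n} P = ∀ (π : Permutation′ n) (μ ν : Distribution n) →
  (∀ i → pr ν i ≃ pr μ (π ⟨$⟩ʳ i)) → P μ → P ν

Far : ∀ {n} → ℝ → Property n → Distribution n → Set
Far ε P μ = ∀ μ′ → P μ′ → ε ≤ distance μ μ′

------------------------------------------------------------------------
-- Conditional sampling and testers

Oracle : ℕ → Set
Oracle n = (A : Subset n) → Nonempty A → Distribution n

-- Since 0ℝ < mass μ A is undecidable, the oracle is specified rather
-- than computed; it is determined up to _≃_ once either case holds.  The
-- equations pr = μ(j)/μ(A) and pr = 1/∣A∣ are cleared of their positive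
-- denominators.
record IsConditionalOracle {n} (μ : Distribution n) (O : Oracle n) : Set where
  field
    supported : ∀ A ne j → j ∉ A → pr (O A ne) j ≃ 0ℝ
    posMass   : ∀ A ne j → j ∈ A → 0ℝ < mass μ A → pr (O A ne) j * mass μ A ≃ pr μ j
    zeroMass  : ∀ A ne j → j ∈ A → mass μ A ≃ 0ℝ → pr (O A ne) j * fromℕ ∣ A ∣ ≃ 1ℝ

-- Adaptive algorithms making at most q conditional samples on every
-- execution.  The position in the tree records all previous samples and
-- coin tosses.  Arbitrary real biases lose no randomness: there are only
-- finitely many deterministic trees with at most q samples, and `toss`
-- can choose among them with any probabilities.
data Algorithm (n : ℕ) : ℕ → Set where
  output : ∀ {q} → Bool → Algorithm n q
  toss   : ∀ {q k} → Distribution k → (Fin k → Algorithm n q) → Algorithm n q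
  sample : ∀ {q} (A : Subset n) → Nonempty A → (Fin n → Algorithm n q) → Algorithm n (suc q)

outputProb : ∀ {n q} → Oracle n → Algorithm n q → Bool → ℝ
outputProb O (output true)   true  = 1ℝ
outputProb O (output false)  false = 1ℝ
outputProb O (output true)   false = 0ℝ
outputProb O (output false)  true  = 0ℝ
outputProb O (toss coin T)   b = sum λ i → pr coin i * outputProb O (T i) b
outputProb O (sample A ne T) b = sum λ j → pr (O A ne) j * outputProb O (T j) b

record IsTester {n q} (P : Property n) (ε δ : ℝ) (T : Algorithm n q) : Set where
  field
    accepts : ∀ μ O → IsConditionalOracle μ O → P μ → 1ℝ - δ ≤ outputProb O T true
    rejects : ∀ μ O → IsConditionalOracle μ O → Far ε P μ → 1ℝ - δ ≤ outputProb O T false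

-- ⌈log₂ ⌈log₂ n ⌉ ⌉ is log₂ log₂ n rounded up (n ≥ 2): a bound by it
-- implies the bound by log log n, and the two differ by at most a factor
-- of two once n ≥ 4.
√loglog : ℕ → ℝ
√loglog n = √ ⌈log₂ ⌈log₂ n ⌉ ⌉

-- The hidden distribution is uniform on a random set S of size B^(3κ+1), which
-- has the property, or B^(3κ+2), which is far from it, for a random scale κ.  A
-- query A is small for κ when A almost surely misses S, and large when A meets
-- S in many elements.  A small query is answered as if S consisted of the
-- elements already found (or uniformly on A when it contains none of them), and
-- a large one by an almost uniform new element of A, so in both cases the answer
-- does not distinguish the two sizes.  Since |A| is critical, neither small nor
-- large, for at most one κ, and the other scales only split into small and large,
-- at most 2^q - 1 scales are ever critical in q steps.  With 8 · 2^Q scales and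
-- B = 64 · 4^Q, which fit below n when 2 Q is below log log n, the errors of an
-- algorithm with q ≤ Q samples therefore add up to more than 1/3 on average.
--
-- The probability of a history under S contains the factors 1 / |A ∩ S| of the
-- large queries.  By AM-GM, ∏ 1/yₜ ≥ 1 + ∑ (1 - yₜ), so averaging them over S
-- needs only the first moments of |A ∩ S|, hence only the ratios of the numbers
-- of s-element sets containing X ∪ {j} and X.
module Submission where

-- The posterior of `S` after adaptively chosen queries is hard to control, so no distribution is
-- tracked. A nonnegative weight below the true probability of the history is carried along instead,
-- and whatever does not fit the idealised picture is thrown away. Such minorants can be added,
-- scaled and weakened, and the induction on the number of samples rests on this. The idealised
-- answers depend on the history but neither on `S` nor on which of the two sizes of a scale is the
-- true one. Hence their probabilities sum to 1 over the answers, and at a leaf every surviving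
-- scale leaves weight at least 1 against either output: a two-point lower bound in the manner of Le
-- Cam, for many pairs at once. The numbers: with x = 2^Q the certificate leaves at least 8x - x =
-- 7x. A tester with error 1/3 pays at most (9x + 9x) / 3 = 6x, where 9x = 8x · 9/8 is the total
-- weight against each output. The number 8x of scales leaves room for both the lost scales and the
-- factor 9/8.

module Finite where

  open import Data.Bool using (Bool; true; false)
  open import Data.Empty using (⊥-elim)
  open import Data.Fin as Fin using (Fin; zero; suc)
  open import Data.Fin.Subset using (Subset; inside; outside; ∣_∣; _∈_; _∉_; _⊆_; _∩_; _∪_; ∁; Nonempty)
  open import Data.Fin.Subset.Properties using (_⊆?_; _∈?_; nonempty?; ∣p∣≤n; p⊆q⇒∣p∣≤∣q∣; ∣p∩q∣≤∣q∣; ∣⊥∣≡0; Empty-unique; x∈p∩q⁺; x∈p∩q⁻; x∈p∪q⁺; x∈p∪q⁻; x∉p⇒x∈∁p; x∈∁p⇒x∉p; p∩q⊆p; ⊆-antisym; ⊆-trans)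
  import Data.Integer as ℤ
  import Data.Integer.Properties as ℤ
  open import Data.List using (List; []; _∷_; _++_; map; length; tabulate; allFin)
  open import Data.List.Membership.Propositional using () renaming (_∈_ to _∈ˡ_)
  open import Data.List.Relation.Unary.All as All using (All; []; _∷_)
  open import Data.List.Relation.Unary.AllPairs using (AllPairs; []; _∷_)
  open import Data.List.Relation.Unary.Any using (here; there)
  open import Data.Nat as ℕ using (ℕ; zero; suc; s≤s; z≤n)
  open import Data.Nat.Combinatorics using (_C_; nCk+nC[k+1]≡[n+1]C[k+1]; k>n⇒nCk≡0)
  import Data.Nat.Properties as ℕ
  open import Data.Nat.Tactic.RingSolver using (solve-∀)
  open import Data.Product using (∃-syntax; _×_; _,_; proj₁; proj₂)
  open import Data.Rational hiding (∣_∣)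
  open import Data.Rational.Properties
  open import Data.Rational.Solver using (module +-*-Solver)
  import Data.Rational.Unnormalised as ℚᵘ
  import Data.Rational.Unnormalised.Properties as ℚᵘ
  open import Data.Sum using (_⊎_; inj₁; inj₂)
  open import Data.Vec as Vec using ([]; _∷_; lookup; _[_]≔_)
  open import Data.Vec.Properties using ([]=⇒lookup; lookup⇒[]=; lookup∘update′)
  open import Function using (_∘_)
  open import Relation.Binary.PropositionalEquality
  open import Relation.Nullary using (Dec; yes; no; does; ¬_; contradiction)
  open +-*-Solver using (solve; _:+_; _:*_; _:-_; :-_; _:=_; con)

  -- Reduces a polynomial inequality to a ring identity: `d` exhibits the slack as a sum of products
  -- of nonnegative terms.
  ≤-certificate : ∀ {a b d} → 0ℚ ≤ d → b ≡ a + d → a ≤ b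
  ≤-certificate {a} 0≤d refl = subst (_≤ a + _) (+-identityʳ a) (+-monoʳ-≤ a 0≤d)

  ≤⇒0≤- : ∀ {a b} → a ≤ b → 0ℚ ≤ b - a
  ≤⇒0≤- {a} {b} a≤b = subst (_≤ b - a) (+-inverseʳ a) (+-monoˡ-≤ (- a) a≤b)

  +-nonNeg : ∀ {a b} → 0ℚ ≤ a → 0ℚ ≤ b → 0ℚ ≤ a + b
  +-nonNeg = +-mono-≤

  *-monoˡ : ∀ {c a b} → 0ℚ ≤ c → a ≤ b → c * a ≤ c * b
  *-monoˡ {c} 0≤c = *-monoˡ-≤-nonNeg c {{nonNegative 0≤c}}

  *-monoʳ : ∀ {c a b} → 0ℚ ≤ c → a ≤ b → a * c ≤ b * c
  *-monoʳ {c} 0≤c = *-monoʳ-≤-nonNeg c {{nonNegative 0≤c}}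

  *-nonNeg : ∀ {a b} → 0ℚ ≤ a → 0ℚ ≤ b → 0ℚ ≤ a * b
  *-nonNeg {a} {b} 0≤a 0≤b = subst (_≤ a * b) (*-zeroʳ a) (*-monoˡ 0≤a 0≤b)

  *-pos : ∀ {a b} → 0ℚ < a → 0ℚ < b → 0ℚ < a * b
  *-pos {a} {b} 0<a 0<b = subst (_< a * b) (*-zeroʳ a) (*-monoʳ-<-pos a {{positive 0<a}} 0<b)

  *-mono : ∀ {a b c d} → 0ℚ ≤ a → a ≤ b → 0ℚ ≤ c → c ≤ d → a * c ≤ b * d
  *-mono 0≤a a≤b 0≤c c≤d = ≤-trans (*-monoˡ 0≤a c≤d) (*-monoʳ (≤-trans 0≤c c≤d) a≤b)

  *-cancelˡ : ∀ {c a b} → 0ℚ < c → c * a ≤ c * b → a ≤ b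
  *-cancelˡ {c} 0<c = *-cancelˡ-≤-pos c {{positive 0<c}}

  <⇒≱ : ∀ {a b} → a < b → ¬ b ≤ a
  <⇒≱ a<b b≤a = <-irrefl refl (<-≤-trans a<b b≤a)

  0≤1 : 0ℚ ≤ 1ℚ
  0≤1 = nonNegative⁻¹ 1ℚ

  infixr 8 _^_
  _^_ : ℚ → ℕ → ℚ
  x ^ zero  = 1ℚ
  x ^ suc k = x * x ^ k

  ^-nonNeg : ∀ {x} → 0ℚ ≤ x → ∀ k → 0ℚ ≤ x ^ k
  ^-nonNeg 0≤x zero    = 0≤1
  ^-nonNeg 0≤x (suc k) = *-nonNeg 0≤x (^-nonNeg 0≤x k)

  ^-pos : ∀ {x} → 0ℚ < x → ∀ k → 0ℚ < x ^ k
  ^-pos 0<x zero    = positive⁻¹ 1ℚ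
  ^-pos 0<x (suc k) = *-pos 0<x (^-pos 0<x k)

  abstract
    ι : ℕ → ℚ
    ι n = ℤ.+ n / 1

    ι-def : ∀ n → ι n ≡ ℤ.+ n / 1
    ι-def n = refl

    ι-0 : ι 0 ≡ 0ℚ
    ι-0 = refl

    ι-1 : ι 1 ≡ 1ℚ
    ι-1 = refl

    toℚᵘ-ι : ∀ n → toℚᵘ (ι n) ℚᵘ.≃ ℚᵘ.mkℚᵘ (ℤ.+ n) 0
    toℚᵘ-ι n = toℚᵘ-fromℚᵘ (ℚᵘ.mkℚᵘ (ℤ.+ n) 0)

    ι-+ : ∀ m n → ι (m ℕ.+ n) ≡ ι m + ι n
    ι-+ m n = toℚᵘ-injective (ℚᵘ.≃-trans (toℚᵘ-ι (m ℕ.+ n)) (ℚᵘ.≃-trans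
      (ℚᵘ.*≡* (trans (ℤ.*-identityʳ _) (trans (ℤ.pos-+ m n) (sym (trans (ℤ.*-identityʳ _) (cong₂ ℤ._+_ (ℤ.*-identityʳ (ℤ.+ m)) (ℤ.*-identityʳ (ℤ.+ n))))))))
      (ℚᵘ.≃-trans (ℚᵘ.+-cong (ℚᵘ.≃-sym (toℚᵘ-ι m)) (ℚᵘ.≃-sym (toℚᵘ-ι n)))
        (ℚᵘ.≃-sym (toℚᵘ-homo-+ (ι m) (ι n))))))

    ι-* : ∀ m n → ι (m ℕ.* n) ≡ ι m * ι n
    ι-* m n = toℚᵘ-injective (ℚᵘ.≃-trans (toℚᵘ-ι (m ℕ.* n)) (ℚᵘ.≃-trans
      (ℚᵘ.*≡* (trans (ℤ.*-identityʳ _) (trans (ℤ.pos-* m n) (sym (ℤ.*-identityʳ _)))))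
      (ℚᵘ.≃-trans (ℚᵘ.*-cong (ℚᵘ.≃-sym (toℚᵘ-ι m)) (ℚᵘ.≃-sym (toℚᵘ-ι n)))
        (ℚᵘ.≃-sym (toℚᵘ-homo-* (ι m) (ι n))))))

    ι-suc : ∀ n → ι (suc n) ≡ 1ℚ + ι n
    ι-suc = ι-+ 1

    0≤ι : ∀ n → 0ℚ ≤ ι n
    0≤ι n = toℚᵘ-cancel-≤ (ℚᵘ.≤-respʳ-≃ (ℚᵘ.≃-sym (toℚᵘ-ι n)) (ℚᵘ.*≤* (subst (ℤ.+ 0 ℤ.≤_) (sym (ℤ.*-identityʳ (ℤ.+ n))) (ℤ.+≤+ z≤n))))

  ι-mono : ∀ {m n} → m ℕ.≤ n → ι m ≤ ι n
  ι-mono {m} {n} m≤n = ≤-certificate (0≤ι (n ℕ.∸ m)) (trans (cong ι (sym (ℕ.m+[n∸m]≡n m≤n))) (ι-+ m (n ℕ.∸ m)))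

  0<ι : ∀ {n} → 0 ℕ.< n → 0ℚ < ι n
  0<ι {n} 0<n = <-≤-trans (positive⁻¹ 1ℚ) (subst (_≤ ι n) ι-1 (ι-mono 0<n))

  abstract
    inv : ℕ → ℚ
    inv zero    = 0ℚ
    inv (suc n) = (1/ ι (suc n)) {{pos⇒nonZero (ι (suc n)) {{positive (0<ι {suc n} (s≤s z≤n))}}}}

    inv-0 : inv 0 ≡ 0ℚ
    inv-0 = refl

    ι*inv : ∀ {n} → 0 ℕ.< n → ι n * inv n ≡ 1ℚ
    ι*inv {suc n} _ = *-inverseʳ (ι (suc n)) {{pos⇒nonZero (ι (suc n)) {{positive (0<ι {suc n} (s≤s z≤n))}}}}

  0≤inv : ∀ n → 0ℚ ≤ inv n
  0≤inv zero    = ≤-reflexive (sym inv-0)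
  0≤inv (suc n) = *-cancelˡ (0<ι {suc n} (s≤s z≤n))
    (subst₂ _≤_ (sym (*-zeroʳ (ι (suc n)))) (sym (ι*inv {suc n} (s≤s z≤n))) 0≤1)

  inv-antimono : ∀ {m n} → 0 ℕ.< m → m ℕ.≤ n → inv n ≤ inv m
  inv-antimono {m} {n} 0<m m≤n = begin
    inv n                   ≡⟨ *-identityʳ (inv n) ⟨
    inv n * 1ℚ              ≡⟨ cong (inv n *_) (ι*inv 0<m) ⟨
    inv n * (ι m * inv m)   ≤⟨ *-monoˡ (0≤inv n) (*-monoʳ (0≤inv m) (ι-mono m≤n)) ⟩
    inv n * (ι n * inv m)   ≡⟨ solve 3 (λ x y z → x :* (y :* z) := (y :* x) :* z) refl (inv n) (ι n) (inv m) ⟩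
    (ι n * inv n) * inv m   ≡⟨ cong (_* inv m) (ι*inv (ℕ.<-≤-trans 0<m m≤n)) ⟩
    1ℚ * inv m              ≡⟨ *-identityˡ (inv m) ⟩
    inv m                   ∎
    where open ≤-Reasoning

  -- Finite sums and products, and the tangent inequality

  private
    variable
      A B : Set

  ∑ : List A → (A → ℚ) → ℚ
  ∑ []       f = 0ℚ
  ∑ (x ∷ xs) f = f x + ∑ xs f

  ∑-cong : ∀ (xs : List A) {f g : A → ℚ} → (∀ x → f x ≡ g x) → ∑ xs f ≡ ∑ xs g
  ∑-cong []       eq = refl
  ∑-cong (x ∷ xs) eq = cong₂ _+_ (eq x) (∑-cong xs eq)

  ∑-mono-∈ : ∀ (xs : List A) {f g : A → ℚ} → (∀ {x} → x ∈ˡ xs → f x ≤ g x) → ∑ xs f ≤ ∑ xs g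
  ∑-mono-∈ []       le = ≤-refl
  ∑-mono-∈ (x ∷ xs) le = +-mono-≤ (le (here refl)) (∑-mono-∈ xs (le ∘ there))

  ∑-mono : ∀ (xs : List A) {f g : A → ℚ} → (∀ x → f x ≤ g x) → ∑ xs f ≤ ∑ xs g
  ∑-mono xs le = ∑-mono-∈ xs (λ {x} _ → le x)

  ∑-nonNeg : ∀ (xs : List A) {f : A → ℚ} → (∀ x → 0ℚ ≤ f x) → 0ℚ ≤ ∑ xs f
  ∑-nonNeg []       nn = ≤-refl
  ∑-nonNeg (x ∷ xs) nn = +-nonNeg (nn x) (∑-nonNeg xs nn)

  ∑-zero : ∀ (xs : List A) → ∑ xs (λ _ → 0ℚ) ≡ 0ℚ
  ∑-zero []       = refl
  ∑-zero (x ∷ xs) = trans (+-identityˡ _) (∑-zero xs)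

  ∑-const : ∀ (xs : List A) c → ∑ xs (λ _ → c) ≡ ι (length xs) * c
  ∑-const []       c = sym (trans (cong (_* c) ι-0) (*-zeroˡ c))
  ∑-const (x ∷ xs) c = trans (cong (_+_ c) (∑-const xs c))
    (trans (solve 2 (λ c l → c :+ l :* c := (con 1ℚ :+ l) :* c) refl c (ι (length xs)))
      (cong (_* c) (sym (ι-suc (length xs)))))

  ∑-+ : ∀ (xs : List A) (f g : A → ℚ) → ∑ xs (λ x → f x + g x) ≡ ∑ xs f + ∑ xs g
  ∑-+ []       f g = refl
  ∑-+ (x ∷ xs) f g = trans (cong (_+_ (f x + g x)) (∑-+ xs f g))
    (solve 4 (λ a b c d → (a :+ b) :+ (c :+ d) := (a :+ c) :+ (b :+ d)) refl (f x) (g x) (∑ xs f) (∑ xs g))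

  ∑-*ˡ : ∀ (xs : List A) c (f : A → ℚ) → ∑ xs (λ x → c * f x) ≡ c * ∑ xs f
  ∑-*ˡ []       c f = sym (*-zeroʳ c)
  ∑-*ˡ (x ∷ xs) c f = trans (cong (_+_ (c * f x)) (∑-*ˡ xs c f)) (sym (*-distribˡ-+ c (f x) (∑ xs f)))

  ∑-*ʳ : ∀ (xs : List A) c (f : A → ℚ) → ∑ xs (λ x → f x * c) ≡ ∑ xs f * c
  ∑-*ʳ xs c f = trans (∑-cong xs (λ x → *-comm (f x) c)) (trans (∑-*ˡ xs c f) (*-comm c (∑ xs f)))

  ∑-swap : ∀ (xs : List A) (ys : List B) (f : A → B → ℚ) →
           ∑ xs (λ x → ∑ ys (f x)) ≡ ∑ ys (λ y → ∑ xs (λ x → f x y))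
  ∑-swap []       ys f = sym (∑-zero ys)
  ∑-swap (x ∷ xs) ys f = trans (cong (_+_ (∑ ys (f x))) (∑-swap xs ys f))
    (sym (∑-+ ys (f x) (λ y → ∑ xs (λ x → f x y))))

  ∑-++ : ∀ (xs ys : List A) (f : A → ℚ) → ∑ (xs ++ ys) f ≡ ∑ xs f + ∑ ys f
  ∑-++ []       ys f = sym (+-identityˡ _)
  ∑-++ (x ∷ xs) ys f = trans (cong (_+_ (f x)) (∑-++ xs ys f)) (sym (+-assoc (f x) _ _))

  ∑-map : ∀ (h : A → B) (xs : List A) (f : B → ℚ) → ∑ (map h xs) f ≡ ∑ xs (f ∘ h)
  ∑-map h []       f = refl
  ∑-map h (x ∷ xs) f = cong (_+_ (f (h x))) (∑-map h xs f)

  ∑-tabulate : ∀ {n} (h : Fin n → A) (f : A → ℚ) → ∑ (tabulate h) f ≡ ∑ (allFin n) (f ∘ h)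
  ∑-tabulate {n = zero}  h f = refl
  ∑-tabulate {n = suc n} h f = cong (_+_ (f (h zero)))
    (trans (∑-tabulate (h ∘ suc) f) (sym (∑-tabulate suc (f ∘ h))))

  ∑-allFin-suc : ∀ n (f : Fin (suc n) → ℚ) → ∑ (allFin (suc n)) f ≡ f zero + ∑ (allFin n) (f ∘ suc)
  ∑-allFin-suc n f = cong (_+_ (f zero)) (∑-tabulate suc f)

  ∏ : List A → (A → ℚ) → ℚ
  ∏ []       f = 1ℚ
  ∏ (x ∷ xs) f = f x * ∏ xs f

  ∏-nonNeg : ∀ (xs : List A) {f : A → ℚ} → (∀ x → 0ℚ ≤ f x) → 0ℚ ≤ ∏ xs f
  ∏-nonNeg []       nn = 0≤1
  ∏-nonNeg (x ∷ xs) nn = *-nonNeg (nn x) (∏-nonNeg xs nn)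

  -- b ^ (l + 1) lies above its tangent at b = a.
  tangent : ∀ l {a b} → 0ℚ ≤ a → 0ℚ ≤ b → (1ℚ + ι l) * b * a ^ l - ι l * a ^ suc l ≤ b ^ suc l
  tangent zero {a} {b} 0≤a 0≤b = ≤-reflexive (trans
    (cong (λ t → (1ℚ + t) * b * 1ℚ - t * (a * 1ℚ)) ι-0)
    (solve 2 (λ a b → (con 1ℚ :+ con 0ℚ) :* b :* con 1ℚ :- con 0ℚ :* (a :* con 1ℚ) := b :* con 1ℚ) refl a b))
  tangent (suc l) {a} {b} 0≤a 0≤b = ≤-trans
    (≤-certificate (*-nonNeg (*-nonNeg (+-nonNeg 0≤1 (0≤ι l)) (^-nonNeg 0≤a l)) square)
      (trans
        (solve 4 (λ a b l p →
          b :* ((con 1ℚ :+ l) :* b :* p :- l :* (a :* p)) :=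
          ((con 1ℚ :+ (con 1ℚ :+ l)) :* b :* (a :* p) :- (con 1ℚ :+ l) :* (a :* (a :* p)))
            :+ (con 1ℚ :+ l) :* p :* ((a :- b) :* (a :- b))) refl a b (ι l) (a ^ l))
        (cong (λ t → ((1ℚ + t) * b * (a * a ^ l) - t * (a * (a * a ^ l))) + (1ℚ + ι l) * a ^ l * ((a - b) * (a - b)))
          (sym (ι-suc l)))))
    (*-monoˡ 0≤b (tangent l 0≤a 0≤b))
    where
    square : 0ℚ ≤ (a - b) * (a - b)
    square with ≤-total 0ℚ (a - b)
    ... | inj₁ nn = *-nonNeg nn nn

    ... | inj₂ np = subst (0ℚ ≤_) (solve 1 (λ x → (:- x) :* (:- x) := x :* x) refl (a - b))
      (*-nonNeg (neg-antimono-≤ np) (neg-antimono-≤ np))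

  -- The AM-GM inequality and the number of supersets

  -- AM-GM for the values of `y` and one extra number, chosen so that the mean of all is `a`. If the
  -- extra number is not positive, the left side is at most 0. Otherwise `y x` is removed: the
  -- remaining numbers have mean `b`, the induction hypothesis bounds their product by a power of
  -- `b`, and `tangent` at `b` returns to `a`.
  am-gm-scaled : ∀ (xs : List A) {y : A → ℚ} → (∀ x → 0ℚ ≤ y x) → ∀ {a} → 0ℚ ≤ a →
                 ((1ℚ + ι (length xs)) * a - ∑ xs y) * ∏ xs y ≤ a ^ suc (length xs)
  am-gm-scaled []       nn {a} 0≤a = ≤-reflexive (trans
    (cong (λ t → ((1ℚ + t) * a - 0ℚ) * 1ℚ) ι-0)
    (solve 1 (λ a → ((con 1ℚ :+ con 0ℚ) :* a :- con 0ℚ) :* con 1ℚ := a :* con 1ℚ) refl a))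
  am-gm-scaled (x ∷ xs) {y} nn {a} 0≤a with ≤-total 0ℚ ((1ℚ + ι (suc (length xs))) * a - (y x + ∑ xs y))
  ... | inj₂ z≤0 = ≤-trans (≤-certificate (*-nonNeg (neg-antimono-≤ z≤0) (∏-nonNeg (x ∷ xs) nn))
        (solve 2 (λ z p → con 0ℚ := z :* p :+ (:- z) :* p) refl ((1ℚ + ι (suc (length xs))) * a - (y x + ∑ xs y)) (∏ (x ∷ xs) y)))
      (^-nonNeg 0≤a (suc (suc (length xs))))
  ... | inj₁ 0≤z = begin
    z * (y x * ∏ xs y)                ≡⟨ solve 3 (λ z u p → z :* (u :* p) := u :* (z :* p)) refl z (y x) (∏ xs y) ⟩
    y x * (z * ∏ xs y)                ≡⟨ cong (λ t → y x * (t * ∏ xs y)) z≡ ⟩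
    y x * ((l * b - ∑ xs y) * ∏ xs y) ≤⟨ *-monoˡ (nn x) (am-gm-scaled xs nn 0≤b) ⟩
    y x * b ^ suc k                   ≡⟨ cong (_* b ^ suc k) y≡ ⟩
    ((1ℚ + ι (suc k)) * a - l * b) * b ^ suc k
      ≡⟨ cong (λ t → ((1ℚ + ι (suc k)) * a - t * b) * b ^ suc k) (sym (ι-suc k)) ⟩
    ((1ℚ + ι (suc k)) * a - ι (suc k) * b) * b ^ suc k
      ≡⟨ solve 4 (λ m a b p → ((con 1ℚ :+ m) :* a :- m :* b) :* p := (con 1ℚ :+ m) :* a :* p :- m :* (b :* p)) refl (ι (suc k)) a b (b ^ suc k) ⟩
    (1ℚ + ι (suc k)) * a * b ^ suc k - ι (suc k) * b ^ suc (suc k)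
      ≤⟨ tangent (suc k) 0≤b 0≤a ⟩
    a ^ suc (suc k) ∎
    where
    open ≤-Reasoning
    k = length xs
    l = 1ℚ + ι k
    z = (1ℚ + ι (suc k)) * a - (y x + ∑ xs y)
    b = inv (suc k) * (z + ∑ xs y)
    0≤b : 0ℚ ≤ b
    0≤b = *-nonNeg (0≤inv (suc k)) (+-nonNeg 0≤z (∑-nonNeg xs nn))
    l*b≡ : l * b ≡ z + ∑ xs y
    l*b≡ = trans (sym (*-assoc l (inv (suc k)) (z + ∑ xs y)))
      (trans (cong (_* (z + ∑ xs y)) (trans (cong (_* inv (suc k)) (sym (ι-suc k))) (ι*inv {suc k} (s≤s z≤n))))
        (*-identityˡ _))
    z≡ : z ≡ l * b - ∑ xs y
    z≡ = trans (solve 2 (λ z s → z := z :+ s :- s) refl z (∑ xs y)) (cong (_- ∑ xs y) (sym l*b≡))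
    y≡ : y x ≡ (1ℚ + ι (suc k)) * a - l * b
    y≡ = trans (solve 3 (λ m u s → u := m :- ((m :- (u :+ s)) :+ s)) refl ((1ℚ + ι (suc k)) * a) (y x) (∑ xs y))
      (cong (λ t → (1ℚ + ι (suc k)) * a - t) (sym l*b≡))

  -- The case `a = 1`. For positive `y`, division by `∏ xs y` gives an affine lower bound for the
  -- product of the reciprocals.
  am-gm : ∀ (xs : List A) {y : A → ℚ} → (∀ x → 0ℚ ≤ y x) → (1ℚ + ι (length xs) - ∑ xs y) * ∏ xs y ≤ 1ℚ
  am-gm xs {y} nn = subst₂ _≤_ (cong (λ t → (t - ∑ xs y) * ∏ xs y) (*-identityʳ (1ℚ + ι (length xs)))) (1^ (suc (length xs)))
    (am-gm-scaled xs nn 0≤1)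
    where
    1^ : ∀ k → 1ℚ ^ k ≡ 1ℚ
    1^ zero    = refl
    1^ (suc k) = trans (*-identityˡ _) (1^ k)

  bit : Bool → ℚ
  bit true  = 1ℚ
  bit false = 0ℚ

  0≤bit : ∀ b → 0ℚ ≤ bit b
  0≤bit true  = 0≤1
  0≤bit false = ≤-refl

  δ : ℕ → ℕ → ℚ
  δ zero    zero    = 1ℚ
  δ zero    (suc n) = 0ℚ
  δ (suc m) zero    = 0ℚ
  δ (suc m) (suc n) = δ m n

  0≤δ : ∀ m n → 0ℚ ≤ δ m n
  0≤δ zero    zero    = 0≤1
  0≤δ zero    (suc n) = ≤-refl
  0≤δ (suc m) zero    = ≤-refl
  0≤δ (suc m) (suc n) = 0≤δ m n

  δ-zero : ∀ {m n} → m ≢ n → δ m n ≡ 0ℚ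
  δ-zero {zero}  {zero}  m≢n = contradiction refl m≢n
  δ-zero {zero}  {suc n} m≢n = refl
  δ-zero {suc m} {zero}  m≢n = refl
  δ-zero {suc m} {suc n} m≢n = δ-zero (m≢n ∘ cong suc)

  δ-subst : ∀ (f : ℕ → ℚ) m n → δ m n * f m ≡ δ m n * f n
  δ-subst f zero    zero    = refl
  δ-subst f zero    (suc n) = trans (*-zeroˡ (f zero)) (sym (*-zeroˡ (f (suc n))))
  δ-subst f (suc m) zero    = trans (*-zeroˡ (f (suc m))) (sym (*-zeroˡ (f zero)))
  δ-subst f (suc m) (suc n) = δ-subst (f ∘ suc) m n

  χ : ∀ {n} → Subset n → Fin n → ℚ
  χ X i = bit (lookup X i)

  0≤χ : ∀ {n} (X : Subset n) i → 0ℚ ≤ χ X i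
  0≤χ X i = 0≤bit (lookup X i)

  χ-∩ : ∀ {n} (X Y : Subset n) i → χ (X ∩ Y) i ≡ χ X i * χ Y i
  χ-∩ (inside  ∷ X) (y       ∷ Y) zero    = sym (*-identityˡ (bit y))
  χ-∩ (outside ∷ X) (y       ∷ Y) zero    = sym (*-zeroˡ (bit y))
  χ-∩ (_       ∷ X) (_       ∷ Y) (suc i) = χ-∩ X Y i

  ∑χ : ∀ {n} (X : Subset n) → ∑ (allFin n) (χ X) ≡ ι ∣ X ∣
  ∑χ []            = sym ι-0
  ∑χ {suc n} (inside  ∷ X) = trans (∑-allFin-suc n (χ (inside ∷ X))) (trans (cong (_+_ 1ℚ) (∑χ X)) (sym (ι-suc ∣ X ∣)))
  ∑χ {suc n} (outside ∷ X) = trans (∑-allFin-suc n (χ (outside ∷ X))) (trans (+-identityˡ _) (∑χ X))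

  subsets : ∀ n → List (Subset n)
  subsets zero    = [] ∷ []
  subsets (suc n) = map (inside ∷_) (subsets n) ++ map (outside ∷_) (subsets n)

  ∑-subsets-suc : ∀ n (f : Subset (suc n) → ℚ) →
    ∑ (subsets (suc n)) f ≡ ∑ (subsets n) (f ∘ (inside ∷_)) + ∑ (subsets n) (f ∘ (outside ∷_))
  ∑-subsets-suc n f = trans (∑-++ (map (inside ∷_) (subsets n)) _ f)
    (cong₂ _+_ (∑-map (inside ∷_) (subsets n) f) (∑-map (outside ∷_) (subsets n) f))

  ⟦_⊑_⟧ : ∀ {n} → Subset n → Subset n → ℚ
  ⟦ X ⊑ Y ⟧ = bit (does (X ⊆? Y))

  0≤⟦⊑⟧ : ∀ {n} (X Y : Subset n) → 0ℚ ≤ ⟦ X ⊑ Y ⟧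
  0≤⟦⊑⟧ X Y = 0≤bit (does (X ⊆? Y))

  k*nCk : ∀ n k → suc k ℕ.* (suc n C suc k) ≡ suc n ℕ.* (n C k)
  k*nCk zero    zero    = refl
  k*nCk zero    (suc k) = trans (cong (suc (suc k) ℕ.*_) (k>n⇒nCk≡0 {1} {suc (suc k)} (s≤s (s≤s z≤n))))
    (trans (ℕ.*-zeroʳ (suc (suc k))) (sym (trans (ℕ.*-identityˡ (0 C suc k)) (k>n⇒nCk≡0 {0} {suc k} (s≤s z≤n)))))
  k*nCk (suc n) zero    = trans (ℕ.*-identityˡ _) (trans (sym (nCk+nC[k+1]≡[n+1]C[k+1] (suc n) 0))
    (cong suc (trans (sym (ℕ.*-identityˡ _)) (k*nCk n 0))))
  k*nCk (suc n) (suc k) = begin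
    suc (suc k) ℕ.* (suc (suc n) C suc (suc k))
      ≡⟨ cong (suc (suc k) ℕ.*_) (sym (nCk+nC[k+1]≡[n+1]C[k+1] (suc n) (suc k))) ⟩
    suc (suc k) ℕ.* (x ℕ.+ suc n C suc (suc k))
      ≡⟨ ℕ.*-distribˡ-+ (suc (suc k)) x _ ⟩
    (x ℕ.+ suc k ℕ.* x) ℕ.+ suc (suc k) ℕ.* (suc n C suc (suc k))
      ≡⟨ cong₂ (λ u v → (x ℕ.+ u) ℕ.+ v) (k*nCk n k) (k*nCk n (suc k)) ⟩
    (x ℕ.+ suc n ℕ.* (n C k)) ℕ.+ suc n ℕ.* (n C suc k)
      ≡⟨ ℕ.+-assoc x _ _ ⟩
    x ℕ.+ (suc n ℕ.* (n C k) ℕ.+ suc n ℕ.* (n C suc k))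
      ≡⟨ cong (x ℕ.+_) (ℕ.*-distribˡ-+ (suc n) (n C k) (n C suc k)) ⟨
    x ℕ.+ suc n ℕ.* (n C k ℕ.+ n C suc k)
      ≡⟨ cong (λ t → x ℕ.+ suc n ℕ.* t) (nCk+nC[k+1]≡[n+1]C[k+1] n k) ⟩
    suc (suc n) ℕ.* x ∎
    where
    open ≡-Reasoning
    x = suc n C suc k

  0<nCk : ∀ {n k} → k ℕ.≤ n → 0 ℕ.< n C k
  0<nCk {n}     {zero}  _         = s≤s z≤n
  0<nCk {suc n} {suc k} (s≤s k≤n) = subst (0 ℕ.<_) (nCk+nC[k+1]≡[n+1]C[k+1] n k)
    (ℕ.<-≤-trans (0<nCk k≤n) (ℕ.m≤m+n _ _))

  -- Pascal's rule along the vector: an element outside `X` is either put into `S`, which uses up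
  -- one of the `t` free places, or left out.
  count-supersets : ∀ {n} (X : Subset n) t →
    ∑ (subsets n) (λ S → δ ∣ S ∣ (∣ X ∣ ℕ.+ t) * ⟦ X ⊑ S ⟧) ≡ ι ((n ℕ.∸ ∣ X ∣) C t)
  count-supersets []            zero    = sym ι-1
  count-supersets []            (suc t) = sym (trans (cong ι (k>n⇒nCk≡0 {0} {suc t} (s≤s z≤n))) ι-0)
  count-supersets {suc n} (inside  ∷ X) t = trans (∑-subsets-suc n _)
    (trans (cong₂ _+_ (count-supersets X t)
      (trans (∑-cong (subsets n) (λ S → *-zeroʳ (δ ∣ S ∣ (suc ∣ X ∣ ℕ.+ t)))) (∑-zero (subsets n))))
      (+-identityʳ _))
  count-supersets {suc n} (outside ∷ X) zero = trans (∑-subsets-suc n _)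
    (trans (cong₂ _+_ (trans (∑-cong (subsets n) none) (∑-zero (subsets n))) (count-supersets X zero))
      (+-identityˡ _))
    where
    none : ∀ S → δ (suc ∣ S ∣) (∣ X ∣ ℕ.+ 0) * ⟦ X ⊑ S ⟧ ≡ 0ℚ
    none S with X ⊆? S
    ... | no  _   = *-zeroʳ (δ (suc ∣ S ∣) (∣ X ∣ ℕ.+ 0))
    ... | yes X⊆S = trans (*-identityʳ _) (δ-zero λ eq → ℕ.<-irrefl (sym (trans eq (ℕ.+-identityʳ ∣ X ∣))) (s≤s (p⊆q⇒∣p∣≤∣q∣ X⊆S)))
  count-supersets {suc n} (outside ∷ X) (suc t) = begin
    ∑ (subsets (suc n)) (λ S → δ ∣ S ∣ (∣ X ∣ ℕ.+ suc t) * ⟦ outside ∷ X ⊑ S ⟧)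
      ≡⟨ ∑-subsets-suc n _ ⟩
    ∑ (subsets n) (λ S → δ (suc ∣ S ∣) (∣ X ∣ ℕ.+ suc t) * ⟦ X ⊑ S ⟧) + ∑ (subsets n) (λ S → δ ∣ S ∣ (∣ X ∣ ℕ.+ suc t) * ⟦ X ⊑ S ⟧)
      ≡⟨ cong₂ _+_ (trans (∑-cong (subsets n) (λ S → cong (λ k → δ (suc ∣ S ∣) k * ⟦ X ⊑ S ⟧) (ℕ.+-suc ∣ X ∣ t))) (count-supersets X t))
           (count-supersets X (suc t)) ⟩
    ι (m C t) + ι (m C suc t)
      ≡⟨ ι-+ (m C t) (m C suc t) ⟨
    ι (m C t ℕ.+ m C suc t)
      ≡⟨ cong ι (nCk+nC[k+1]≡[n+1]C[k+1] m t) ⟩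
    ι (suc m C suc t)
      ≡⟨ cong (λ k → ι (k C suc t)) (sym (ℕ.+-∸-assoc 1 (∣p∣≤n X))) ⟩
    ι ((suc n ℕ.∸ ∣ X ∣) C suc t) ∎
    where
    open ≡-Reasoning
    m = n ℕ.∸ ∣ X ∣

  ∣insert∣ : ∀ {n} (X : Subset n) j → lookup X j ≡ outside → ∣ X [ j ]≔ inside ∣ ≡ suc ∣ X ∣
  ∣insert∣ (outside ∷ X) zero    eq = refl
  ∣insert∣ (inside  ∷ X) (suc j) eq = cong suc (∣insert∣ X j eq)
  ∣insert∣ (outside ∷ X) (suc j) eq = ∣insert∣ X j eq

  insert-⊑ : ∀ {n} (X : Subset n) j S → ⟦ X [ j ]≔ inside ⊑ S ⟧ ≡ ⟦ X ⊑ S ⟧ * χ S j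
  insert-⊑ (inside  ∷ X) zero    (inside  ∷ S) = sym (*-identityʳ _)
  insert-⊑ (inside  ∷ X) zero    (outside ∷ S) = refl
  insert-⊑ (outside ∷ X) zero    (inside  ∷ S) = sym (*-identityʳ _)
  insert-⊑ (outside ∷ X) zero    (outside ∷ S) = sym (*-zeroʳ ⟦ X ⊑ S ⟧)
  insert-⊑ (inside  ∷ X) (suc j) (inside  ∷ S) = insert-⊑ X j S
  insert-⊑ (inside  ∷ X) (suc j) (outside ∷ S) = sym (*-zeroˡ (χ S j))
  insert-⊑ (outside ∷ X) (suc j) (_       ∷ S) = insert-⊑ X j S

  module _ {n s} (s≤n : s ℕ.≤ n) where

    -- The two binomials have the exact ratio (s - c) / (n - c). It is at most s / n because s ≤ n,
    -- and at least (s - c) / n, which is the bound that follows.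
    ratio-upper : ∀ {c} → c ℕ.< s →
      ((n ℕ.∸ suc c) C (s ℕ.∸ suc c)) ℕ.* n ℕ.≤ s ℕ.* ((n ℕ.∸ c) C (s ℕ.∸ c))
    ratio-lower : ∀ {c} → c ℕ.< s →
      (s ℕ.∸ c) ℕ.* ((n ℕ.∸ c) C (s ℕ.∸ c)) ℕ.≤ n ℕ.* ((n ℕ.∸ suc c) C (s ℕ.∸ suc c))

    private
      predecessor : ∀ {c k} → c ℕ.< k → k ℕ.∸ c ≡ suc (k ℕ.∸ suc c)
      predecessor {zero}  {suc k} _         = refl
      predecessor {suc c} {suc k} (s≤s c<k) = predecessor c<k

    ratio-upper {c} c<s rewrite predecessor c<s | predecessor (ℕ.<-≤-trans c<s s≤n) = begin
      x ℕ.* n                         ≡⟨ cong (x ℕ.*_) (sym (ℕ.m+[n∸m]≡n (ℕ.<-≤-trans c<s s≤n))) ⟩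
      x ℕ.* (suc c ℕ.+ m)             ≡⟨ cong (x ℕ.*_) (sym (ℕ.+-suc c m)) ⟩
      x ℕ.* (c ℕ.+ suc m)             ≡⟨ ℕ.*-distribˡ-+ x c (suc m) ⟩
      x ℕ.* c ℕ.+ x ℕ.* suc m         ≡⟨ cong₂ ℕ._+_ (ℕ.*-comm x c) (trans (ℕ.*-comm x (suc m)) (sym (k*nCk m t))) ⟩
      c ℕ.* x ℕ.+ suc t ℕ.* y         ≤⟨ ℕ.+-monoˡ-≤ _ (ℕ.*-monoʳ-≤ c (ℕ.≤-trans (ℕ.m≤m+n x _) (ℕ.≤-reflexive (nCk+nC[k+1]≡[n+1]C[k+1] m t)))) ⟩
      c ℕ.* y ℕ.+ suc t ℕ.* y         ≡⟨ ℕ.*-distribʳ-+ y c (suc t) ⟨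
      (c ℕ.+ suc t) ℕ.* y             ≡⟨ cong (ℕ._* y) (trans (ℕ.+-suc c t) (ℕ.m+[n∸m]≡n c<s)) ⟩
      s ℕ.* y                         ∎
      where
      open ℕ.≤-Reasoning
      m = n ℕ.∸ suc c
      t = s ℕ.∸ suc c
      x = m C t
      y = suc m C suc t

    ratio-lower {c} c<s rewrite predecessor c<s | predecessor (ℕ.<-≤-trans c<s s≤n) =
      ℕ.≤-trans (ℕ.≤-reflexive (k*nCk (n ℕ.∸ suc c) (s ℕ.∸ suc c)))
        (ℕ.*-monoˡ-≤ _ (ℕ.≤-trans (ℕ.≤-reflexive (sym (predecessor (ℕ.<-≤-trans c<s s≤n)))) (ℕ.m∸n≤m n c)))

  -- Moments of a random set of fixed size

  ∏-* : ∀ (xs : List A) (f g : A → ℚ) → ∏ xs (λ x → f x * g x) ≡ ∏ xs f * ∏ xs g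
  ∏-* []       f g = refl
  ∏-* (x ∷ xs) f g = trans (cong ((f x * g x) *_) (∏-* xs f g))
    (solve 4 (λ a b c d → (a :* b) :* (c :* d) := (a :* c) :* (b :* d)) refl (f x) (g x) (∏ xs f) (∏ xs g))

  ∏-*ˡ : ∀ (xs : List A) c (f : A → ℚ) → ∏ xs (λ x → c * f x) ≡ c ^ length xs * ∏ xs f
  ∏-*ˡ []       c f = refl
  ∏-*ˡ (x ∷ xs) c f = trans (cong ((c * f x) *_) (∏-*ˡ xs c f))
    (solve 4 (λ a b c d → (a :* b) :* (c :* d) := (a :* c) :* (b :* d)) refl c (f x) (c ^ length xs) (∏ xs f))

  ∏-one-∈ : ∀ (xs : List A) {f : A → ℚ} → (∀ {x} → x ∈ˡ xs → f x ≡ 1ℚ) → ∏ xs f ≡ 1ℚ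
  ∏-one-∈ []       eq = refl
  ∏-one-∈ (x ∷ xs) eq = cong₂ _*_ (eq (here refl)) (∏-one-∈ xs (eq ∘ there))

  nonempty⇒0<∣∣ : ∀ {n} {X : Subset n} → Nonempty X → 0 ℕ.< ∣ X ∣
  nonempty⇒0<∣∣ {X = inside  ∷ X} _                          = s≤s z≤n
  nonempty⇒0<∣∣ {X = outside ∷ X} (suc i , Vec.there i∈X) = nonempty⇒0<∣∣ (i , i∈X)

  -- Unnormalised: the sum over the subsets with s elements.
  E : ∀ n → ℕ → (Subset n → ℚ) → ℚ
  E n s f = ∑ (subsets n) (λ S → δ ∣ S ∣ s * f S)

  E-mono : ∀ n s {f g : Subset n → ℚ} → (∀ S → f S ≤ g S) → E n s f ≤ E n s g
  E-mono n s le = ∑-mono (subsets n) (λ S → *-monoˡ (0≤δ ∣ S ∣ s) (le S))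

  E-cong : ∀ n s {f g : Subset n → ℚ} → (∀ S → f S ≡ g S) → E n s f ≡ E n s g
  E-cong n s eq = ∑-cong (subsets n) (λ S → cong (δ ∣ S ∣ s *_) (eq S))

  E-+ : ∀ n s (f g : Subset n → ℚ) → E n s (λ S → f S + g S) ≡ E n s f + E n s g
  E-+ n s f g = trans (∑-cong (subsets n) (λ S → *-distribˡ-+ (δ ∣ S ∣ s) (f S) (g S)))
    (∑-+ (subsets n) (λ S → δ ∣ S ∣ s * f S) (λ S → δ ∣ S ∣ s * g S))

  E-*ˡ : ∀ n s c (f : Subset n → ℚ) → E n s (λ S → c * f S) ≡ c * E n s f
  E-*ˡ n s c f = trans
    (∑-cong (subsets n) (λ S → solve 3 (λ d c f → d :* (c :* f) := c :* (d :* f)) refl (δ ∣ S ∣ s) c (f S)))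
    (∑-*ˡ (subsets n) c (λ S → δ ∣ S ∣ s * f S))

  E-∑ : ∀ n s (xs : List A) (f : A → Subset n → ℚ) →
        E n s (λ S → ∑ xs (λ x → f x S)) ≡ ∑ xs (λ x → E n s (f x))
  E-∑ n s xs f = trans
    (∑-cong (subsets n) (λ S → sym (∑-*ˡ xs (δ ∣ S ∣ s) (λ x → f x S))))
    (∑-swap (subsets n) xs (λ S x → δ ∣ S ∣ s * f x S))

  module Moments {n s : ℕ} (0<s : 0 ℕ.< s) (s≤n : s ℕ.≤ n) where

    0<n : 0 ℕ.< n
    0<n = ℕ.<-≤-trans 0<s s≤n

    -- The probability that a given element belongs to a random `s`-element set.
    p : ℚ
    p = ι s * inv n

    0≤p : 0ℚ ≤ p
    0≤p = *-nonNeg (0≤ι s) (0≤inv n)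

    p*n : p * ι n ≡ ι s
    p*n = trans (solve 3 (λ s i n → s :* i :* n := s :* (n :* i)) refl (ι s) (inv n) (ι n))
      (trans (cong (ι s *_) (ι*inv 0<n)) (*-identityʳ (ι s)))

    0<p : 0ℚ < p
    0<p = *-cancelʳ-<-nonNeg (ι n) {{nonNegative (0≤ι n)}} (subst₂ _<_ (sym (*-zeroˡ (ι n))) (sym p*n) (0<ι 0<s))

    supersets : Subset n → ℚ
    supersets X = E n s ⟦ X ⊑_⟧

    g : ℕ → ℚ
    g c = ι ((n ℕ.∸ c) C (s ℕ.∸ c))

    0≤g : ∀ c → 0ℚ ≤ g c
    0≤g c = 0≤ι ((n ℕ.∸ c) C (s ℕ.∸ c))

    supersets≡ : ∀ X → ∣ X ∣ ℕ.≤ s → supersets X ≡ g ∣ X ∣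
    supersets≡ X X≤s = trans
      (cong (λ k → E n k ⟦ X ⊑_⟧) (sym (ℕ.m+[n∸m]≡n X≤s)))
      (count-supersets X (s ℕ.∸ ∣ X ∣))

    g-upper : ∀ {c} → c ℕ.< s → g (suc c) ≤ p * g c
    g-upper {c} c<s = *-cancelˡ (0<ι 0<n) (begin
      ι n * g (suc c)    ≡⟨ trans (*-comm (ι n) (g (suc c))) (sym (ι-* _ n)) ⟩
      ι _                ≤⟨ ι-mono (ratio-upper s≤n c<s) ⟩
      ι _                ≡⟨ ι-* s _ ⟩
      ι s * g c          ≡⟨ cong (_* g c) p*n ⟨
      p * ι n * g c      ≡⟨ solve 3 (λ p n g → p :* n :* g := n :* (p :* g)) refl p (ι n) (g c) ⟩
      ι n * (p * g c)    ∎)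
      where open ≤-Reasoning

    g-lower : ∀ {c} → c ℕ.< s → p * (1ℚ - ι c * inv s) * g c ≤ g (suc c)
    g-lower {c} c<s = *-cancelˡ (0<ι 0<n) (begin
      ι n * (p * (1ℚ - ι c * inv s) * g c)
        ≡⟨ solve 4 (λ n p r g → n :* (p :* r :* g) := p :* n :* r :* g) refl (ι n) p (1ℚ - ι c * inv s) (g c) ⟩
      p * ι n * (1ℚ - ι c * inv s) * g c
        ≡⟨ cong (λ t → t * (1ℚ - ι c * inv s) * g c) p*n ⟩
      ι s * (1ℚ - ι c * inv s) * g c
        ≡⟨ cong (_* g c) (solve 3 (λ s c i → s :* (con 1ℚ :- c :* i) := s :- c :* (s :* i)) refl (ι s) (ι c) (inv s)) ⟩
      (ι s - ι c * (ι s * inv s)) * g c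
        ≡⟨ cong (λ t → (ι s - ι c * t) * g c) (ι*inv 0<s) ⟩
      (ι s - ι c * 1ℚ) * g c
        ≡⟨ cong (_* g c) (trans (cong (λ t → ι t - ι c * 1ℚ) (sym (ℕ.m+[n∸m]≡n (ℕ.<⇒≤ c<s))))
             (trans (cong (_- ι c * 1ℚ) (ι-+ c (s ℕ.∸ c)))
               (solve 2 (λ c d → c :+ d :- c :* con 1ℚ := d) refl (ι c) (ι (s ℕ.∸ c))))) ⟩
      ι (s ℕ.∸ c) * g c
        ≡⟨ ι-* (s ℕ.∸ c) _ ⟨
      ι _
        ≤⟨ ι-mono (ratio-lower s≤n c<s) ⟩
      ι _
        ≡⟨ ι-* n _ ⟩
      ι n * g (suc c) ∎)
      where open ≤-Reasoning

    -- Iterates `g-lower` as in Bernoulli's inequality: each further element costs a factor of at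
    -- least p (1 - θ), and (1 - θ)(1 - cθ) ≥ 1 - (c + 1)θ.
    g-bound : ∀ {θ} → 0ℚ ≤ θ → θ ≤ 1ℚ → ∀ c → c ℕ.≤ s → (∀ d → d ℕ.< c → ι d * inv s ≤ θ) →
              p ^ c * g 0 * (1ℚ - ι c * θ) ≤ g c
    g-bound {θ} 0≤θ θ≤1 zero c≤s small = ≤-reflexive (trans
      (cong (λ t → 1ℚ * g 0 * (1ℚ - t * θ)) ι-0)
      (solve 2 (λ g t → con 1ℚ :* g :* (con 1ℚ :- con 0ℚ :* t) := g) refl (g 0) θ))
    g-bound {θ} 0≤θ θ≤1 (suc c) c<s small = begin
      p ^ suc c * g 0 * (1ℚ - ι (suc c) * θ)
        ≤⟨ ≤-certificate (*-nonNeg (*-nonNeg (^-nonNeg 0≤p (suc c)) (0≤g 0)) (*-nonNeg (0≤ι c) (*-nonNeg 0≤θ 0≤θ)))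
             (trans (solve 5 (λ p r g c t →
                  p :* (con 1ℚ :- t) :* (r :* g :* (con 1ℚ :- c :* t)) :=
                  p :* r :* g :* (con 1ℚ :- (con 1ℚ :+ c) :* t) :+ p :* r :* g :* (c :* (t :* t))) refl p (p ^ c) (g 0) (ι c) θ)
               (cong (λ t → p ^ suc c * g 0 * (1ℚ - t * θ) + p ^ suc c * g 0 * (ι c * (θ * θ))) (sym (ι-suc c)))) ⟩
      p * (1ℚ - θ) * (p ^ c * g 0 * (1ℚ - ι c * θ))
        ≤⟨ *-monoˡ (*-nonNeg 0≤p (≤⇒0≤- θ≤1)) (g-bound 0≤θ θ≤1 c (ℕ.<⇒≤ c<s) (λ d d<c → small d (ℕ.m≤n⇒m≤1+n d<c))) ⟩
      p * (1ℚ - θ) * g c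
        ≤⟨ *-monoʳ (0≤g c) (*-monoˡ 0≤p (+-monoʳ-≤ 1ℚ (neg-antimono-≤ (small c ℕ.≤-refl)))) ⟩
      p * (1ℚ - ι c * inv s) * g c
        ≤⟨ g-lower c<s ⟩
      g (suc c) ∎
      where open ≤-Reasoning

    module _ (X : Subset n) (X<s : ∣ X ∣ ℕ.< s) where

      N : ℚ
      N = supersets X

      0≤N : 0ℚ ≤ N
      0≤N = ∑-nonNeg (subsets n) (λ S → *-nonNeg (0≤δ ∣ S ∣ s) (0≤⟦⊑⟧ X S))

      -- An element of `X` lies in every superset of `X`, any other one in at most a fraction `p` of
      -- them. Adding the two cases gives a bound linear in `χ X j`, which can then be summed over
      -- `j`.
      one-more : ∀ j → E n s (λ S → ⟦ X ⊑ S ⟧ * χ S j) ≤ (χ X j + p) * N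
      one-more j with lookup X j in eq
      ... | inside = begin
        E n s (λ S → ⟦ X ⊑ S ⟧ * χ S j) ≤⟨ E-mono n s bounded ⟩
        N                               ≤⟨ ≤-certificate (*-nonNeg 0≤p 0≤N)
          (solve 2 (λ p n → (con 1ℚ :+ p) :* n := n :+ p :* n) refl p N) ⟩
        (1ℚ + p) * N                    ∎
        where
        open ≤-Reasoning
        bounded : ∀ S → ⟦ X ⊑ S ⟧ * χ S j ≤ ⟦ X ⊑ S ⟧
        bounded S with lookup S j
        ... | true  = ≤-reflexive (*-identityʳ ⟦ X ⊑ S ⟧)
        ... | false = ≤-trans (≤-reflexive (*-zeroʳ ⟦ X ⊑ S ⟧)) (0≤⟦⊑⟧ X S)
      ... | outside = begin
        E n s (λ S → ⟦ X ⊑ S ⟧ * χ S j) ≡⟨ E-cong n s (λ S → sym (insert-⊑ X j S)) ⟩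
        supersets (X [ j ]≔ inside)     ≡⟨ supersets≡ (X [ j ]≔ inside) (subst (ℕ._≤ s) (sym (∣insert∣ X j eq)) X<s) ⟩
        g ∣ X [ j ]≔ inside ∣            ≡⟨ cong g (∣insert∣ X j eq) ⟩
        g (suc ∣ X ∣)                    ≤⟨ g-upper X<s ⟩
        p * g ∣ X ∣                      ≡⟨ cong (p *_) (supersets≡ X (ℕ.<⇒≤ X<s)) ⟨
        p * N                           ≡⟨ cong (_* N) (+-identityˡ p) ⟨
        (0ℚ + p) * N                    ∎
        where open ≤-Reasoning

      first-moment : ∀ D → E n s (λ S → ⟦ X ⊑ S ⟧ * ι ∣ D ∩ S ∣) ≤ N * (ι ∣ D ∩ X ∣ + p * ι ∣ D ∣)
      first-moment D = begin
        E n s (λ S → ⟦ X ⊑ S ⟧ * ι ∣ D ∩ S ∣)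
          ≡⟨ E-cong n s expand ⟩
        E n s (λ S → ∑ (allFin n) (λ d → χ D d * (⟦ X ⊑ S ⟧ * χ S d)))
          ≡⟨ E-∑ n s (allFin n) (λ d S → χ D d * (⟦ X ⊑ S ⟧ * χ S d)) ⟩
        ∑ (allFin n) (λ d → E n s (λ S → χ D d * (⟦ X ⊑ S ⟧ * χ S d)))
          ≡⟨ ∑-cong (allFin n) (λ d → E-*ˡ n s (χ D d) (λ S → ⟦ X ⊑ S ⟧ * χ S d)) ⟩
        ∑ (allFin n) (λ d → χ D d * E n s (λ S → ⟦ X ⊑ S ⟧ * χ S d))
          ≤⟨ ∑-mono (allFin n) (λ d → *-monoˡ (0≤χ D d) (one-more d)) ⟩
        ∑ (allFin n) (λ d → χ D d * ((χ X d + p) * N))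
          ≡⟨ ∑-cong (allFin n) (λ d → trans
               (solve 4 (λ x y p m → x :* ((y :+ p) :* m) := m :* (x :* y :+ p :* x)) refl (χ D d) (χ X d) p N)
               (cong (λ t → N * (t + p * χ D d)) (sym (χ-∩ D X d)))) ⟩
        ∑ (allFin n) (λ d → N * (χ (D ∩ X) d + p * χ D d))
          ≡⟨ ∑-*ˡ (allFin n) N _ ⟩
        N * ∑ (allFin n) (λ d → χ (D ∩ X) d + p * χ D d)
          ≡⟨ cong (N *_) (trans (∑-+ (allFin n) (χ (D ∩ X)) (λ d → p * χ D d))
               (cong₂ _+_ (∑χ (D ∩ X)) (trans (∑-*ˡ (allFin n) p (χ D)) (cong (p *_) (∑χ D))))) ⟩
        N * (ι ∣ D ∩ X ∣ + p * ι ∣ D ∣) ∎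
        where
        open ≤-Reasoning
        expand : ∀ S → ⟦ X ⊑ S ⟧ * ι ∣ D ∩ S ∣ ≡ ∑ (allFin n) (λ d → χ D d * (⟦ X ⊑ S ⟧ * χ S d))
        expand S = trans (cong (⟦ X ⊑ S ⟧ *_) (sym (∑χ (D ∩ S))))
          (trans (sym (∑-*ˡ (allFin n) ⟦ X ⊑ S ⟧ (χ (D ∩ S))))
            (∑-cong (allFin n) (λ d → trans (cong (⟦ X ⊑ S ⟧ *_) (χ-∩ D S d))
              (solve 3 (λ x y z → x :* (y :* z) := y :* (x :* z)) refl ⟦ X ⊑ S ⟧ (χ D d) (χ S d)))))

    -- The ratio of 1 / (Q + ∣D ∩ S∣), a guaranteed probability of a new element, to its idealised
    -- probability 1 / ∣D∣.
    e-term : ℕ → Subset n → Subset n → ℚ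
    e-term Q D S = ι ∣ D ∣ * inv (Q ℕ.+ ∣ D ∩ S ∣)

    0≤e-term : ∀ Q D S → 0ℚ ≤ e-term Q D S
    0≤e-term Q D S = *-nonNeg (0≤ι ∣ D ∣) (0≤inv (Q ℕ.+ ∣ D ∩ S ∣))

    -- The average weight of one history over the sets of one size. Each large query accounts for
    -- one element of `X`, contained in `S` with probability about `p`, and for one factor of `P`,
    -- which is about 1 / p; `∣X∣≡` lets these cancel. `e₁` bounds the expected number of hidden
    -- elements outside `U`, and `e₂` bounds the reciprocals of p ∣D∣.
    module Leaf
      {Q} (0<Q : 0 ℕ.< Q) (Q<s : Q ℕ.< s)
      {X U : Subset n} {hist : List (Subset n)}
      (∣X∣≡ : ∣ X ∣ ≡ length hist) (∣X∣≤Q : ∣ X ∣ ℕ.≤ Q) (X⊆U : X ⊆ U)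
      {e₁ e₂ : ℚ} (0≤e₁ : 0ℚ ≤ e₁) (0≤e₂ : 0ℚ ≤ e₂)
      (missing : p * ι ∣ ∁ U ∣ ≤ e₁)
      (large : ∀ {D} → D ∈ˡ hist → 0 ℕ.< ∣ D ∣ × ι n * inv (s ℕ.* ∣ D ∣) ≤ e₂)
      where

      X<s : ∣ X ∣ ℕ.< s
      X<s = ℕ.≤-<-trans ∣X∣≤Q Q<s

      l = length hist

      M = N X X<s

      0≤M : 0ℚ ≤ M
      0≤M = 0≤N X X<s

      z : Subset n → ℚ
      z D = ι n * inv (s ℕ.* ∣ D ∣)

      -- The denominator Q + ∣D ∩ S∣ relative to p ∣D∣, hence with mean close to 1.
      y : Subset n → Subset n → ℚ
      y S D = ι (Q ℕ.+ ∣ D ∩ S ∣) * z D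

      0≤z : ∀ D → 0ℚ ≤ z D
      0≤z D = *-nonNeg (0≤ι n) (0≤inv _)

      0≤y : ∀ S D → 0ℚ ≤ y S D
      0≤y S D = *-nonNeg (0≤ι (Q ℕ.+ ∣ D ∩ S ∣)) (0≤z D)

      p*D*z : ∀ {D} → 0 ℕ.< ∣ D ∣ → p * ι ∣ D ∣ * z D ≡ 1ℚ
      p*D*z {D} 0<D = begin
        p * ι ∣ D ∣ * (ι n * inv (s ℕ.* ∣ D ∣))
          ≡⟨ solve 4 (λ p d n i → p :* d :* (n :* i) := p :* n :* d :* i) refl p (ι ∣ D ∣) (ι n) (inv (s ℕ.* ∣ D ∣)) ⟩
        p * ι n * ι ∣ D ∣ * inv (s ℕ.* ∣ D ∣)
          ≡⟨ cong (λ t → t * ι ∣ D ∣ * inv (s ℕ.* ∣ D ∣)) p*n ⟩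
        ι s * ι ∣ D ∣ * inv (s ℕ.* ∣ D ∣)
          ≡⟨ cong (_* inv (s ℕ.* ∣ D ∣)) (ι-* s ∣ D ∣) ⟨
        ι (s ℕ.* ∣ D ∣) * inv (s ℕ.* ∣ D ∣)
          ≡⟨ ι*inv (ℕ.*-mono-≤ 0<s 0<D) ⟩
        1ℚ ∎
        where open ≡-Reasoning

      P : Subset n → ℚ
      P S = ∏ hist (λ D → e-term Q D S)

      0≤P : ∀ S → 0ℚ ≤ P S
      0≤P S = ∏-nonNeg hist (λ D → 0≤e-term Q D S)

      P*y : ∀ S → p ^ l * P S * ∏ hist (y S) ≡ 1ℚ
      P*y S = begin
        p ^ l * P S * ∏ hist (y S)
          ≡⟨ cong (_* ∏ hist (y S)) (∏-*ˡ hist p (λ D → e-term Q D S)) ⟨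
        ∏ hist (λ D → p * e-term Q D S) * ∏ hist (y S)
          ≡⟨ ∏-* hist (λ D → p * e-term Q D S) (y S) ⟨
        ∏ hist (λ D → p * e-term Q D S * y S D)
          ≡⟨ ∏-one-∈ hist one ⟩
        1ℚ ∎
        where
        open ≡-Reasoning
        one : ∀ {D} → D ∈ˡ hist → p * e-term Q D S * y S D ≡ 1ℚ
        one {D} D∈ = trans
          (solve 5 (λ p d i q z → p :* (d :* i) :* (q :* z) := (q :* i) :* (p :* d :* z)) refl
            p (ι ∣ D ∣) (inv (Q ℕ.+ ∣ D ∩ S ∣)) (ι (Q ℕ.+ ∣ D ∩ S ∣)) (z D))
          (cong₂ _*_ (ι*inv (ℕ.<-≤-trans 0<Q (ℕ.m≤m+n Q _))) (p*D*z {D} (proj₁ (large D∈))))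

      -- `p ^ l * P S` is the reciprocal of `∏ hist (y S)`, so AM-GM puts it above an affine
      -- function of the `y S D`.
      linearised : ∀ S → 1ℚ + ι l - ∑ hist (y S) ≤ p ^ l * P S
      linearised S = begin
        a                          ≡⟨ *-identityʳ a ⟨
        a * 1ℚ                     ≡⟨ cong (a *_) (P*y S) ⟨
        a * (b * c)                ≡⟨ solve 3 (λ a b c → a :* (b :* c) := b :* (a :* c)) refl a b c ⟩
        b * (a * c)                ≤⟨ *-monoˡ (*-nonNeg (^-nonNeg 0≤p l) (0≤P S)) (am-gm hist (0≤y S)) ⟩
        b * 1ℚ                     ≡⟨ *-identityʳ b ⟩
        b                          ∎
        where
        open ≤-Reasoning
        a = 1ℚ + ι l - ∑ hist (y S)
        b = p ^ l * P S
        c = ∏ hist (y S)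

      weight : Subset n → ℚ
      weight S = ⟦ X ⊑ S ⟧ * ⟦ S ⊑ U ⟧ * P S

      -- The number 1 - ∣∁U ∩ S∣ stands in for the indicator of S ⊆ U: it is 1 when the inclusion
      -- holds and at most 0 otherwise. With it the minorant needs only first moments.
      lower : Subset n → ℚ
      lower S = (1ℚ + ι l) * ⟦ X ⊑ S ⟧ + - (1ℚ + ι l) * (⟦ X ⊑ S ⟧ * ι ∣ ∁ U ∩ S ∣)
                + - 1ℚ * ∑ hist (λ D → ⟦ X ⊑ S ⟧ * y S D)

      lower≤ : ∀ S → lower S ≤ p ^ l * weight S
      lower≤ S = ≤-trans (≤-reflexive lower≡) core
        where
        σ = ∑ hist (y S)
        lower≡ : lower S ≡ ⟦ X ⊑ S ⟧ * ((1ℚ + ι l) * (1ℚ - ι ∣ ∁ U ∩ S ∣) - σ)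
        lower≡ = trans
          (cong (λ t → (1ℚ + ι l) * ⟦ X ⊑ S ⟧ + - (1ℚ + ι l) * (⟦ X ⊑ S ⟧ * ι ∣ ∁ U ∩ S ∣) + - 1ℚ * t)
            (∑-*ˡ hist ⟦ X ⊑ S ⟧ (y S)))
          (solve 4 (λ l x u s → l :* x :+ (:- l) :* (x :* u) :+ (:- con 1ℚ) :* (x :* s)
            := x :* (l :* (con 1ℚ :- u) :- s)) refl (1ℚ + ι l) ⟦ X ⊑ S ⟧ (ι ∣ ∁ U ∩ S ∣) σ)
        0≤σ : 0ℚ ≤ σ
        0≤σ = ∑-nonNeg hist (0≤y S)
        0≤1+l : 0ℚ ≤ 1ℚ + ι l
        0≤1+l = +-nonNeg 0≤1 (0≤ι l)
        core : ⟦ X ⊑ S ⟧ * ((1ℚ + ι l) * (1ℚ - ι ∣ ∁ U ∩ S ∣) - σ) ≤ p ^ l * weight S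
        core with S ⊆? U
        ... | yes S⊆U = ≤-trans
          (*-monoˡ (0≤⟦⊑⟧ X S) (≤-trans
            (≤-certificate (*-nonNeg 0≤1+l (0≤ι ∣ ∁ U ∩ S ∣))
              (solve 3 (λ l u s → l :- s := (l :* (con 1ℚ :- u) :- s) :+ l :* u) refl (1ℚ + ι l) (ι ∣ ∁ U ∩ S ∣) σ))
            (linearised S)))
          (≤-reflexive (solve 3 (λ x r w → x :* (r :* w) := r :* (x :* con 1ℚ :* w)) refl ⟦ X ⊑ S ⟧ (p ^ l) (P S)))
        ... | no S⊈U = ≤-trans
          (≤-certificate
            (*-nonNeg (0≤⟦⊑⟧ X S) (+-nonNeg (*-nonNeg 0≤1+l (≤⇒0≤- 1≤)) 0≤σ))
            (solve 4 (λ x l u s → con 0ℚ := x :* (l :* (con 1ℚ :- u) :- s) :+ x :* (l :* (u :- con 1ℚ) :+ s)) refl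
              ⟦ X ⊑ S ⟧ (1ℚ + ι l) (ι ∣ ∁ U ∩ S ∣) σ))
          (≤-reflexive (solve 3 (λ x r w → con 0ℚ := r :* (x :* con 0ℚ :* w)) refl ⟦ X ⊑ S ⟧ (p ^ l) (P S)))
          where
          meets : 0 ℕ.< ∣ ∁ U ∩ S ∣
          meets with nonempty? (∁ U ∩ S)
          ... | yes ne = nonempty⇒0<∣∣ ne
          ... | no  em = ⊥-elim (S⊈U λ {x} → S⊆U {x})
            where
            S⊆U : ∀ {x} → x ∈ S → x ∈ U
            S⊆U {x} x∈S with x ∈? U
            ... | yes x∈U = x∈U
            ... | no  x∉U = contradiction (x , x∈p∩q⁺ (x∉p⇒x∈∁p x∉U , x∈S)) em
          1≤ : 1ℚ ≤ ι ∣ ∁ U ∩ S ∣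
          1≤ = subst (_≤ ι ∣ ∁ U ∩ S ∣) ι-1 (ι-mono meets)

      ∁U∩X : ∣ ∁ U ∩ X ∣ ≡ 0
      ∁U∩X with nonempty? (∁ U ∩ X)
      ... | yes (x , x∈) = let x∈∁U , x∈X = x∈p∩q⁻ (∁ U) X x∈ in contradiction (X⊆U x∈X) (x∈∁p⇒x∉p x∈∁U)
      ... | no em = trans (cong ∣_∣ (Empty-unique em)) (∣⊥∣≡0 n)

      mean-missing : E n s (λ S → ⟦ X ⊑ S ⟧ * ι ∣ ∁ U ∩ S ∣) ≤ M * e₁
      mean-missing = ≤-trans (first-moment X X<s (∁ U))
        (*-monoˡ 0≤M (≤-trans (≤-reflexive (trans (cong (λ k → ι k + p * ι ∣ ∁ U ∣) ∁U∩X)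
          (trans (cong (_+ p * ι ∣ ∁ U ∣) ι-0) (+-identityˡ _)))) missing))

      -- The expected number p ∣D∣ of elements contributes exactly 1. The two copies of `Q` are the
      -- one in the definition of `y` and the bound for the elements of `X` that may lie in `D`.
      mean-y : ∀ {D} → D ∈ˡ hist → E n s (λ S → ⟦ X ⊑ S ⟧ * y S D) ≤ M * (1ℚ + (ι Q + ι Q) * e₂)
      mean-y {D} D∈ = begin
        E n s (λ S → ⟦ X ⊑ S ⟧ * y S D)
          ≡⟨ E-cong n s (λ S → trans (cong (λ t → ⟦ X ⊑ S ⟧ * (t * z D)) (ι-+ Q ∣ D ∩ S ∣))
               (solve 4 (λ x q d z → x :* ((q :+ d) :* z) := z :* (q :* x :+ x :* d)) refl ⟦ X ⊑ S ⟧ (ι Q) (ι ∣ D ∩ S ∣) (z D))) ⟩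
        E n s (λ S → z D * (ι Q * ⟦ X ⊑ S ⟧ + ⟦ X ⊑ S ⟧ * ι ∣ D ∩ S ∣))
          ≡⟨ trans (E-*ˡ n s (z D) _) (cong (z D *_) (trans (E-+ n s _ _) (cong (_+ _) (E-*ˡ n s (ι Q) ⟦ X ⊑_⟧)))) ⟩
        z D * (ι Q * M + E n s (λ S → ⟦ X ⊑ S ⟧ * ι ∣ D ∩ S ∣))
          ≤⟨ *-monoˡ (0≤z D) (+-monoʳ-≤ (ι Q * M) (≤-trans (first-moment X X<s D)
               (*-monoˡ 0≤M (+-monoˡ-≤ (p * ι ∣ D ∣) (ι-mono (ℕ.≤-trans (∣p∩q∣≤∣q∣ D X) ∣X∣≤Q)))))) ⟩
        z D * (ι Q * M + M * (ι Q + p * ι ∣ D ∣))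
          ≡⟨ solve 5 (λ z q m p d → z :* (q :* m :+ m :* (q :+ p :* d)) := m :* (p :* d :* z :+ (q :+ q) :* z)) refl
               (z D) (ι Q) M p (ι ∣ D ∣) ⟩
        M * (p * ι ∣ D ∣ * z D + (ι Q + ι Q) * z D)
          ≡⟨ cong (λ t → M * (t + (ι Q + ι Q) * z D)) (p*D*z {D} (proj₁ (large D∈))) ⟩
        M * (1ℚ + (ι Q + ι Q) * z D)
          ≤⟨ *-monoˡ 0≤M (+-monoʳ-≤ 1ℚ (*-monoˡ (+-nonNeg (0≤ι Q) (0≤ι Q)) (proj₂ (large D∈)))) ⟩
        M * (1ℚ + (ι Q + ι Q) * e₂) ∎
        where open ≤-Reasoning

      l≤Q : ι l ≤ ι Q
      l≤Q = ι-mono (subst (ℕ._≤ Q) ∣X∣≡ ∣X∣≤Q)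

      -- In the average of `lower` the main terms 1 + l and -l leave 1. The losses are enlarged from
      -- `l` to `Q`, so that the bound is the same for all histories.
      r : ℚ
      r = 1ℚ - (1ℚ + ι Q) * e₁ - ι Q * ((ι Q + ι Q) * e₂)

      E-lower : M * r ≤ E n s lower
      E-lower = begin
        M * r
          ≤⟨ ≤-certificate (*-nonNeg 0≤M (+-nonNeg (*-nonNeg (≤⇒0≤- l≤Q) 0≤e₁)
               (*-nonNeg (≤⇒0≤- l≤Q) (*-nonNeg (+-nonNeg (0≤ι Q) (0≤ι Q)) 0≤e₂))))
             (solve 5 (λ m l q e f →
               (con 1ℚ :+ l) :* m :+ (:- (con 1ℚ :+ l)) :* (m :* e) :+ (:- con 1ℚ) :* (l :* (m :* (con 1ℚ :+ (q :+ q) :* f)))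
               := m :* (con 1ℚ :- (con 1ℚ :+ q) :* e :- q :* ((q :+ q) :* f))
                  :+ m :* ((q :- l) :* e :+ (q :- l) :* ((q :+ q) :* f))) refl M (ι l) (ι Q) e₁ e₂) ⟩
        (1ℚ + ι l) * M + - (1ℚ + ι l) * (M * e₁) + - 1ℚ * (ι l * (M * (1ℚ + (ι Q + ι Q) * e₂)))
          ≤⟨ +-mono-≤ (+-monoʳ-≤ ((1ℚ + ι l) * M) (neg-mono (+-nonNeg 0≤1 (0≤ι l)) mean-missing))
               (neg-mono 0≤1 (≤-trans (∑-mono-∈ hist mean-y) (≤-reflexive (∑-const hist _)))) ⟩
        (1ℚ + ι l) * M + - (1ℚ + ι l) * E n s (λ S → ⟦ X ⊑ S ⟧ * ι ∣ ∁ U ∩ S ∣)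
          + - 1ℚ * ∑ hist (λ D → E n s (λ S → ⟦ X ⊑ S ⟧ * y S D))
          ≡⟨ sym E-lower≡ ⟩
        E n s lower ∎
        where
        open ≤-Reasoning
        neg-mono : ∀ {c a b} → 0ℚ ≤ c → a ≤ b → - c * b ≤ - c * a
        neg-mono {c} {a} {b} 0≤c a≤b = ≤-certificate (*-nonNeg 0≤c (≤⇒0≤- a≤b))
          (solve 3 (λ c a b → (:- c) :* a := (:- c) :* b :+ c :* (b :- a)) refl c a b)
        E-lower≡ : E n s lower ≡ _
        E-lower≡ = trans (E-+ n s _ _) (cong₂ _+_
          (trans (E-+ n s _ _) (cong₂ _+_ (E-*ˡ n s (1ℚ + ι l) ⟦ X ⊑_⟧)
            (E-*ˡ n s (- (1ℚ + ι l)) (λ S → ⟦ X ⊑ S ⟧ * ι ∣ ∁ U ∩ S ∣))))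
          (trans (E-*ˡ n s (- 1ℚ) (λ S → ∑ hist (λ D → ⟦ X ⊑ S ⟧ * y S D)))
            (cong (- 1ℚ *_) (E-∑ n s hist (λ D S → ⟦ X ⊑ S ⟧ * y S D)))))

      -- The supersets of `X` make up at least p^l (1 - Qθ) of all `s`-element sets, and over them
      -- `p ^ l * weight S` sums to at least `r` times their number. Cancelling p^l leaves a bound
      -- that no longer depends on the history.
      leaf : ∀ {θ} → 0ℚ ≤ θ → ι Q * inv s ≤ θ → θ ≤ 1ℚ → 0ℚ ≤ r →
             ι (n C s) * ((1ℚ - ι Q * θ) * r) ≤ E n s weight
      leaf {θ} 0≤θ Q/s≤θ θ≤1 0≤r = *-cancelˡ (^-pos 0<p l) (begin
        p ^ l * (ι (n C s) * ((1ℚ - ι Q * θ) * r))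
          ≤⟨ ≤-certificate (*-nonNeg (*-nonNeg (*-nonNeg (^-nonNeg 0≤p l) (0≤g 0)) (*-nonNeg (≤⇒0≤- l≤Q) 0≤θ)) 0≤r)
               (solve 6 (λ w g q l t r → w :* g :* (con 1ℚ :- l :* t) :* r :=
                 w :* (g :* ((con 1ℚ :- q :* t) :* r)) :+ w :* g :* ((q :- l) :* t) :* r) refl
                 (p ^ l) (g 0) (ι Q) (ι l) θ r) ⟩
        p ^ l * g 0 * (1ℚ - ι l * θ) * r
          ≡⟨ cong (λ k → p ^ k * g 0 * (1ℚ - ι k * θ) * r) ∣X∣≡ ⟨
        p ^ ∣ X ∣ * g 0 * (1ℚ - ι ∣ X ∣ * θ) * r
          ≤⟨ *-monoʳ 0≤r (g-bound 0≤θ θ≤1 ∣ X ∣ (ℕ.<⇒≤ X<s)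
               (λ d d<X → ≤-trans (*-monoʳ (0≤inv s) (ι-mono (ℕ.≤-trans (ℕ.<⇒≤ d<X) ∣X∣≤Q))) Q/s≤θ)) ⟩
        g ∣ X ∣ * r
          ≡⟨ cong (_* r) (supersets≡ X (ℕ.<⇒≤ X<s)) ⟨
        M * r
          ≤⟨ E-lower ⟩
        E n s lower
          ≤⟨ E-mono n s lower≤ ⟩
        E n s (λ S → p ^ l * weight S)
          ≡⟨ E-*ˡ n s (p ^ l) weight ⟩
        p ^ l * E n s weight ∎)
        where open ≤-Reasoning

  -- Certificates for the loss of adaptive algorithms

  -- Where the conditional oracle of the uniform distribution on `S` places its answers; in the
  -- second case the conditioning set has mass 0.
  support : ∀ {n} → Subset n → Subset n → Subset n
  support A S with nonempty? (A ∩ S)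
  ... | yes _ = A ∩ S
  ... | no  _ = A

  support-≡ : ∀ {n} (A S : Subset n) → Nonempty (A ∩ S) → support A S ≡ A ∩ S
  support-≡ A S ne with nonempty? (A ∩ S)
  ... | yes _ = refl
  ... | no em = contradiction ne em

  support-nonempty : ∀ {n} (A S : Subset n) → Nonempty A → Nonempty (support A S)
  support-nonempty A S ne with nonempty? (A ∩ S)
  ... | yes ne′ = ne′
  ... | no  _   = ne

  support-cong : ∀ {n} (A S T : Subset n) → A ∩ S ≡ A ∩ T → support A S ≡ support A T
  support-cong A S T eq with nonempty? (A ∩ S) | nonempty? (A ∩ T)
  ... | yes _  | yes _  = eq
  ... | yes ne | no em  = contradiction (subst Nonempty eq ne) em
  ... | no em  | yes ne = contradiction (subst Nonempty (sym eq) ne) em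
  ... | no _   | no _   = refl

  uniform : ∀ {n} → Subset n → Fin n → ℚ
  uniform X j = χ X j * inv ∣ X ∣

  0≤uniform : ∀ {n} (X : Subset n) j → 0ℚ ≤ uniform X j
  0≤uniform X j = *-nonNeg (0≤χ X j) (0≤inv ∣ X ∣)

  ∑uniform : ∀ {n} {X : Subset n} → Nonempty X → ∑ (allFin n) (uniform X) ≡ 1ℚ
  ∑uniform {n} {X} ne = trans (∑-*ʳ (allFin n) (inv ∣ X ∣) (χ X))
    (trans (cong (_* inv ∣ X ∣) (∑χ X)) (ι*inv (nonempty⇒0<∣∣ ne)))

  answer : ∀ {n} → Subset n → Subset n → Fin n → ℚ
  answer A S = uniform (support A S)

  module _ {n : ℕ} where

    Weight : Set
    Weight = Subset n → Bool → ℚ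

    -- Quantified over `b` because the algorithm chooses its output, so the weight against either
    -- output must be large. `Cert` asks for it at every depth, since an algorithm may stop with
    -- samples to spare.
    Leafy : Weight → ℚ → Set
    Leafy w c = ∀ b → c ≤ ∑ (subsets n) (λ S → w S b)

    -- w S b is the loss incurred when the hidden set is S and the output is b;
    -- the certificate bounds below the loss of every algorithm with q samples.
    Cert : ℕ → Weight → ℚ → Set
    Cert zero    w c = Leafy w c
    Cert (suc q) w c = Leafy w c × (∀ A → Nonempty A → ∃[ c′ ]
      (∀ j → 0ℚ ≤ c′ j) × c ≤ ∑ (allFin n) c′ × (∀ j → Cert q (λ S b → w S b * answer A S j) (c′ j)))

    Cert-leafy : ∀ q {w c} → Cert q w c → Leafy w c
    Cert-leafy zero    C = C
    Cert-leafy (suc q) C = proj₁ C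

    Leafy-mono : ∀ {w w′ c c′} → (∀ S b → w S b ≤ w′ S b) → c′ ≤ c → Leafy w c → Leafy w′ c′
    Leafy-mono w≤ c≥ L b = ≤-trans c≥ (≤-trans (L b) (∑-mono (subsets n) (λ S → w≤ S b)))

    Leafy-scale : ∀ {w c t} → 0ℚ ≤ t → Leafy w c → Leafy (λ S b → t * w S b) (t * c)
    Leafy-scale {w} {c} {t} 0≤t L b = ≤-trans (*-monoˡ 0≤t (L b)) (≤-reflexive (sym (∑-*ˡ (subsets n) t (λ S → w S b))))

    Leafy-+ : ∀ {w w′ c c′} → Leafy w c → Leafy w′ c′ → Leafy (λ S b → w S b + w′ S b) (c + c′)
    Leafy-+ {w} {w′} L L′ b = ≤-trans (+-mono-≤ (L b) (L′ b))
      (≤-reflexive (sym (∑-+ (subsets n) (λ S → w S b) (λ S → w′ S b))))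

    Leafy-zero : ∀ {w} → (∀ S b → 0ℚ ≤ w S b) → Leafy w 0ℚ
    Leafy-zero 0≤w b = ∑-nonNeg (subsets n) (λ S → 0≤w S b)

    Cert-mono : ∀ q {w w′ c c′} → (∀ S b → w S b ≤ w′ S b) → c′ ≤ c → Cert q w c → Cert q w′ c′
    Cert-mono zero    w≤ c≥ L = Leafy-mono w≤ c≥ L
    Cert-mono (suc q) w≤ c≥ (leafy , step) = Leafy-mono w≤ c≥ leafy , λ A ne →
      let c′ , 0≤c′ , c≤ , certs = step A ne
      in c′ , 0≤c′ , ≤-trans c≥ c≤ , λ j →
         Cert-mono q (λ S b → *-monoʳ (0≤uniform (support A S) j) (w≤ S b)) ≤-refl (certs j)

    Cert-scale : ∀ q {w c t} → 0ℚ ≤ t → Cert q w c → Cert q (λ S b → t * w S b) (t * c)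
    Cert-scale zero    {w} 0≤t L = Leafy-scale {w} 0≤t L
    Cert-scale (suc q) {w} {c} {t} 0≤t (leafy , step) = Leafy-scale {w} 0≤t leafy , λ A ne →
      let c′ , 0≤c′ , c≤ , certs = step A ne
      in (λ j → t * c′ j) , (λ j → *-nonNeg 0≤t (0≤c′ j)) ,
         ≤-trans (*-monoˡ 0≤t c≤) (≤-reflexive (sym (∑-*ˡ (allFin n) t c′))) , λ j →
         Cert-mono q (λ S b → ≤-reflexive (sym (*-assoc t (w S b) (answer A S j)))) ≤-refl
           (Cert-scale q {λ S b → w S b * answer A S j} 0≤t (certs j))

    -- Allows the small and the large scales to be certified separately: one algorithm faces both
    -- weights, and its losses add.
    Cert-+ : ∀ q {w w′ c c′} → Cert q w c → Cert q w′ c′ → Cert q (λ S b → w S b + w′ S b) (c + c′)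
    Cert-+ zero    {w} {w′} L L′ = Leafy-+ {w} {w′} L L′
    Cert-+ (suc q) {w} {w′} (leafy , step) (leafy′ , step′) = Leafy-+ {w} {w′} leafy leafy′ , λ A ne →
      let d  , 0≤d  , c≤  , certs  = step  A ne
          d′ , 0≤d′ , c′≤ , certs′ = step′ A ne
      in (λ j → d j + d′ j) , (λ j → +-nonNeg (0≤d j) (0≤d′ j)) ,
         ≤-trans (+-mono-≤ c≤ c′≤) (≤-reflexive (sym (∑-+ (allFin n) d d′))) , λ j →
         Cert-mono q (λ S b → ≤-reflexive (sym (*-distribʳ-+ (answer A S j) (w S b) (w′ S b)))) ≤-refl
           (Cert-+ q {λ S b → w S b * answer A S j} {λ S b → w′ S b * answer A S j} (certs j) (certs′ j))

    Cert-zero : ∀ q {w} → (∀ S b → 0ℚ ≤ w S b) → Cert q w 0ℚ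
    Cert-zero zero    0≤w = Leafy-zero 0≤w
    Cert-zero (suc q) 0≤w = Leafy-zero 0≤w , λ A ne →
      (λ _ → 0ℚ) , (λ _ → ≤-refl) , ≤-reflexive (sym (∑-zero (allFin n))) , λ j →
      Cert-zero q (λ S b → *-nonNeg (0≤w S b) (0≤uniform (support A S) j))

  ∣∪∣≤ : ∀ {n} (X Y : Subset n) → ∣ X ∪ Y ∣ ℕ.≤ ∣ X ∣ ℕ.+ ∣ Y ∣
  ∣∪∣≤ []            []            = z≤n
  ∣∪∣≤ (inside  ∷ X) (inside  ∷ Y) = s≤s (ℕ.≤-trans (∣∪∣≤ X Y) (ℕ.+-monoʳ-≤ ∣ X ∣ (ℕ.n≤1+n ∣ Y ∣)))
  ∣∪∣≤ (inside  ∷ X) (outside ∷ Y) = s≤s (∣∪∣≤ X Y)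
  ∣∪∣≤ (outside ∷ X) (inside  ∷ Y) = ℕ.≤-trans (s≤s (∣∪∣≤ X Y)) (ℕ.≤-reflexive (sym (ℕ.+-suc ∣ X ∣ ∣ Y ∣)))
  ∣∪∣≤ (outside ∷ X) (outside ∷ Y) = ∣∪∣≤ X Y

  cover : ∀ {n} {X Y Z : Subset n} → (∀ {x} → x ∈ X → x ∈ Y ⊎ x ∈ Z) → ∣ X ∣ ℕ.≤ ∣ Y ∣ ℕ.+ ∣ Z ∣
  cover {Y = Y} {Z} c = ℕ.≤-trans (p⊆q⇒∣p∣≤∣q∣ (λ x∈X → x∈p∪q⁺ (c x∈X))) (∣∪∣≤ Y Z)

  ⊑-yes : ∀ {n} {X Y : Subset n} → X ⊆ Y → ⟦ X ⊑ Y ⟧ ≡ 1ℚ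
  ⊑-yes {X = X} {Y} X⊆Y with X ⊆? Y
  ... | yes _ = refl
  ... | no ¬X⊆Y = contradiction (λ {x} → X⊆Y {x}) ¬X⊆Y

  ⊑-no : ∀ {n} {X Y : Subset n} → ¬ X ⊆ Y → ⟦ X ⊑ Y ⟧ ≡ 0ℚ
  ⊑-no {X = X} {Y} ¬X⊆Y with X ⊆? Y
  ... | yes X⊆Y = contradiction (λ {x} → X⊆Y {x}) ¬X⊆Y
  ... | no _ = refl

  χ-∈ : ∀ {n} {X : Subset n} {j} → j ∈ X → χ X j ≡ 1ℚ
  χ-∈ {X = X} j∈X = cong bit ([]=⇒lookup j∈X)

  χ-∉ : ∀ {n} {X : Subset n} {j} → j ∉ X → χ X j ≡ 0ℚ
  χ-∉ {X = X} {j} j∉X with lookup X j in eq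
  ... | true  = contradiction (lookup⇒[]= j X eq) j∉X
  ... | false = refl

  fraction-≤ : ∀ {a b c d} → 0 ℕ.< b → 0 ℕ.< d → a ℕ.* d ℕ.≤ c ℕ.* b → ι a * inv b ≤ ι c * inv d
  fraction-≤ {a} {b} {c} {d} 0<b 0<d ad≤cb = *-cancelˡ (*-pos (0<ι 0<b) (0<ι 0<d)) (begin
    ι b * ι d * (ι a * inv b)  ≡⟨ solve 4 (λ b d a i → b :* d :* (a :* i) := (b :* i) :* (a :* d)) refl (ι b) (ι d) (ι a) (inv b) ⟩
    (ι b * inv b) * (ι a * ι d) ≡⟨ cong₂ _*_ (ι*inv 0<b) (sym (ι-* a d)) ⟩
    1ℚ * ι (a ℕ.* d)           ≤⟨ *-monoˡ 0≤1 (ι-mono ad≤cb) ⟩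
    1ℚ * ι (c ℕ.* b)           ≡⟨ cong₂ _*_ (sym (ι*inv 0<d)) (ι-* c b) ⟩
    (ι d * inv d) * (ι c * ι b) ≡⟨ solve 4 (λ b d c i → (d :* i) :* (c :* b) := b :* d :* (c :* i)) refl (ι b) (ι d) (ι c) (inv d) ⟩
    ι b * ι d * (ι c * inv d)  ∎)
    where open ≤-Reasoning

  -- The game of the hidden scale against an adaptive algorithm

  module Game
    -- size κ b is a size for which the output b is wrong
    {n Q B : ℕ} (size : ℕ → Bool → ℕ)
    (0<Q : 0 ℕ.< Q) (64Q²≤B : 64 ℕ.* (Q ℕ.* Q) ℕ.≤ B)
    (sizes-mono : ∀ κ → size κ false ℕ.≤ size κ true)
    (gap : ∀ {κ κ′} → κ ℕ.< κ′ → size κ true ℕ.* (B ℕ.* B) ℕ.≤ size κ′ false)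
    where

    size≥ : ∀ κ b → size κ false ℕ.≤ size κ b
    size≥ κ false = ℕ.≤-refl
    size≥ κ true  = sizes-mono κ

    size≤ : ∀ κ b → size κ b ℕ.≤ size κ true
    size≤ κ false = sizes-mono κ
    size≤ κ true  = ℕ.≤-refl

    4Q≤B : 4 ℕ.* Q ℕ.≤ B
    4Q≤B = ℕ.≤-trans (ℕ.*-mono-≤ {4} {64} (ℕ.m≤m+n 4 60) (ℕ.≤-trans (ℕ.≤-reflexive (sym (ℕ.*-identityʳ Q))) (ℕ.*-monoʳ-≤ Q 0<Q))) 64Q²≤B

    Q<B : Q ℕ.< B
    Q<B = ℕ.<-≤-trans (ℕ.m<m+n Q (ℕ.≤-trans 0<Q (ℕ.m≤m+n Q _))) 4Q≤B

    0<B : 0 ℕ.< B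
    0<B = ℕ.≤-<-trans z≤n Q<B

    record State : Set where
      constructor state
      field
        X U  : Subset n
        hist : List (Subset n)

    open State

    -- After a history, X is the set of hidden elements found so far, S ⊆ U is all
    -- that is known otherwise, and hist lists the sets of possible new elements of
    -- the large queries.  For such a query A with set D, ∣ A ∩ S ∣ ≤ Q + ∣ D ∩ S ∣,
    -- so V bounds below the probability of the history under S relative to the
    -- idealised answers, which are uniform on D.  The factor 9 / 8 pays for the
    -- loss in the averaging over S.
    V : State → Subset n → ℚ
    V st S = ℤ.+ 9 / 8 * inv (n C ∣ S ∣) *
      (⟦ X st ⊑ S ⟧ * ⟦ S ⊑ U st ⟧ * ∏ (hist st) (λ D → ι ∣ D ∣ * inv (Q ℕ.+ ∣ D ∩ S ∣)))

    multiplicity : List ℕ → ℕ → Bool → ℚ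
    multiplicity K s b = ∑ K (λ κ → δ s (size κ b))

    0≤multiplicity : ∀ K s b → 0ℚ ≤ multiplicity K s b
    0≤multiplicity K s b = ∑-nonNeg K (λ κ → 0≤δ s (size κ b))

    weights : List ℕ → State → Weight {n}
    weights K st S b = multiplicity K ∣ S ∣ b * V st S

    -- Cleared of denominators, `missing` says that a random set of the size in question has on
    -- average at most d / B elements outside `U`, and `large` that it has on average at least B / 2
    -- in `D`. Each is stated for the less favourable of the two sizes.
    record Inv (d : ℕ) (st : State) (κ : ℕ) : Set where
      field
        B≤size  : B ℕ.≤ size κ false
        size≤n  : size κ true ℕ.≤ n
        ∣X∣≡    : ∣ X st ∣ ≡ length (hist st)
        ∣X∣≤    : ∣ X st ∣ ℕ.≤ d
        X⊆U     : X st ⊆ U st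
        missing : ∣ ∁ (U st) ∣ ℕ.* size κ true ℕ.* B ℕ.≤ d ℕ.* n
        large   : ∀ {D} → D ∈ˡ hist st → n ℕ.* B ℕ.≤ 2 ℕ.* ∣ D ∣ ℕ.* size κ false

    positive-size : ∀ {D κ} → B ℕ.≤ size κ false → size κ true ℕ.≤ n → n ℕ.* B ℕ.≤ 2 ℕ.* D ℕ.* size κ false → 0 ℕ.< D
    positive-size {suc D} _ _ _ = s≤s z≤n
    positive-size {zero} {κ} B≤ ≤n nB≤ = contradiction (ℕ.≤-trans (ℕ.*-mono-≤ (ℕ.≤-trans 0<B (ℕ.≤-trans B≤ (ℕ.≤-trans (sizes-mono κ) ≤n))) 0<B) nB≤) λ ()

    -- For either output, the average of `V` over the sets of the corresponding size is at least 1
    -- at every scale of `K`.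
    leafy : ∀ {d st K} → d ℕ.≤ Q → All (Inv d st) K → Leafy (weights K st) (ι (length K))
    leafy {d} {st} {K} d≤Q inv-K b = begin
      ι (length K)                                          ≡⟨ *-identityʳ (ι (length K)) ⟨
      ι (length K) * 1ℚ                                     ≡⟨ ∑-const K 1ℚ ⟨
      ∑ K (λ _ → 1ℚ)                                        ≤⟨ ∑-mono-∈ K (λ κ∈K → one (All.lookup inv-K κ∈K)) ⟩
      ∑ K (λ κ → E n (size κ b) (V st))                     ≡⟨ ∑-swap K (subsets n) (λ κ S → δ ∣ S ∣ (size κ b) * V st S) ⟩
      ∑ (subsets n) (λ S → ∑ K (λ κ → δ ∣ S ∣ (size κ b) * V st S))
        ≡⟨ ∑-cong (subsets n) (λ S → ∑-*ʳ K (V st S) (λ κ → δ ∣ S ∣ (size κ b))) ⟩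
      ∑ (subsets n) (λ S → weights K st S b)                ∎
      where
      open ≤-Reasoning
      one : ∀ {κ} → Inv d st κ → 1ℚ ≤ E n (size κ b) (V st)
      one {κ} i = ≤-trans numeric (≤-trans (*-monoˡ (*-nonNeg 0≤9/8 (0≤inv (n C s))) leaf′) (≤-reflexive (sym normalise)))
        where
        open Inv i
        s = size κ b
        0≤9/8 : 0ℚ ≤ ℤ.+ 9 / 8
        0≤9/8 = nonNegative⁻¹ (ℤ.+ 9 / 8)
        B≤s : B ℕ.≤ s
        B≤s = ℕ.≤-trans B≤size (size≥ κ b)
        0<s : 0 ℕ.< s
        0<s = ℕ.≤-trans 0<B B≤s
        s≤n : s ℕ.≤ n
        s≤n = ℕ.≤-trans (size≤ κ b) size≤n
        0<n′ : 0 ℕ.< n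
        0<n′ = ℕ.≤-trans 0<s s≤n
        open Moments 0<s s≤n using (p; module Leaf)
        -- `e₁` is the bound d / B of `missing` with d ≤ Q, and it serves as `θ` too, since Q / s ≤
        -- Q / B. `e₂` is the reciprocal of the B / 2 in `large`. All losses are multiples of `u` =
        -- Q² / B ≤ 1/64 or smaller.
        e₁ e₂ u : ℚ
        e₁ = ι Q * inv B
        e₂ = ι 2 * inv B
        u  = ι Q * e₁
        missing′ : p * ι ∣ ∁ (U st) ∣ ≤ e₁
        missing′ = ≤-trans
          (≤-reflexive (trans (solve 3 (λ s i c → s :* i :* c := c :* s :* i) refl (ι s) (inv n) (ι ∣ ∁ (U st) ∣))
            (cong (_* inv n) (sym (ι-* ∣ ∁ (U st) ∣ s)))))
          (fraction-≤ 0<n′ 0<B (ℕ.≤-trans (ℕ.*-monoˡ-≤ B (ℕ.*-monoʳ-≤ ∣ ∁ (U st) ∣ (size≤ κ b)))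
            (ℕ.≤-trans missing (ℕ.*-monoˡ-≤ n d≤Q))))
        large′ : ∀ {D} → D ∈ˡ hist st → 0 ℕ.< ∣ D ∣ × ι n * inv (s ℕ.* ∣ D ∣) ≤ e₂
        large′ {D} D∈ = 0<D , fraction-≤ (ℕ.*-mono-≤ 0<s 0<D) 0<B
          (ℕ.≤-trans (large D∈) (ℕ.≤-trans (ℕ.*-monoʳ-≤ (2 ℕ.* ∣ D ∣) (size≥ κ b))
            (ℕ.≤-reflexive (trans (ℕ.*-assoc 2 ∣ D ∣ s) (cong (2 ℕ.*_) (ℕ.*-comm ∣ D ∣ s))))))
          where
          0<D = positive-size {∣ D ∣} {κ} B≤size size≤n (large D∈)
        0≤e₁ : 0ℚ ≤ e₁
        0≤e₁ = *-nonNeg (0≤ι Q) (0≤inv B)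
        e₁≤u : e₁ ≤ u
        e₁≤u = ≤-trans (≤-reflexive (sym (*-identityˡ e₁))) (*-monoʳ 0≤e₁ (subst (_≤ ι Q) ι-1 (ι-mono 0<Q)))
        u≤1/64 : u ≤ ℤ.+ 1 / 64
        u≤1/64 = *-cancelˡ {c = ι 64} (0<ι {64} (s≤s z≤n)) (begin
          ι 64 * (ι Q * (ι Q * inv B))  ≡⟨ solve 3 (λ c q i → c :* (q :* (q :* i)) := c :* (q :* q) :* i) refl (ι 64) (ι Q) (inv B) ⟩
          ι 64 * (ι Q * ι Q) * inv B    ≡⟨ cong (λ t → ι 64 * t * inv B) (sym (ι-* Q Q)) ⟩
          ι 64 * ι (Q ℕ.* Q) * inv B    ≡⟨ cong (_* inv B) (sym (ι-* 64 (Q ℕ.* Q))) ⟩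
          ι (64 ℕ.* (Q ℕ.* Q)) * inv B  ≤⟨ *-monoʳ (0≤inv B) (ι-mono 64Q²≤B) ⟩
          ι B * inv B                   ≡⟨ ι*inv 0<B ⟩
          1ℚ                            ≡⟨ cong (_* (ℤ.+ 1 / 64)) (ι-def 64) ⟨
          ι 64 * (ℤ.+ 1 / 64)             ∎)
        ι2 : ι 2 ≡ ℤ.+ 2 / 1
        ι2 = ι-def 2
        open Leaf {Q} 0<Q (ℕ.<-≤-trans Q<B B≤s) {X st} {U st} {hist st} ∣X∣≡ (ℕ.≤-trans ∣X∣≤ d≤Q) X⊆U
          {e₁} {e₂} 0≤e₁ (*-nonNeg (0≤ι 2) (0≤inv B)) missing′ large′
          using (r; weight) renaming (leaf to leaf-bound)
        r≡ : r ≡ 1ℚ - e₁ - ℤ.+ 5 / 1 * u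
        r≡ = trans
          (cong (λ t → 1ℚ - (1ℚ + ι Q) * e₁ - ι Q * ((ι Q + ι Q) * (t * inv B))) ι2)
          (solve 2 (λ q i → con 1ℚ :- (con 1ℚ :+ q) :* (q :* i) :- q :* ((q :+ q) :* (con (ℤ.+ 2 / 1) :* i))
            := con 1ℚ :- q :* i :- con (ℤ.+ 5 / 1) :* (q :* (q :* i))) refl (ι Q) (inv B))
        -- From `e₁ ≤ u ≤ 1/64`: 1 - e₁ - 5u ≥ 1 - 6/64.
        58/64≤r : ℤ.+ 58 / 64 ≤ r
        58/64≤r = ≤-trans (≤-certificate
          (+-nonNeg (≤⇒0≤- e₁≤u) (*-nonNeg (nonNegative⁻¹ (ℤ.+ 6 / 1)) (≤⇒0≤- u≤1/64)))
          (solve 2 (λ e u → con 1ℚ :- e :- con (ℤ.+ 5 / 1) :* u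
            := con (ℤ.+ 58 / 64) :+ ((u :- e) :+ con (ℤ.+ 6 / 1) :* (con (ℤ.+ 1 / 64) :- u))) refl e₁ u)) (≤-reflexive (sym r≡))
        -- The product 63/64 · 58/64 is just above 8/9, and the factor 9/8 in `V` restores 1.
        8/9≤ : ℤ.+ 8 / 9 ≤ (1ℚ - ι Q * e₁) * r
        8/9≤ = ≤-trans (≤ᵇ⇒≤ {ℤ.+ 8 / 9} {(ℤ.+ 63 / 64) * (ℤ.+ 58 / 64)} _)
          (*-mono (nonNegative⁻¹ (ℤ.+ 63 / 64)) (+-monoʳ-≤ 1ℚ (neg-antimono-≤ u≤1/64)) (nonNegative⁻¹ (ℤ.+ 58 / 64)) 58/64≤r)
        leaf′ : ι (n C s) * ((1ℚ - ι Q * e₁) * r) ≤ E n s weight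
        leaf′ = leaf-bound 0≤e₁ (fraction-≤ 0<s 0<B (ℕ.*-monoʳ-≤ Q B≤s))
          (≤-trans e₁≤u (≤-trans u≤1/64 (≤ᵇ⇒≤ {ℤ.+ 1 / 64} {1ℚ} _)))
          (≤-trans (nonNegative⁻¹ (ℤ.+ 58 / 64)) 58/64≤r)
        normalise : E n s (V st) ≡ ℤ.+ 9 / 8 * inv (n C s) * E n s weight
        normalise = trans
          (∑-cong (subsets n) (λ S → trans (sym (*-assoc (δ ∣ S ∣ s) _ (weight S)))
            (trans (cong (_* weight S) (δ-subst (λ k → ℤ.+ 9 / 8 * inv (n C k)) ∣ S ∣ s)) (*-assoc (δ ∣ S ∣ s) _ (weight S)))))
          (E-*ˡ n s (ℤ.+ 9 / 8 * inv (n C s)) weight)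
        numeric : 1ℚ ≤ ℤ.+ 9 / 8 * inv (n C s) * (ι (n C s) * ((1ℚ - ι Q * e₁) * r))
        numeric = ≤-trans (*-monoˡ 0≤9/8 8/9≤) (≤-reflexive (sym (trans
          (solve 4 (λ c i b t → c :* i :* (b :* t) := c :* (b :* i :* t)) refl (ℤ.+ 9 / 8) (inv (n C s)) (ι (n C s)) ((1ℚ - ι Q * e₁) * r))
          (cong (ℤ.+ 9 / 8 *_) (trans (cong (_* ((1ℚ - ι Q * e₁) * r)) (ι*inv (0<nCk s≤n))) (*-identityˡ ((1ℚ - ι Q * e₁) * r)))))))

    -- The expected size of A ∩ S is at most 1 / B even for the larger size, or at least `B` even
    -- for the smaller one.
    Small Large : Subset n → ℕ → Set
    Small A κ = ∣ A ∣ ℕ.* size κ true ℕ.* B ℕ.≤ n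
    Large A κ = n ℕ.* B ℕ.≤ ∣ A ∣ ℕ.* size κ false

    -- The factor B² in `gap` leads from above 1 / B to at least `B`, so the scales after one that
    -- is not small are all large.
    large-after : ∀ {A κ κ′} → ¬ Small A κ → κ ℕ.< κ′ → Large A κ′
    large-after {A} {κ} {κ′} ¬small κ<κ′ = begin
      n ℕ.* B                                 ≤⟨ ℕ.*-monoˡ-≤ B (ℕ.<⇒≤ (ℕ.≰⇒> ¬small)) ⟩
      ∣ A ∣ ℕ.* size κ true ℕ.* B ℕ.* B        ≡⟨ trans (ℕ.*-assoc (∣ A ∣ ℕ.* size κ true) B B) (ℕ.*-assoc ∣ A ∣ (size κ true) (B ℕ.* B)) ⟩
      ∣ A ∣ ℕ.* (size κ true ℕ.* (B ℕ.* B))    ≤⟨ ℕ.*-monoʳ-≤ ∣ A ∣ (gap κ<κ′) ⟩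
      ∣ A ∣ ℕ.* size κ′ false                  ∎
      where open ℕ.≤-Reasoning

    record Split (A : Subset n) (K : List ℕ) : Set₁ where
      field
        smalls larges : List ℕ
        all-small     : All (Small A) smalls
        all-large     : All (Large A) larges
        sorted-smalls : AllPairs ℕ._<_ smalls
        sorted-larges : AllPairs ℕ._<_ larges
        inherit       : ∀ {P : ℕ → Set} → All P K → All P smalls × All P larges
        lengths       : length K ℕ.≤ suc (length smalls ℕ.+ length larges)
        dominated     : ∀ s b → multiplicity smalls s b + multiplicity larges s b ≤ multiplicity K s b

    -- In increasing order, the scales before the first one that is not small are kept as small,
    -- that one is dropped, and the rest are large by `large-after`.
    split : ∀ A K → AllPairs ℕ._<_ K → Split A K
    split A []      []             = record
      { smalls = [] ; larges = [] ; all-small = [] ; all-large = [] ; sorted-smalls = [] ; sorted-larges = []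
      ; inherit = λ _ → [] , [] ; lengths = z≤n ; dominated = λ _ _ → ≤-refl }
    split A (κ ∷ K) (κ<K ∷ sorted) with ∣ A ∣ ℕ.* size κ true ℕ.* B ℕ.≤? n
    ... | yes small = record
      { smalls = κ ∷ smalls ; larges = larges ; all-small = small ∷ all-small ; all-large = all-large
      ; sorted-smalls = proj₁ (inherit κ<K) ∷ sorted-smalls ; sorted-larges = sorted-larges
      ; inherit = λ { (p ∷ ps) → p ∷ proj₁ (inherit ps) , proj₂ (inherit ps) }
      ; lengths = s≤s lengths
      ; dominated = λ s b → ≤-trans (≤-reflexive (+-assoc (δ s (size κ b)) _ _)) (+-monoʳ-≤ (δ s (size κ b)) (dominated s b)) }
      where open Split (split A K sorted)
    ... | no ¬small = record
      { smalls = [] ; larges = K ; all-small = [] ; all-large = All.map (large-after {A} ¬small) κ<K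
      ; sorted-smalls = [] ; sorted-larges = sorted
      ; inherit = λ { (_ ∷ ps) → [] , ps } ; lengths = ℕ.≤-refl
      ; dominated = λ s b → +-monoˡ-≤ (multiplicity K s b) (0≤δ s (size κ b)) }

    -- Discards the sets `S` that have an element of `A` not yet in `X`; they are rare, as A ∩ S is
    -- almost always empty at a small scale.
    after-small : Subset n → State → State
    after-small A (state X U hist) = state X (U ∩ (∁ A ∪ X)) hist

    fresh : Subset n → State → Subset n
    fresh A st = A ∩ (U st ∩ ∁ (X st))

    after-large : Subset n → Fin n → State → State
    after-large A j st = state (X st [ j ]≔ inside) (U st) (fresh A st ∷ hist st)

    inv-small : ∀ {d A st κ} → Inv d st κ → Small A κ → Inv (suc d) (after-small A st) κ
    inv-small {d} {A} {st} {κ} i small = record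
      { B≤size = B≤size ; size≤n = size≤n ; ∣X∣≡ = ∣X∣≡ ; ∣X∣≤ = ℕ.m≤n⇒m≤1+n ∣X∣≤
      ; X⊆U = λ x∈X → x∈p∩q⁺ (X⊆U x∈X , x∈p∪q⁺ (inj₂ x∈X))
      ; missing = begin
          ∣ ∁ (U st ∩ (∁ A ∪ X st)) ∣ ℕ.* size κ true ℕ.* B
            ≤⟨ ℕ.*-monoˡ-≤ B (ℕ.*-monoˡ-≤ (size κ true) (cover {Y = A} {∁ (U st)} lost)) ⟩
          (∣ A ∣ ℕ.+ ∣ ∁ (U st) ∣) ℕ.* size κ true ℕ.* B
            ≡⟨ trans (cong (ℕ._* B) (ℕ.*-distribʳ-+ (size κ true) ∣ A ∣ _)) (ℕ.*-distribʳ-+ B (∣ A ∣ ℕ.* size κ true) _) ⟩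
          ∣ A ∣ ℕ.* size κ true ℕ.* B ℕ.+ ∣ ∁ (U st) ∣ ℕ.* size κ true ℕ.* B
            ≤⟨ ℕ.+-mono-≤ small missing ⟩
          n ℕ.+ d ℕ.* n ∎
      ; large = large }
      where
      open Inv i
      open ℕ.≤-Reasoning
      lost : ∀ {x} → x ∈ ∁ (U st ∩ (∁ A ∪ X st)) → x ∈ A ⊎ x ∈ ∁ (U st)
      lost {x} x∈ with x ∈? A | x ∈? U st
      ... | yes x∈A | _        = inj₁ x∈A
      ... | no _    | no x∉U   = inj₂ (x∉p⇒x∈∁p x∉U)
      ... | no x∉A  | yes x∈U  = contradiction (x∈p∩q⁺ (x∈U , x∈p∪q⁺ (inj₁ (x∉p⇒x∈∁p x∉A)))) (x∈∁p⇒x∉p x∈)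

    -- Only the elements outside `U` and those of `X` are removed from `A`. Multiplied by the size,
    -- each of these two parts is at most Q n, together at most half of n B by 4Q ≤ B. The
    -- inequality is proved doubled, with n B added on both sides.
    fresh-large : ∀ {d A st κ} → d ℕ.≤ Q → Inv d st κ → Large A κ → n ℕ.* B ℕ.≤ 2 ℕ.* ∣ fresh A st ∣ ℕ.* size κ false
    fresh-large {d} {A} {st} {κ} d≤Q i big = ℕ.+-cancelʳ-≤ (n ℕ.* B) _ _ (begin
      n ℕ.* B ℕ.+ n ℕ.* B
        ≤⟨ ℕ.+-mono-≤ big big ⟩
      ∣ A ∣ ℕ.* s ℕ.+ ∣ A ∣ ℕ.* s
        ≤⟨ ℕ.+-mono-≤ (ℕ.*-monoˡ-≤ s sizes) (ℕ.*-monoˡ-≤ s sizes) ⟩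
      (f ℕ.+ (c ℕ.+ x)) ℕ.* s ℕ.+ (f ℕ.+ (c ℕ.+ x)) ℕ.* s
        ≡⟨ regroup f c x s ⟩
      2 ℕ.* f ℕ.* s ℕ.+ 2 ℕ.* (c ℕ.* s ℕ.+ x ℕ.* s)
        ≤⟨ ℕ.+-monoʳ-≤ (2 ℕ.* f ℕ.* s) (ℕ.*-monoʳ-≤ 2 (ℕ.+-mono-≤ c*s≤ (ℕ.*-mono-≤ (ℕ.≤-trans ∣X∣≤ d≤Q) (ℕ.≤-trans (sizes-mono κ) size≤n)))) ⟩
      2 ℕ.* f ℕ.* s ℕ.+ 2 ℕ.* (Q ℕ.* n ℕ.+ Q ℕ.* n)
        ≡⟨ cong (ℕ._+_ (2 ℕ.* f ℕ.* s)) (quadruple Q n) ⟩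
      2 ℕ.* f ℕ.* s ℕ.+ n ℕ.* (4 ℕ.* Q)
        ≤⟨ ℕ.+-monoʳ-≤ (2 ℕ.* f ℕ.* s) (ℕ.*-monoʳ-≤ n 4Q≤B) ⟩
      2 ℕ.* f ℕ.* s ℕ.+ n ℕ.* B ∎)
      where
      open Inv i
      open ℕ.≤-Reasoning
      s = size κ false
      f = ∣ fresh A st ∣
      c = ∣ ∁ (U st) ∣
      x = ∣ X st ∣
      regroup : ∀ f c x s → (f ℕ.+ (c ℕ.+ x)) ℕ.* s ℕ.+ (f ℕ.+ (c ℕ.+ x)) ℕ.* s ≡ 2 ℕ.* f ℕ.* s ℕ.+ 2 ℕ.* (c ℕ.* s ℕ.+ x ℕ.* s)
      regroup = solve-∀
      quadruple : ∀ q n → 2 ℕ.* (q ℕ.* n ℕ.+ q ℕ.* n) ≡ n ℕ.* (4 ℕ.* q)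
      quadruple = solve-∀
      sizes : ∣ A ∣ ℕ.≤ f ℕ.+ (c ℕ.+ x)
      sizes = ℕ.≤-trans (cover {Y = fresh A st} {∁ (U st) ∪ X st} decompose) (ℕ.+-monoʳ-≤ f (∣∪∣≤ (∁ (U st)) (X st)))
        where
        decompose : ∀ {y} → y ∈ A → y ∈ fresh A st ⊎ y ∈ ∁ (U st) ∪ X st
        decompose {y} y∈A with y ∈? U st | y ∈? X st
        ... | no y∉U  | _       = inj₂ (x∈p∪q⁺ (inj₁ (x∉p⇒x∈∁p y∉U)))
        ... | yes _   | yes y∈X = inj₂ (x∈p∪q⁺ (inj₂ y∈X))
        ... | yes y∈U | no y∉X  = inj₁ (x∈p∩q⁺ (y∈A , x∈p∩q⁺ (y∈U , x∉p⇒x∈∁p y∉X)))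
      c*s≤ : c ℕ.* s ℕ.≤ Q ℕ.* n
      c*s≤ = ℕ.≤-trans (ℕ.*-monoʳ-≤ c (sizes-mono κ))
        (ℕ.≤-trans (ℕ.≤-trans (ℕ.≤-reflexive (sym (ℕ.*-identityʳ _))) (ℕ.*-monoʳ-≤ (c ℕ.* size κ true) 0<B))
          (ℕ.≤-trans missing (ℕ.*-monoˡ-≤ n d≤Q)))

    inv-large : ∀ {d A st κ j} → d ℕ.≤ Q → j ∈ fresh A st → Inv d st κ → Large A κ → Inv (suc d) (after-large A j st) κ
    inv-large {d} {A} {st} {κ} {j} d≤Q j∈ i big = record
      { B≤size = B≤size ; size≤n = size≤n
      ; ∣X∣≡ = trans ∣X′∣ (cong suc ∣X∣≡)
      ; ∣X∣≤ = subst (ℕ._≤ suc d) (sym ∣X′∣) (s≤s ∣X∣≤)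
      ; X⊆U = X′⊆U
      ; missing = ℕ.≤-trans missing (ℕ.m≤n+m (d ℕ.* n) n)
      ; large = λ { (here refl) → fresh-large {d} {A} {st} d≤Q i big ; (there D∈) → large D∈ } }
      where
      open Inv i
      j∈U∖X : j ∈ U st × j ∈ ∁ (X st)
      j∈U∖X = x∈p∩q⁻ (U st) (∁ (X st)) (proj₂ (x∈p∩q⁻ A (U st ∩ ∁ (X st)) j∈))
      j∉X : lookup (X st) j ≡ outside
      j∉X with lookup (X st) j in eq
      ... | true  = contradiction (lookup⇒[]= j (X st) eq) (x∈∁p⇒x∉p (proj₂ j∈U∖X))
      ... | false = refl
      ∣X′∣ = ∣insert∣ (X st) j j∉X
      X′⊆U : X st [ j ]≔ inside ⊆ U st
      X′⊆U {x} x∈ with x Fin.≟ j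
      ... | yes refl = proj₁ j∈U∖X
      ... | no x≢j   = X⊆U (lookup⇒[]= x (X st) (trans (sym (lookup∘update′ x≢j (X st) inside)) ([]=⇒lookup x∈)))

    0≤V : ∀ st S → 0ℚ ≤ V st S
    0≤V st S = *-nonNeg (*-nonNeg (nonNegative⁻¹ (ℤ.+ 9 / 8)) (0≤inv (n C ∣ S ∣)))
      (*-nonNeg (*-nonNeg (0≤⟦⊑⟧ (X st) S) (0≤⟦⊑⟧ S (U st)))
        (∏-nonNeg (hist st) (λ D → *-nonNeg (0≤ι ∣ D ∣) (0≤inv (Q ℕ.+ ∣ D ∩ S ∣)))))

    0≤weights : ∀ K st S b → 0ℚ ≤ weights K st S b
    0≤weights K st S b = *-nonNeg (0≤multiplicity K ∣ S ∣ b) (0≤V st S)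

    -- For a set `S` that the new state admits, A ∩ S = A ∩ X, so the true answer has exactly the
    -- idealised distribution. For all others the left side is 0.
    small-step : ∀ A st S j → answer A (X st) j * V (after-small A st) S ≤ V st S * answer A S j
    small-step A st S j = by-cases (X st ⊆? S) (S ⊆? U (after-small A st))
      where
      c = ℤ.+ 9 / 8 * inv (n C ∣ S ∣)
      P = ∏ (hist st) (λ D → ι ∣ D ∣ * inv (Q ℕ.+ ∣ D ∩ S ∣))
      U′ = U (after-small A st)
      a = answer A (X st) j
      vanish : ∀ {x u} → x * u ≡ 0ℚ → a * (c * (x * u * P)) ≤ V st S * answer A S j
      vanish {x} {u} xu≡0 = ≤-trans
        (≤-reflexive (trans (cong (λ t → a * (c * (t * P))) xu≡0)
          (solve 3 (λ a c p → a :* (c :* (con 0ℚ :* p)) := con 0ℚ) refl a c P)))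
        (*-nonNeg (0≤V st S) (0≤uniform (support A S) j))
      by-cases : Dec (X st ⊆ S) → Dec (S ⊆ U′) → a * (c * (⟦ X st ⊑ S ⟧ * ⟦ S ⊑ U′ ⟧ * P)) ≤ V st S * answer A S j
      by-cases (no ¬X⊆S) _ = vanish {⟦ X st ⊑ S ⟧} {⟦ S ⊑ U′ ⟧} (trans (cong (_* ⟦ S ⊑ U′ ⟧) (⊑-no ¬X⊆S)) (*-zeroˡ ⟦ S ⊑ U′ ⟧))
      by-cases (yes _) (no ¬S⊆U′) = vanish {⟦ X st ⊑ S ⟧} {⟦ S ⊑ U′ ⟧} (trans (cong (⟦ X st ⊑ S ⟧ *_) (⊑-no ¬S⊆U′)) (*-zeroʳ ⟦ X st ⊑ S ⟧))
      by-cases (yes X⊆S) (yes S⊆U′) = ≤-reflexive (trans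
        (*-comm a _)
        (cong₂ (λ t v → c * (⟦ X st ⊑ S ⟧ * t * P) * v)
          (trans (⊑-yes S⊆U′) (sym (⊑-yes (⊆-trans S⊆U′ (p∩q⊆p (U st) (∁ A ∪ X st))))))
          (cong (λ Y → uniform Y j) (support-cong A (X st) S (⊆-antisym
            (λ x∈ → let x∈A , x∈X = x∈p∩q⁻ A (X st) x∈ in x∈p∩q⁺ (x∈A , X⊆S x∈X))
            (λ x∈ → let x∈A , x∈S = x∈p∩q⁻ A S x∈ in x∈p∩q⁺ (x∈A , confirmed x∈A x∈S)))))))
        where
        confirmed : ∀ {x} → x ∈ A → x ∈ S → x ∈ X st
        confirmed x∈A x∈S with x∈p∪q⁻ (∁ A) (X st) (proj₂ (x∈p∩q⁻ (U st) _ (S⊆U′ x∈S)))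
        ... | inj₁ x∈∁A = contradiction x∈A (x∈∁p⇒x∉p x∈∁A)
        ... | inj₂ x∈X  = x∈X

    -- The idealised 1 / ∣D∣ cancels against the numerator of the new factor. What remains is 1 / (Q
    -- + ∣D ∩ S∣), at most the true probability 1 / ∣A ∩ S∣, because A ∩ S is covered by `X` and D ∩
    -- S. Answers outside `D` are given up.
    large-step : ∀ A st S j → ∣ X st ∣ ℕ.≤ Q →
                 uniform (fresh A st) j * V (after-large A j st) S ≤ V st S * answer A S j
    large-step A st S j X≤Q = by-cases (j ∈? D) (j ∈? S) (X st ⊆? S) (S ⊆? U st)
      where
      D = fresh A st
      c = ℤ.+ 9 / 8 * inv (n C ∣ S ∣)
      P = ∏ (hist st) (λ D → ι ∣ D ∣ * inv (Q ℕ.+ ∣ D ∩ S ∣))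
      x = ⟦ X st ⊑ S ⟧
      u = ⟦ S ⊑ U st ⟧
      d = ι ∣ D ∣
      i = inv ∣ D ∣
      h = inv (Q ℕ.+ ∣ D ∩ S ∣)
      lhs≡ : uniform D j * V (after-large A j st) S ≡ (χ D j * χ S j * (d * i)) * (c * (x * u * P)) * h
      lhs≡ = trans (cong (λ t → χ D j * i * (c * (t * u * (d * h * P)))) (insert-⊑ (X st) j S))
        (solve 9 (λ e f d i c x u p h → e :* i :* (c :* (x :* f :* u :* (d :* h :* p)))
          := (e :* f :* (d :* i)) :* (c :* (x :* u :* p)) :* h) refl (χ D j) (χ S j) d i c x u P h)
      0≤rhs : 0ℚ ≤ V st S * answer A S j
      0≤rhs = *-nonNeg (0≤V st S) (0≤uniform (support A S) j)
      zero-left : χ D j * χ S j ≡ 0ℚ → uniform D j * V (after-large A j st) S ≤ V st S * answer A S j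
      zero-left eq = ≤-trans (≤-reflexive (trans lhs≡ (trans
        (cong (λ t → t * (d * i) * (c * (x * u * P)) * h) eq)
        (solve 3 (λ d v h → con 0ℚ :* d :* v :* h := con 0ℚ) refl (d * i) (c * (x * u * P)) h)))) 0≤rhs
      zero-right : x * u ≡ 0ℚ → uniform D j * V (after-large A j st) S ≤ V st S * answer A S j
      zero-right eq = ≤-trans (≤-reflexive (trans lhs≡ (trans
        (cong (λ t → χ D j * χ S j * (d * i) * (c * (t * P)) * h) eq)
        (solve 4 (λ e c p h → e :* (c :* (con 0ℚ :* p)) :* h := con 0ℚ) refl (χ D j * χ S j * (d * i)) c P h)))) 0≤rhs
      by-cases : Dec (j ∈ D) → Dec (j ∈ S) → Dec (X st ⊆ S) → Dec (S ⊆ U st) →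
                 uniform D j * V (after-large A j st) S ≤ V st S * answer A S j
      by-cases (no j∉D) _ _ _ = zero-left (trans (cong (_* χ S j) (χ-∉ j∉D)) (*-zeroˡ (χ S j)))
      by-cases (yes _) (no j∉S) _ _ = zero-left (trans (cong (χ D j *_) (χ-∉ j∉S)) (*-zeroʳ (χ D j)))
      by-cases (yes _) (yes _) (no ¬X⊆S) _ = zero-right (trans (cong (_* u) (⊑-no ¬X⊆S)) (*-zeroˡ u))
      by-cases (yes _) (yes _) (yes _) (no ¬S⊆U) = zero-right (trans (cong (x *_) (⊑-no ¬S⊆U)) (*-zeroʳ x))
      by-cases (yes j∈D) (yes j∈S) (yes _) (yes S⊆U) = begin
        uniform D j * V (after-large A j st) S         ≡⟨ lhs≡ ⟩
        (χ D j * χ S j * (d * i)) * V st S * h         ≡⟨ cong (λ t → t * V st S * h) unit ⟩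
        1ℚ * V st S * h                                ≡⟨ cong (_* h) (*-identityˡ (V st S)) ⟩
        V st S * h                                     ≤⟨ *-monoˡ (0≤V st S) h≤ ⟩
        V st S * answer A S j                          ∎
        where
        open ≤-Reasoning
        unit : χ D j * χ S j * (d * i) ≡ 1ℚ
        unit = cong₂ _*_ (cong₂ _*_ (χ-∈ j∈D) (χ-∈ j∈S)) (ι*inv (nonempty⇒0<∣∣ (j , j∈D)))
        j∈A∩S : j ∈ A ∩ S
        j∈A∩S = x∈p∩q⁺ (proj₁ (x∈p∩q⁻ A _ j∈D) , j∈S)
        decompose : ∀ {y} → y ∈ A ∩ S → y ∈ X st ⊎ y ∈ D ∩ S
        decompose {y} y∈ with x∈p∩q⁻ A S y∈ | y ∈? X st
        ... | _         , _         | yes y∈X = inj₁ y∈X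
        ... | y∈A       , y∈S       | no y∉X  = inj₂ (x∈p∩q⁺ (x∈p∩q⁺ (y∈A , x∈p∩q⁺ (S⊆U y∈S , x∉p⇒x∈∁p y∉X)) , y∈S))
        h≤ : h ≤ answer A S j
        h≤ = ≤-trans
          (inv-antimono (nonempty⇒0<∣∣ (j , j∈A∩S))
            (ℕ.≤-trans (cover {Y = X st} {D ∩ S} decompose) (ℕ.+-monoˡ-≤ ∣ D ∩ S ∣ X≤Q)))
          (≤-reflexive (sym (trans (cong (λ Y → uniform Y j) (support-≡ A S (j , j∈A∩S)))
            (trans (cong (_* inv ∣ A ∩ S ∣) (χ-∈ j∈A∩S)) (*-identityˡ _)))))

    -- At most one scale is critical for each of the 2 ^ q ∸ 1 sampling nodes that
    -- remain when every answer is classified as small or large.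
    criticals : ℕ → ℕ
    criticals zero    = 0
    criticals (suc q) = suc (criticals q ℕ.+ criticals q)

    truncate-≤ : ∀ {k a b} q → k ℕ.≤ suc (a ℕ.+ b) →
                 k ℕ.∸ criticals (suc q) ℕ.≤ (a ℕ.∸ criticals q) ℕ.+ (b ℕ.∸ criticals q)
    truncate-≤ {k} {a} {b} q k≤ = begin
      k ℕ.∸ suc (r ℕ.+ r)                  ≤⟨ ℕ.∸-monoˡ-≤ (suc (r ℕ.+ r)) k≤ ⟩
      (a ℕ.+ b) ℕ.∸ (r ℕ.+ r)              ≤⟨ ℕ.m≤n+o⇒m∸n≤o (a ℕ.+ b) (r ℕ.+ r) (begin
        a ℕ.+ b                               ≤⟨ ℕ.+-mono-≤ (ℕ.m≤n+m∸n a r) (ℕ.m≤n+m∸n b r) ⟩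
        (r ℕ.+ (a ℕ.∸ r)) ℕ.+ (r ℕ.+ (b ℕ.∸ r)) ≡⟨ regroup r (a ℕ.∸ r) (b ℕ.∸ r) ⟩
        (r ℕ.+ r) ℕ.+ ((a ℕ.∸ r) ℕ.+ (b ℕ.∸ r)) ∎) ⟩
      (a ℕ.∸ r) ℕ.+ (b ℕ.∸ r)              ∎
      where
      open ℕ.≤-Reasoning
      r = criticals q
      regroup : ∀ r a b → (r ℕ.+ a) ℕ.+ (r ℕ.+ b) ≡ (r ℕ.+ r) ℕ.+ (a ℕ.+ b)
      regroup = solve-∀

    -- The weight is split into its small and its large scales. The idealised answers of either part
    -- do not depend on `S`, so summing over `j` returns the full bound of that part, and only the
    -- critical scale is lost.
    certificate : ∀ q {d st K} → d ℕ.+ q ℕ.≤ Q → ∣ X st ∣ ℕ.≤ Q → AllPairs ℕ._<_ K → All (Inv d st) K →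
                  Cert q (weights K st) (ι (length K ℕ.∸ criticals q))
    certificate zero    {d} d≤Q X≤Q sorted inv-K = leafy (subst (ℕ._≤ Q) (ℕ.+-identityʳ d) d≤Q) inv-K
    certificate (suc q) {d} {st} {K} d≤Q X≤Q sorted inv-K =
      (λ b → ≤-trans (ι-mono (ℕ.m∸n≤m (length K) (criticals (suc q)))) (leafy d≤Q′ inv-K b)) , step
      where
      d≤Q′ : d ℕ.≤ Q
      d≤Q′ = ℕ.≤-trans (ℕ.m≤m+n d (suc q)) d≤Q
      d+q≤Q : suc d ℕ.+ q ℕ.≤ Q
      d+q≤Q = subst (ℕ._≤ Q) (ℕ.+-suc d q) d≤Q
      step : ∀ A → Nonempty A → ∃[ c ] (∀ j → 0ℚ ≤ c j) × ι (length K ℕ.∸ criticals (suc q)) ≤ ∑ (allFin n) c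
        × (∀ j → Cert q (λ S b → weights K st S b * answer A S j) (c j))
      step A ne = c , 0≤c , total , cert
        where
        open Split (split A K sorted)
        k₁ = length smalls ℕ.∸ criticals q
        k₂ = length larges ℕ.∸ criticals q
        D = fresh A st
        c : Fin n → ℚ
        c j = answer A (X st) j * ι k₁ + uniform D j * ι k₂
        0≤c : ∀ j → 0ℚ ≤ c j
        0≤c j = +-nonNeg (*-nonNeg (0≤uniform (support A (X st)) j) (0≤ι k₁)) (*-nonNeg (0≤uniform D j) (0≤ι k₂))
        inv-large-K = proj₂ (inherit inv-K)
        ∑D : ∀ {L} → All (Inv d st) L → All (Large A) L →
             ι (length L ℕ.∸ criticals q) ≤ ∑ (allFin n) (uniform D) * ι (length L ℕ.∸ criticals q)
        -- Without large scales `D` may be empty, but then the number to be bounded is 0.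
        ∑D {[]} _ _ = ≤-trans (≤-reflexive (trans (cong ι (ℕ.0∸n≡0 (criticals q))) ι-0))
          (*-nonNeg (∑-nonNeg (allFin n) (0≤uniform D)) (0≤ι (0 ℕ.∸ criticals q)))
        ∑D {κ ∷ L} (i ∷ _) (big ∷ _) = ≤-reflexive (sym (trans
          (cong (_* ι k) (∑uniform D-nonempty)) (*-identityˡ (ι k))))
          where
          k = length (κ ∷ L) ℕ.∸ criticals q
          D-nonempty : Nonempty D
          D-nonempty with nonempty? D
          ... | yes ne = ne
          ... | no em = contradiction
            (positive-size {∣ D ∣} {κ} (Inv.B≤size i) (Inv.size≤n i) (fresh-large {d} {A} {st} d≤Q′ i big))
            (λ 0<D → ℕ.<-irrefl (sym (trans (cong ∣_∣ (Empty-unique em)) (∣⊥∣≡0 n))) 0<D)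
        total : ι (length K ℕ.∸ criticals (suc q)) ≤ ∑ (allFin n) c
        total = begin
          ι (length K ℕ.∸ criticals (suc q)) ≤⟨ ι-mono (truncate-≤ {b = length larges} q lengths) ⟩
          ι (k₁ ℕ.+ k₂)                      ≡⟨ ι-+ k₁ k₂ ⟩
          ι k₁ + ι k₂                        ≤⟨ +-mono-≤ (≤-reflexive (sym (trans
                                                  (cong (_* ι k₁) (∑uniform (support-nonempty A (X st) ne))) (*-identityˡ (ι k₁)))))
                                                  (∑D inv-large-K all-large) ⟩
          ∑ (allFin n) (answer A (X st)) * ι k₁ + ∑ (allFin n) (uniform D) * ι k₂
                                             ≡⟨ cong₂ _+_ (∑-*ʳ (allFin n) (ι k₁) (answer A (X st))) (∑-*ʳ (allFin n) (ι k₂) (uniform D)) ⟨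
          ∑ (allFin n) (λ j → answer A (X st) j * ι k₁) + ∑ (allFin n) (λ j → uniform D j * ι k₂)
                                             ≡⟨ ∑-+ (allFin n) (λ j → answer A (X st) j * ι k₁) (λ j → uniform D j * ι k₂) ⟨
          ∑ (allFin n) c                     ∎
          where open ≤-Reasoning
        w₁ w₂ : Fin n → Weight {n}
        w₁ j S b = answer A (X st) j * weights smalls (after-small A st) S b
        w₂ j S b = uniform D j * weights larges (after-large A j st) S b
        cert₁ : ∀ j → Cert q (w₁ j) (answer A (X st) j * ι k₁)
        cert₁ j = Cert-scale q {weights smalls (after-small A st)} (0≤uniform (support A (X st)) j)
          (certificate q {suc d} {after-small A st} d+q≤Q X≤Q sorted-smalls
            (All.zipWith (λ (i , small) → inv-small {d} {A} {st} i small) (proj₁ (inherit inv-K) , all-small)))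
        cert₂ : ∀ j → Cert q (w₂ j) (uniform D j * ι k₂)
        cert₂ j with j ∈? D | larges in eq
        -- An answer outside `D` need not lead to a state satisfying the invariant, but its
        -- coefficient is 0. In the next case no scale remains to bound the new `X`, and the claim
        -- is again 0.
        ... | no j∉D | L = Cert-mono q {λ _ _ → 0ℚ} (λ S b → *-nonNeg (0≤uniform D j) (0≤weights L (after-large A j st) S b))
          (≤-reflexive (trans (cong (λ t → t * inv ∣ D ∣ * ι (length L ℕ.∸ criticals q)) (χ-∉ j∉D))
            (solve 2 (λ a b → con 0ℚ :* a :* b := con 0ℚ) refl (inv ∣ D ∣) (ι (length L ℕ.∸ criticals q)))))
          (Cert-zero q (λ _ _ → ≤-refl))
        ... | yes j∈D | [] = Cert-mono q {λ _ _ → 0ℚ} (λ S b → *-nonNeg (0≤uniform D j) (0≤weights [] (after-large A j st) S b))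
          (≤-reflexive (trans (cong (uniform D j *_) (trans (cong ι (ℕ.0∸n≡0 (criticals q))) ι-0)) (*-zeroʳ (uniform D j))))
          (Cert-zero q (λ _ _ → ≤-refl))
        ... | yes j∈D | κ ∷ L = Cert-scale q {weights (κ ∷ L) (after-large A j st)} (0≤uniform D j)
          (certificate q {suc d} {after-large A j st} d+q≤Q
            (ℕ.≤-trans (Inv.∣X∣≤ (All.head invs)) (ℕ.≤-trans (ℕ.m≤m+n (suc d) q) d+q≤Q))
            (subst (AllPairs ℕ._<_) eq sorted-larges) invs)
          where
          invs : All (Inv (suc d) (after-large A j st)) (κ ∷ L)
          invs = subst (All (Inv (suc d) (after-large A j st))) eq
            (All.zipWith (λ (i , big) → inv-large {d} {A} {st} d≤Q′ j∈D i big) (inv-large-K , all-large))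
        cert : ∀ j → Cert q (λ S b → weights K st S b * answer A S j) (c j)
        cert j = Cert-mono q {λ S b → w₁ j S b + w₂ j S b} below ≤-refl (Cert-+ q {w₁ j} {w₂ j} (cert₁ j) (cert₂ j))
          where
          below : ∀ S b → w₁ j S b + w₂ j S b ≤ weights K st S b * answer A S j
          below S b = begin
            w₁ j S b + w₂ j S b
              ≡⟨ solve 6 (λ a m v e l w → a :* (m :* v) :+ e :* (l :* w) := m :* (a :* v) :+ l :* (e :* w)) refl
                   (answer A (X st) j) m₁ (V (after-small A st) S) (uniform D j) m₂ (V (after-large A j st) S) ⟩
            m₁ * (answer A (X st) j * V (after-small A st) S) + m₂ * (uniform D j * V (after-large A j st) S)
              ≤⟨ +-mono-≤ (*-monoˡ (0≤multiplicity smalls ∣ S ∣ b) (small-step A st S j))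
                          (*-monoˡ (0≤multiplicity larges ∣ S ∣ b) (large-step A st S j X≤Q)) ⟩
            m₁ * v + m₂ * v
              ≡⟨ *-distribʳ-+ v m₁ m₂ ⟨
            (m₁ + m₂) * v
              ≤⟨ *-monoʳ (*-nonNeg (0≤V st S) (0≤uniform (support A S) j)) (dominated ∣ S ∣ b) ⟩
            multiplicity K ∣ S ∣ b * (V st S * answer A S j)
              ≡⟨ *-assoc (multiplicity K ∣ S ∣ b) (V st S) (answer A S j) ⟨
            weights K st S b * answer A S j ∎
            where
            open ≤-Reasoning
            m₁ = multiplicity smalls ∣ S ∣ b
            m₂ = multiplicity larges ∣ S ∣ b
            v  = V st S * answer A S j

open import Defs
import Algebra.Properties.CommutativeMonoid.Sum as NatSum
open import Data.Bool using (Bool; true; false; if_then_else_)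
open import Data.Empty using (⊥; ⊥-elim)
open import Data.Fin using (Fin; zero; suc)
open import Data.Fin.Permutation using (Permutation′; _⟨$⟩ʳ_)
open import Data.Fin.Subset as Subset using (Subset; ∣_∣; _∈_; _∉_; _∩_; Nonempty)
open import Data.Fin.Subset.Properties using (nonempty?; ∣∁p∣≡n∸∣p∣; ∣⊥∣≡0; ∣⊤∣≡n; ⊥⊆; ⊆⊤; Empty-unique; x∈p∩q⁻)
open import Data.Integer as ℤ using (+_)
import Data.Integer.Properties as ℤ
open import Data.List using (List; []; _∷_; length; allFin; upTo)
open import Data.List.Properties using (length-upTo)
open import Data.List.Relation.Unary.All as All using (All)
open import Data.List.Relation.Unary.All.Properties using (applyUpTo⁺₁)
import Data.List.Relation.Unary.AllPairs.Properties as AllPairs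
open import Data.List.Relation.Unary.Any using (Any; here; there; any?; satisfied)
open import Data.Nat as ℕ using (ℕ; zero; suc; s≤s; z≤n; _≥_)
open import Data.Nat.Combinatorics using (_C_)
open import Data.Nat.Logarithm using (⌈log₂_⌉; ⌈log₂⌉-mono-≤; ⌈log₂2^n⌉≡n)
import Data.Nat.Properties as ℕ
open import Data.Nat.Tactic.RingSolver using (solve-∀)
open import Data.Product using (Σ-syntax; ∃-syntax; _×_; _,_; proj₁; proj₂)
open import Data.Rational as ℚ using (ℚ; 0ℚ; 1ℚ; ½; _/_)
import Data.Rational.Properties as ℚ
open import Data.Rational.Solver using (module +-*-Solver)
import Data.Rational.Unnormalised as ℚᵘ
import Data.Rational.Unnormalised.Properties as ℚᵘ
open import Data.Sum using (_⊎_; inj₁; inj₂)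
open import Data.Vec as Vec using (lookup)
open import Data.Vec.Properties using (lookup∘tabulate; tabulate∘lookup)
open import Function using (_∘_; id)
open import Relation.Binary.PropositionalEquality
open import Relation.Nullary using (yes; no; ¬_; contradiction)
open +-*-Solver using (solve; _:+_; _:*_; _:-_; :-_; _:=_; con)
open Finite using (∑; ι; inv; 0≤1; ≤-certificate; ≤⇒0≤-; χ; bit; subsets; δ; ⟦_⊑_⟧; nonempty⇒0<∣∣; E; uniform; answer; support; Weight; Cert; module Game)

-- Order on the real numbers, and the loss of an algorithm

half : ∀ {ε} → 0ℚ ℚ.< ε → 0ℚ ℚ.< ½ ℚ.* ε
half = Finite.*-pos (ℚ.positive⁻¹ ½)

⊔ˡ : ∀ {M N k} → k ≥ M ℕ.⊔ N → k ≥ M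
⊔ˡ {M} {N} = ℕ.≤-trans (ℕ.m≤m⊔n M N)

⊔ʳ : ∀ {M N k} → k ≥ M ℕ.⊔ N → k ≥ N
⊔ʳ {M} {N} = ℕ.≤-trans (ℕ.m≤n⊔m M N)

pointwise-≤ : ∀ {x y} → (∀ m → approx x m ℚ.≤ approx y m) → x ≤ y
pointwise-≤ {x} {y} x≤y ε 0<ε = 0 , λ m _ → ≤-certificate (Finite.+-nonNeg (≤⇒0≤- (x≤y m)) (ℚ.<⇒≤ 0<ε))
  (solve 3 (λ x y e → y :+ e := x :+ ((y :- x) :+ e)) refl (approx x m) (approx y m) ε)

≡⇒≤ : ∀ {x y} → (∀ m → approx x m ≡ approx y m) → x ≤ y
≡⇒≤ {x} {y} eq = pointwise-≤ {x} {y} (λ m → ℚ.≤-reflexive (eq m))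

≡⇒≃ : ∀ {x y} → (∀ m → approx x m ≡ approx y m) → x ≃ y
≡⇒≃ {x} {y} eq ε 0<ε = 0 , λ m _ → subst (ℚ._≤ ε)
  (cong ℚ.∣_∣ (sym (trans (cong (ℚ._- approx y m) (eq m)) (ℚ.+-inverseʳ (approx y m))))) (ℚ.<⇒≤ 0<ε)

≃-trans : ∀ {x y z} → x ≃ y → y ≃ z → x ≃ z
≃-trans {x} {y} {z} x≃y y≃z ε 0<ε =
  let M , p = x≃y (½ ℚ.* ε) (half 0<ε)
      N , q = y≃z (½ ℚ.* ε) (half 0<ε)
  in M ℕ.⊔ N , λ m m≥ → begin
    ℚ.∣ approx x m ℚ.- approx z m ∣
      ≡⟨ cong ℚ.∣_∣ (solve 3 (λ x y z → x :- z := (x :- y) :+ (y :- z)) refl (approx x m) (approx y m) (approx z m)) ⟩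
    ℚ.∣ (approx x m ℚ.- approx y m) ℚ.+ (approx y m ℚ.- approx z m) ∣
      ≤⟨ ℚ.∣p+q∣≤∣p∣+∣q∣ (approx x m ℚ.- approx y m) (approx y m ℚ.- approx z m) ⟩
    ℚ.∣ approx x m ℚ.- approx y m ∣ ℚ.+ ℚ.∣ approx y m ℚ.- approx z m ∣
      ≤⟨ ℚ.+-mono-≤ (p m (⊔ˡ m≥)) (q m (⊔ʳ {M} m≥)) ⟩
    ½ ℚ.* ε ℚ.+ ½ ℚ.* ε
      ≡⟨ solve 1 (λ e → con ½ :* e :+ con ½ :* e := e) refl ε ⟩
    ε ∎
  where open ℚ.≤-Reasoning

≤-trans : ∀ {x y z} → x ≤ y → y ≤ z → x ≤ z
≤-trans {x} {y} {z} x≤y y≤z ε 0<ε =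
  let M , p = x≤y (½ ℚ.* ε) (half 0<ε)
      N , q = y≤z (½ ℚ.* ε) (half 0<ε)
  in M ℕ.⊔ N , λ m m≥ → ℚ.≤-trans (p m (⊔ˡ m≥))
    (ℚ.≤-trans (ℚ.+-monoˡ-≤ (½ ℚ.* ε) (q m (⊔ʳ {M} m≥)))
      (ℚ.≤-reflexive (solve 2 (λ z e → z :+ con ½ :* e :+ con ½ :* e := z :+ e) refl (approx z m) ε)))

+-mono-≤ : ∀ {x y u v} → x ≤ y → u ≤ v → x + u ≤ y + v
+-mono-≤ {x} {y} {u} {v} x≤y u≤v ε 0<ε =
  let M , p = x≤y (½ ℚ.* ε) (half 0<ε)
      N , q = u≤v (½ ℚ.* ε) (half 0<ε)
  in M ℕ.⊔ N , λ m m≥ → ℚ.≤-trans (ℚ.+-mono-≤ (p m (⊔ˡ m≥)) (q m (⊔ʳ {M} m≥)))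
    (ℚ.≤-reflexive (solve 3 (λ y v e → (y :+ con ½ :* e) :+ (v :+ con ½ :* e) := (y :+ v) :+ e) refl (approx y m) (approx v m) ε))

∣∣-bounds : ∀ {t r} → ℚ.∣ t ∣ ℚ.≤ r → t ℚ.≤ r × ℚ.- t ℚ.≤ r
∣∣-bounds {t} {r} le with ℚ.∣p∣≡p∨∣p∣≡-p t
... | inj₁ eq = t≤r , ℚ.≤-trans (ℚ.neg-antimono-≤ 0≤t) (ℚ.≤-trans 0≤t t≤r)
  where
  0≤t : 0ℚ ℚ.≤ t
  0≤t = ℚ.∣p∣≡p⇒0≤p eq
  t≤r = ℚ.≤-trans (ℚ.≤-reflexive (sym eq)) le
... | inj₂ eq = ℚ.≤-trans t≤-t -t≤r , -t≤r
  where
  -t≤r = ℚ.≤-trans (ℚ.≤-reflexive (sym eq)) le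
  0≤-t : 0ℚ ℚ.≤ ℚ.- t
  0≤-t = subst (0ℚ ℚ.≤_) eq (ℚ.0≤∣p∣ t)
  t≤-t : t ℚ.≤ ℚ.- t
  t≤-t = ≤-certificate (Finite.+-nonNeg 0≤-t 0≤-t) (solve 1 (λ t → :- t := t :+ (:- t :+ :- t)) refl t)

≃⇒≥ : ∀ {x y} → x ≃ y → y ≤ x
≃⇒≥ {x} {y} x≃y ε 0<ε =
  let N , p = x≃y ε 0<ε
  in N , λ m m≥ → ≤-certificate (≤⇒0≤- (proj₂ (∣∣-bounds (p m m≥))))
    (solve 3 (λ x y e → x :+ e := y :+ (e :- (:- (x :- y)))) refl (approx x m) (approx y m) ε)

≃⇒≤ : ∀ {x y} → x ≃ y → x ≤ y
≃⇒≤ {x} {y} x≃y ε 0<ε =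
  let N , p = x≃y ε 0<ε
  in N , λ m m≥ → ≤-certificate (≤⇒0≤- (proj₁ (∣∣-bounds (p m m≥))))
    (solve 3 (λ x y e → y :+ e := x :+ (e :- (x :- y))) refl (approx x m) (approx y m) ε)

eventually-≤ : ∀ x → ∃[ b ] 0ℚ ℚ.≤ b × ∃[ N ] ∀ m → m ≥ N → approx x m ℚ.≤ b
eventually-≤ x with cauchy x 1ℚ (ℚ.positive⁻¹ 1ℚ)
... | N , close = ℚ.∣ approx x N ∣ ℚ.+ 1ℚ , Finite.+-nonNeg (ℚ.0≤∣p∣ (approx x N)) 0≤1 , N , λ m m≥ → ≤-certificate
  (Finite.+-nonNeg (≤⇒0≤- (proj₁ (∣∣-bounds {approx x N} ℚ.≤-refl))) (≤⇒0≤- (proj₁ (∣∣-bounds (close m N m≥ ℕ.≤-refl)))))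
  (solve 3 (λ x y z → z :+ con 1ℚ := x :+ ((z :- y) :+ (con 1ℚ :- (x :- y)))) refl (approx x m) (approx x N) ℚ.∣ approx x N ∣)

-- With a, z ≥ −η one has (a + η) (z + η) ≥ 0, so a z ≥ −η (a + z + η), and a, z are bounded.
*-nonNeg : ∀ {a z} → 0ℝ ≤ a → 0ℝ ≤ z → 0ℝ ≤ a * z
*-nonNeg {a} {z} 0≤a 0≤z ε 0<ε =
  let (A , 0≤A , K , a≤A) = eventually-≤ a
      (Z , 0≤Z , L , z≤Z) = eventually-≤ z
      D = A ℚ.+ Z ℚ.+ 1ℚ
      0<D : 0ℚ ℚ.< D
      0<D = ℚ.+-mono-≤-< (Finite.+-nonNeg 0≤A 0≤Z) (ℚ.positive⁻¹ 1ℚ)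
      instance
        D-pos = ℚ.positive 0<D
        D-nz  = ℚ.pos⇒nonZero D
      D⁻¹ = ℚ.1/ D
      0<D⁻¹ = ℚ.positive⁻¹ D⁻¹ {{ℚ.1/pos⇒pos D}}
      η = (D⁻¹ ℚ.* ε) ℚ.⊓ 1ℚ
      0<η : 0ℚ ℚ.< η
      0<η = ⊓-pos (Finite.*-pos 0<D⁻¹ 0<ε) (ℚ.positive⁻¹ 1ℚ)
      0≤η = ℚ.<⇒≤ 0<η
      (M , p) = 0≤a η 0<η
      (N , q) = 0≤z η 0<η
      D*η≤ε : D ℚ.* η ℚ.≤ ε
      D*η≤ε = ℚ.≤-trans (Finite.*-monoˡ (ℚ.<⇒≤ 0<D) (ℚ.p⊓q≤p (D⁻¹ ℚ.* ε) 1ℚ))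
        (ℚ.≤-reflexive (trans (sym (ℚ.*-assoc D D⁻¹ ε)) (trans (cong (ℚ._* ε) (ℚ.*-inverseʳ D)) (ℚ.*-identityˡ ε))))
  in (K ℕ.⊔ L) ℕ.⊔ (M ℕ.⊔ N) , λ m m≥ →
    let x = approx a m
        y = approx z m
        x≤A = a≤A m (⊔ˡ {K} {L} (⊔ˡ m≥))
        y≤Z = z≤Z m (⊔ʳ {K} (⊔ˡ m≥))
        0≤x+η = p m (⊔ˡ {M} (⊔ʳ {K ℕ.⊔ L} m≥))
        0≤y+η = q m (⊔ʳ {M} (⊔ʳ {K ℕ.⊔ L} m≥))
    in ≤-certificate
      (Finite.+-nonNeg (Finite.+-nonNeg (Finite.*-nonNeg 0≤x+η 0≤y+η) (Finite.*-nonNeg 0≤η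
          (Finite.+-nonNeg (Finite.+-nonNeg (≤⇒0≤- x≤A) (≤⇒0≤- y≤Z)) (≤⇒0≤- (ℚ.p⊓q≤q (D⁻¹ ℚ.* ε) 1ℚ)))))
        (≤⇒0≤- D*η≤ε))
      (solve 6 (λ x y h A Z e → x :* y :+ e := con 0ℚ :+
        ((x :+ h) :* (y :+ h) :+ h :* ((A :- x) :+ (Z :- y) :+ (con 1ℚ :- h)) :+ (e :- (A :+ Z :+ con 1ℚ) :* h))) refl x y η A Z ε)
  where
  ⊓-pos : ∀ {a b} → 0ℚ ℚ.< a → 0ℚ ℚ.< b → 0ℚ ℚ.< a ℚ.⊓ b
  ⊓-pos {a} {b} 0<a 0<b with ℚ.≤-total a b
  ... | inj₁ a≤b = subst (0ℚ ℚ.<_) (sym (ℚ.p≤q⇒p⊓q≡p a≤b)) 0<a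
  ... | inj₂ b≤a = subst (0ℚ ℚ.<_) (sym (ℚ.p≥q⇒p⊓q≡q b≤a)) 0<b

*-monoˡ-≤ : ∀ {a x y} → 0ℝ ≤ a → x ≤ y → a * x ≤ a * y
*-monoˡ-≤ {a} {x} {y} 0≤a x≤y ε 0<ε =
  let N , p = *-nonNeg {a} {y - x} 0≤a 0≤y-x ε 0<ε
  in N , λ m m≥ → ≤-certificate (p m m≥)
    (solve 4 (λ a x y e → a :* y :+ e := a :* x :+ (a :* (y :- x) :+ e)) refl (approx a m) (approx x m) (approx y m) ε)
  where
  0≤y-x : 0ℝ ≤ y - x
  0≤y-x ε 0<ε =
    let N , p = x≤y ε 0<ε
    in N , λ m m≥ → ≤-certificate (≤⇒0≤- (p m m≥))
      (solve 3 (λ x y e → y :- x :+ e := con 0ℚ :+ (y :+ e :- x)) refl (approx x m) (approx y m) ε)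

fromℚ-≤ : ∀ {p q} → p ℚ.≤ q → fromℚ p ≤ fromℚ q
fromℚ-≤ {p} {q} p≤q = pointwise-≤ {fromℚ p} {fromℚ q} (λ _ → p≤q)

sum-mono : ∀ {k} {f g : Fin k → ℝ} → (∀ i → f i ≤ g i) → sum f ≤ sum g
sum-mono {zero}  f≤g = fromℚ-≤ ℚ.≤-refl
sum-mono {suc k} {f} {g} f≤g = +-mono-≤ {f zero} {g zero} {sum (f ∘ suc)} {sum (g ∘ suc)} (f≤g zero) (sum-mono (f≤g ∘ suc))

approx-sum : ∀ {k} (f : Fin k → ℝ) m → approx (sum f) m ≡ ∑ (allFin k) (λ i → approx (f i) m)
approx-sum {zero}  f m = refl
approx-sum {suc k} f m = trans (cong (approx (f zero) m ℚ.+_) (approx-sum (f ∘ suc) m))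
  (sym (Finite.∑-allFin-suc k (λ i → approx (f i) m)))

∑ℝ : {A : Set} → List A → (A → ℝ) → ℝ
∑ℝ []       f = 0ℝ
∑ℝ (x ∷ xs) f = f x + ∑ℝ xs f

approx-∑ℝ : ∀ {A : Set} (xs : List A) (f : A → ℝ) m → approx (∑ℝ xs f) m ≡ ∑ xs (λ x → approx (f x) m)
approx-∑ℝ []       f m = refl
approx-∑ℝ (x ∷ xs) f m = cong (approx (f x) m ℚ.+_) (approx-∑ℝ xs f m)

∑ℝ-mono : ∀ {A : Set} (xs : List A) {f g : A → ℝ} → (∀ x → f x ≤ g x) → ∑ℝ xs f ≤ ∑ℝ xs g
∑ℝ-mono []       f≤g = fromℚ-≤ ℚ.≤-refl
∑ℝ-mono (x ∷ xs) {f} {g} f≤g = +-mono-≤ {f x} {g x} {∑ℝ xs f} {∑ℝ xs g} (f≤g x) (∑ℝ-mono xs f≤g)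

-- Whether the mass of `A` is positive, undecidable for real probabilities in general, is here the
-- decidable question whether `A` meets `S`.
oracle : ∀ {n} → Subset n → Oracle n
oracle S A ne = record
  { pr     = λ j → fromℚ (answer A S j)
  ; pr-≥0  = λ j → fromℚ-≤ (Finite.0≤uniform (support A S) j)
  ; pr-sum = ≡⇒≃ {sum (λ j → fromℚ (answer A S j))} {1ℝ} λ m →
      trans (approx-sum (λ j → fromℚ (answer A S j)) m) (Finite.∑uniform (Finite.support-nonempty A S ne))
  }

expectation-≥ : ∀ {k} (coin : Distribution k) {c} {f : Fin k → ℝ} → 0ℚ ℚ.≤ c → (∀ i → fromℚ c ≤ f i) →
                fromℚ c ≤ sum (λ i → pr coin i * f i)
expectation-≥ {k} coin {c} {f} 0≤c c≤f =
  ≤-trans {fromℚ c} {sum (λ i → pr coin i * fromℚ c)} {sum (λ i → pr coin i * f i)}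
    (≤-trans {fromℚ c} {fromℚ c * sum (pr coin)} {sum (λ i → pr coin i * fromℚ c)}
      (≤-trans {fromℚ c} {fromℚ c * 1ℝ} {fromℚ c * sum (pr coin)}
        (≡⇒≤ {fromℚ c} {fromℚ c * 1ℝ} (λ _ → sym (ℚ.*-identityʳ c)))
        (*-monoˡ-≤ {fromℚ c} {1ℝ} {sum (pr coin)} (fromℚ-≤ 0≤c) (≃⇒≥ {sum (pr coin)} {1ℝ} (pr-sum coin))))
      (≡⇒≤ {fromℚ c * sum (pr coin)} {sum (λ i → pr coin i * fromℚ c)} λ m → sym (trans
        (approx-sum (λ i → pr coin i * fromℚ c) m)
        (trans (Finite.∑-*ʳ (allFin k) c (λ i → approx (pr coin i) m))
          (trans (ℚ.*-comm _ c) (cong (c ℚ.*_) (sym (approx-sum (pr coin) m))))))))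
    (sum-mono (λ i → *-monoˡ-≤ {pr coin i} {fromℚ c} {f i} (pr-≥0 coin i) (c≤f i)))

expectation-≤ : ∀ {k} (coin : Distribution k) {f : Fin k → ℝ} → (∀ i → f i ≤ 1ℝ) →
                sum (λ i → pr coin i * f i) ≤ 1ℝ
expectation-≤ {k} coin {f} f≤1 =
  ≤-trans {sum (λ i → pr coin i * f i)} {sum (λ i → pr coin i * 1ℝ)} {1ℝ}
    (sum-mono (λ i → *-monoˡ-≤ {pr coin i} {f i} {1ℝ} (pr-≥0 coin i) (f≤1 i)))
    (≤-trans {sum (λ i → pr coin i * 1ℝ)} {sum (pr coin)} {1ℝ}
      (≡⇒≤ {sum (λ i → pr coin i * 1ℝ)} {sum (pr coin)} λ m → trans (approx-sum (λ i → pr coin i * 1ℝ) m)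
        (trans (Finite.∑-cong (allFin k) (λ i → ℚ.*-identityʳ (approx (pr coin i) m))) (sym (approx-sum (pr coin) m))))
      (≃⇒≤ {sum (pr coin)} {1ℝ} (pr-sum coin)))

module _ {n : ℕ} where

  loss : ∀ {q} → Weight {n} → Algorithm n q → ℝ
  loss w T = ∑ℝ (subsets n) λ S → fromℚ (w S true) * outputProb (oracle S) T true + fromℚ (w S false) * outputProb (oracle S) T false

  private
    Out : ℕ → Set
    Out k = Subset n → Fin k → ℚ

    exchange : ∀ {k} (w : Weight {n}) (c : Out k) (x y : Out k) →
      ∑ (subsets n) (λ S → w S true ℚ.* ∑ (allFin k) (λ i → c S i ℚ.* x S i) ℚ.+ w S false ℚ.* ∑ (allFin k) (λ i → c S i ℚ.* y S i))
      ≡ ∑ (allFin k) (λ i → ∑ (subsets n) (λ S → (w S true ℚ.* c S i) ℚ.* x S i ℚ.+ (w S false ℚ.* c S i) ℚ.* y S i))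
    exchange {k} w c x y = trans
      (Finite.∑-cong (subsets n) (λ S → trans
        (cong₂ ℚ._+_ (sym (Finite.∑-*ˡ (allFin k) (w S true) (λ i → c S i ℚ.* x S i))) (sym (Finite.∑-*ˡ (allFin k) (w S false) (λ i → c S i ℚ.* y S i))))
        (trans (sym (Finite.∑-+ (allFin k) (λ i → w S true ℚ.* (c S i ℚ.* x S i)) (λ i → w S false ℚ.* (c S i ℚ.* y S i))))
          (Finite.∑-cong (allFin k) (λ i → cong₂ ℚ._+_ (sym (ℚ.*-assoc (w S true) (c S i) (x S i))) (sym (ℚ.*-assoc (w S false) (c S i) (y S i))))))))
      (Finite.∑-swap (subsets n) (allFin k) _)

  loss-toss : ∀ {q k} (w : Weight {n}) (coin : Distribution k) (T : Fin k → Algorithm n q) →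
              sum (λ i → pr coin i * loss w (T i)) ≤ loss w (toss coin T)
  loss-toss {q} {k} w coin T = ≡⇒≤ {sum (λ i → pr coin i * loss w (T i))} {loss w (toss coin T)} λ m →
    let o : Bool → Out k
        o b S i = approx (outputProb (oracle S) (T i) b) m
        c : Fin k → ℚ
        c i = approx (pr coin i) m
    in sym (trans
      (approx-∑ℝ (subsets n) _ m)
      (trans (Finite.∑-cong (subsets n) (λ S → cong₂ (λ u v → w S true ℚ.* u ℚ.+ w S false ℚ.* v)
          (approx-sum (λ i → pr coin i * outputProb (oracle S) (T i) true) m)
          (approx-sum (λ i → pr coin i * outputProb (oracle S) (T i) false) m)))
        (trans (exchange w (λ _ → c) (o true) (o false))
          (trans (Finite.∑-cong (allFin k) (λ i → trans
              (Finite.∑-cong (subsets n) (λ S → solve 5 (λ u v c x y → (u :* c) :* x :+ (v :* c) :* y := c :* (u :* x :+ v :* y)) refl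
                (w S true) (w S false) (c i) (o true S i) (o false S i)))
              (trans (Finite.∑-*ˡ (subsets n) (c i) (λ S → w S true ℚ.* o true S i ℚ.+ w S false ℚ.* o false S i))
                (cong (c i ℚ.*_) (sym (approx-∑ℝ (subsets n) _ m))))))
            (sym (approx-sum (λ i → pr coin i * loss w (T i)) m))))))

  -- The probability of an answer depends on `S` and is therefore absorbed into the weight, which is
  -- the form in which `Cert` passes to the next sample.
  loss-sample : ∀ {q} (w : Weight {n}) A ne (T : Fin n → Algorithm n q) →
                sum (λ j → loss (λ S b → w S b ℚ.* answer A S j) (T j)) ≤ loss w (sample A ne T)
  loss-sample {q} w A ne T = ≡⇒≤ {sum (λ j → loss (λ S b → w S b ℚ.* answer A S j) (T j))} {loss w (sample A ne T)} λ m →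
    let o : Bool → Out n
        o b S j = approx (outputProb (oracle S) (T j) b) m
    in sym (trans
      (approx-∑ℝ (subsets n) _ m)
      (trans (Finite.∑-cong (subsets n) (λ S → cong₂ (λ u v → w S true ℚ.* u ℚ.+ w S false ℚ.* v)
          (approx-sum (λ j → fromℚ (answer A S j) * outputProb (oracle S) (T j) true) m)
          (approx-sum (λ j → fromℚ (answer A S j) * outputProb (oracle S) (T j) false) m)))
        (trans (exchange w (answer A) (o true) (o false))
          (trans (Finite.∑-cong (allFin n) (λ j → sym (approx-∑ℝ (subsets n) _ m)))
            (sym (approx-sum (λ j → loss (λ S b → w S b ℚ.* answer A S j) (T j)) m))))))

  -- A coin is independent of `S` and leaves the weight unchanged, so one certificate serves all its
  -- outcomes. A sample uses the certificates of the changed weights.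
  Cert⇒loss : ∀ {q} (T : Algorithm n q) {w c} → 0ℚ ℚ.≤ c → Cert q w c → fromℚ c ≤ loss w T
  Cert⇒loss {q} (output b) {w} {c} 0≤c cert = pointwise-≤ {fromℚ c} {loss {q} w (output b)} λ m →
    ℚ.≤-trans (Finite.Cert-leafy q cert b) (ℚ.≤-reflexive (trans (Finite.∑-cong (subsets n) (value b m)) (sym (approx-∑ℝ (subsets n) _ m))))
    where
    value : ∀ b m S → w S b ≡ w S true ℚ.* approx (outputProb {q = q} (oracle S) (output b) true) m
                               ℚ.+ w S false ℚ.* approx (outputProb {q = q} (oracle S) (output b) false) m
    value true  m S = solve 2 (λ u v → u := u :* con 1ℚ :+ v :* con 0ℚ) refl (w S true) (w S false)
    value false m S = solve 2 (λ u v → v := u :* con 0ℚ :+ v :* con 1ℚ) refl (w S true) (w S false)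
  Cert⇒loss (toss coin T) {w} {c} 0≤c cert =
    ≤-trans {fromℚ c} {sum (λ i → pr coin i * loss w (T i))} {loss w (toss coin T)}
      (expectation-≥ coin {c} {λ i → loss w (T i)} 0≤c (λ i → Cert⇒loss (T i) 0≤c cert))
      (loss-toss w coin T)
  Cert⇒loss (sample A ne T) {w} {c} 0≤c (_ , step) =
    let c′ , 0≤c′ , c≤ , certs = step A ne
        w′ : Fin n → Weight {n}
        w′ j S b = w S b ℚ.* answer A S j
    in ≤-trans {fromℚ c} {sum (λ j → loss (w′ j) (T j))} {loss w (sample A ne T)}
      (≤-trans {fromℚ c} {sum (λ j → fromℚ (c′ j))} {sum (λ j → loss (w′ j) (T j))}
        (pointwise-≤ {fromℚ c} {sum (λ j → fromℚ (c′ j))} λ m →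
          ℚ.≤-trans c≤ (ℚ.≤-reflexive (sym (approx-sum (λ j → fromℚ (c′ j)) m))))
        (sum-mono (λ j → Cert⇒loss (T j) (0≤c′ j) (certs j))))
      (loss-sample w A ne T)

outputProb-total : ∀ {n q} (O : Oracle n) (T : Algorithm n q) → outputProb O T true + outputProb O T false ≤ 1ℝ
outputProb-total O (output true)  = fromℚ-≤ ℚ.≤-refl
outputProb-total O (output false) = fromℚ-≤ ℚ.≤-refl
outputProb-total O (toss coin T)  =
  ≤-trans {outputProb O (toss coin T) true + outputProb O (toss coin T) false}
    {sum (λ i → pr coin i * (outputProb O (T i) true + outputProb O (T i) false))} {1ℝ}
    (distribute coin (λ i → outputProb O (T i) true) (λ i → outputProb O (T i) false))
    (expectation-≤ coin {λ i → outputProb O (T i) true + outputProb O (T i) false} (λ i → outputProb-total O (T i)))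
  where
  distribute : ∀ {k} (coin : Distribution k) (f g : Fin k → ℝ) →
    sum (λ i → pr coin i * f i) + sum (λ i → pr coin i * g i) ≤ sum (λ i → pr coin i * (f i + g i))
  distribute {k} coin f g = ≡⇒≤ {sum (λ i → pr coin i * f i) + sum (λ i → pr coin i * g i)} {sum (λ i → pr coin i * (f i + g i))} λ m →
    trans (cong₂ ℚ._+_ (approx-sum (λ i → pr coin i * f i) m) (approx-sum (λ i → pr coin i * g i) m))
      (trans (sym (Finite.∑-+ (allFin k) _ _))
        (trans (Finite.∑-cong (allFin k) (λ i → sym (ℚ.*-distribˡ-+ (approx (pr coin i) m) (approx (f i) m) (approx (g i) m))))
          (sym (approx-sum (λ i → pr coin i * (f i + g i)) m))))
outputProb-total O (sample A ne T) = outputProb-total O (toss (O A ne) T)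

-- Uniform distributions on subsets

uniformly-on : ∀ {n} (S : Subset n) → Nonempty S → Distribution n
uniformly-on S ne = record
  { pr     = λ i → fromℚ (uniform S i)
  ; pr-≥0  = λ i → fromℚ-≤ (Finite.0≤uniform S i)
  ; pr-sum = ≡⇒≃ {sum (λ i → fromℚ (uniform S i))} {1ℝ} λ m →
      trans (approx-sum (λ i → fromℚ (uniform S i)) m) (Finite.∑uniform ne)
  }

answer-outside : ∀ {n} (A S : Subset n) {j} → j ∉ A → answer A S j ≡ 0ℚ
answer-outside A S {j} j∉A = trans (cong (ℚ._* inv ∣ support A S ∣) (Finite.χ-∉ (j∉A ∘ support⊆ )))
  (ℚ.*-zeroˡ (inv ∣ support A S ∣))
  where
  support⊆ : j ∈ support A S → j ∈ A
  support⊆ j∈ with nonempty? (A ∩ S)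
  ... | yes _ = proj₁ (x∈p∩q⁻ A S j∈)
  ... | no  _ = j∈

approx-mass : ∀ {n} (S : Subset n) ne A m → approx (mass (uniformly-on S ne) A) m ≡ ι ∣ A ∩ S ∣ ℚ.* inv ∣ S ∣
approx-mass {n} S ne A m = begin
  approx (mass (uniformly-on S ne) A) m
    ≡⟨ approx-sum (λ i → if lookup A i then fromℚ (uniform S i) else 0ℝ) m ⟩
  ∑ (allFin n) (λ i → approx (if lookup A i then fromℚ (uniform S i) else 0ℝ) m)
    ≡⟨ Finite.∑-cong (allFin n) (λ i → trans (select i (lookup A i))
         (trans (sym (ℚ.*-assoc (χ A i) (χ S i) (inv ∣ S ∣))) (cong (ℚ._* inv ∣ S ∣) (sym (Finite.χ-∩ A S i))))) ⟩
  ∑ (allFin n) (λ i → χ (A ∩ S) i ℚ.* inv ∣ S ∣)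
    ≡⟨ Finite.∑-*ʳ (allFin n) (inv ∣ S ∣) (χ (A ∩ S)) ⟩
  ∑ (allFin n) (χ (A ∩ S)) ℚ.* inv ∣ S ∣
    ≡⟨ cong (ℚ._* inv ∣ S ∣) (Finite.∑χ (A ∩ S)) ⟩
  ι ∣ A ∩ S ∣ ℚ.* inv ∣ S ∣ ∎
  where
  open ≡-Reasoning
  select : ∀ i b → approx (if b then fromℚ (uniform S i) else 0ℝ) m ≡ bit b ℚ.* uniform S i
  select i true  = sym (ℚ.*-identityˡ (uniform S i))
  select i false = sym (ℚ.*-zeroˡ (uniform S i))

empty-∩ : ∀ {n} {A S : Subset n} → ¬ Nonempty (A ∩ S) → ι ∣ A ∩ S ∣ ≡ 0ℚ
empty-∩ {n} em = trans (cong (λ X → ι ∣ X ∣) (Empty-unique em)) (trans (cong ι (∣⊥∣≡0 n)) Finite.ι-0)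

oracle-correct : ∀ {n} (S : Subset n) ne → IsConditionalOracle (uniformly-on S ne) (oracle S)
oracle-correct {n} S ne = record
  { supported = λ A neA j j∉A → ≡⇒≃ {fromℚ (answer A S j)} {0ℝ} (λ _ → answer-outside A S j∉A)
  ; posMass   = posMass
  ; zeroMass  = zeroMass
  }
  where
  μ = uniformly-on S ne
  0<inv : 0ℚ ℚ.< inv ∣ S ∣
  0<inv = ℚ.*-cancelˡ-<-nonNeg (ι ∣ S ∣) {{ℚ.nonNegative (Finite.0≤ι ∣ S ∣)}}
    (subst₂ ℚ._<_ (sym (ℚ.*-zeroʳ (ι ∣ S ∣))) (sym (Finite.ι*inv (nonempty⇒0<∣∣ ne))) (ℚ.positive⁻¹ 1ℚ))
  posMass : ∀ A neA j → j ∈ A → 0ℝ < mass μ A → fromℚ (answer A S j) * mass μ A ≃ fromℚ (uniform S j)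
  posMass A neA j j∈A (ε , 0<ε , N , le) with nonempty? (A ∩ S)
  ... | no em = contradiction (le N ℕ.≤-refl) (Finite.<⇒≱ (subst₂ ℚ._<_
    (sym (trans (approx-mass S ne A N) (trans (cong (ℚ._* inv ∣ S ∣) (empty-∩ em)) (ℚ.*-zeroˡ (inv ∣ S ∣)))))
    (sym (ℚ.+-identityˡ ε)) 0<ε))
  ... | yes ne′ = ≡⇒≃ {fromℚ (uniform (A ∩ S) j) * mass μ A} {fromℚ (uniform S j)} λ m → begin
    χ (A ∩ S) j ℚ.* inv ∣ A ∩ S ∣ ℚ.* approx (mass μ A) m
      ≡⟨ cong₂ (λ u v → u ℚ.* inv ∣ A ∩ S ∣ ℚ.* v)
           (trans (Finite.χ-∩ A S j) (trans (cong (ℚ._* χ S j) (Finite.χ-∈ j∈A)) (ℚ.*-identityˡ (χ S j)))) (approx-mass S ne A m) ⟩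
    χ S j ℚ.* inv ∣ A ∩ S ∣ ℚ.* (ι ∣ A ∩ S ∣ ℚ.* inv ∣ S ∣)
      ≡⟨ solve 4 (λ x i k s → x :* i :* (k :* s) := (k :* i) :* (x :* s)) refl (χ S j) (inv ∣ A ∩ S ∣) (ι ∣ A ∩ S ∣) (inv ∣ S ∣) ⟩
    ι ∣ A ∩ S ∣ ℚ.* inv ∣ A ∩ S ∣ ℚ.* uniform S j
      ≡⟨ cong (ℚ._* uniform S j) (Finite.ι*inv (nonempty⇒0<∣∣ ne′)) ⟩
    1ℚ ℚ.* uniform S j
      ≡⟨ ℚ.*-identityˡ (uniform S j) ⟩
    uniform S j ∎
    where open ≡-Reasoning
  zeroMass : ∀ A neA j → j ∈ A → mass μ A ≃ 0ℝ → fromℚ (answer A S j) * fromℕ ∣ A ∣ ≃ 1ℝ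
  zeroMass A neA j j∈A zero-mass with nonempty? (A ∩ S)
  ... | no _ = ≡⇒≃ {fromℚ (uniform A j) * fromℕ ∣ A ∣} {1ℝ} λ m → begin
    χ A j ℚ.* inv ∣ A ∣ ℚ.* (+ ∣ A ∣ ℚ./ 1)
      ≡⟨ cong₂ (λ u v → u ℚ.* inv ∣ A ∣ ℚ.* v) (Finite.χ-∈ j∈A) (sym (Finite.ι-def ∣ A ∣)) ⟩
    1ℚ ℚ.* inv ∣ A ∣ ℚ.* ι ∣ A ∣
      ≡⟨ solve 2 (λ i k → con 1ℚ :* i :* k := k :* i) refl (inv ∣ A ∣) (ι ∣ A ∣) ⟩
    ι ∣ A ∣ ℚ.* inv ∣ A ∣
      ≡⟨ Finite.ι*inv (nonempty⇒0<∣∣ neA) ⟩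
    1ℚ ∎
    where open ≡-Reasoning
  ... | yes ne′ =
    let t = ι ∣ A ∩ S ∣ ℚ.* inv ∣ S ∣
        0<t : 0ℚ ℚ.< t
        0<t = Finite.*-pos (Finite.0<ι (nonempty⇒0<∣∣ ne′)) 0<inv
        ε , 0<ε , ε<t = ℚ.<-dense 0<t
        N , close = zero-mass ε 0<ε
        t≤ε = ℚ.≤-trans (ℚ.≤-reflexive (trans (sym (ℚ.+-identityʳ t)) (cong (ℚ._- 0ℚ) (sym (approx-mass S ne A N)))))
          (proj₁ (∣∣-bounds (close N ℕ.≤-refl)))
    in contradiction t≤ε (Finite.<⇒≱ ε<t)

-- The comparison by `≃` keeps the property independent of the sequences representing the
-- probabilities. `κ` ranges over all natural numbers; values of `s κ` above `n` admit no set.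
scaled-property : ∀ {n} → (ℕ → ℕ) → Property n
scaled-property {n} s ν = Σ[ S ∈ Subset n ] ∃[ κ ] ∣ S ∣ ≡ s κ × (∀ i → pr ν i ≃ fromℚ (uniform S i))

permute-size : ∀ {n} (π : Permutation′ n) (S : Subset n) → ∣ Vec.tabulate (λ i → lookup S (π ⟨$⟩ʳ i)) ∣ ≡ ∣ S ∣
permute-size {n} π S = trans (size-tabulate (λ i → lookup S (π ⟨$⟩ʳ i)))
  (trans (sym (sum-permute (λ i → unit (lookup S i)) π))
    (trans (sym (size-tabulate (lookup S))) (cong ∣_∣ (tabulate∘lookup S))))
  where
  open NatSum ℕ.+-0-commutativeMonoid using (sum-permute) renaming (sum to sumℕ)
  unit : Bool → ℕ
  unit true  = 1
  unit false = 0
  size-tabulate : ∀ {k} (f : Fin k → Bool) → ∣ Vec.tabulate f ∣ ≡ sumℕ (λ i → unit (f i))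
  size-tabulate {zero}  f = refl
  size-tabulate {suc k} f with f zero
  ... | true  = cong suc (size-tabulate (f ∘ suc))
  ... | false = size-tabulate (f ∘ suc)

scaled-property-invariant : ∀ {n} s → LabelInvariant {n} (scaled-property s)
scaled-property-invariant s π μ ν ν≃μ∘π (S , κ , size , μ≃) =
  S′ , κ , trans (permute-size π S) size , λ i →
    ≃-trans {pr ν i} {pr μ (π ⟨$⟩ʳ i)} {fromℚ (uniform S′ i)} (ν≃μ∘π i)
      (≃-trans {pr μ (π ⟨$⟩ʳ i)} {fromℚ (uniform S (π ⟨$⟩ʳ i))} {fromℚ (uniform S′ i)} (μ≃ (π ⟨$⟩ʳ i))
        (≡⇒≃ {fromℚ (uniform S (π ⟨$⟩ʳ i))} {fromℚ (uniform S′ i)} λ _ → cong₂ (λ b k → bit b ℚ.* inv k)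
          (sym (lookup∘tabulate (λ i → lookup S (π ⟨$⟩ʳ i)) i)) (sym (permute-size π S))))
  where S′ = Vec.tabulate (λ i → lookup S (π ⟨$⟩ʳ i))

-- The function (χ S - χ T) / ∣S∣ sums to 1 - ∣T∣ / ∣S∣ ≥ 1/2 and lies below the absolute
-- difference: off `T` it equals `uniform S`, and on `T` it is at most 0.
uniform-distance : ∀ {n} (S T : Subset n) → 0 ℕ.< ∣ S ∣ → 2 ℕ.* ∣ T ∣ ℕ.≤ ∣ S ∣ →
                   ½ ℚ.≤ ∑ (allFin n) (λ i → ℚ.∣ uniform S i ℚ.- uniform T i ∣)
uniform-distance {n} S T 0<S 2T≤S = begin
  ½
    ≤⟨ ≤-certificate (≤⇒0≤- T/S≤½) (solve 1 (λ x → con 1ℚ :- x := con ½ :+ (con ½ :- x)) refl (t ℚ.* i)) ⟩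
  1ℚ ℚ.- t ℚ.* i
    ≡⟨ cong (ℚ._- t ℚ.* i) (sym (Finite.ι*inv 0<S)) ⟩
  s ℚ.* i ℚ.- t ℚ.* i
    ≡⟨ solve 3 (λ s t i → s :* i :- t :* i := (s :+ (:- con 1ℚ) :* t) :* i) refl s t i ⟩
  (s ℚ.+ -1ℚ ℚ.* t) ℚ.* i
    ≡⟨ cong (ℚ._* i) (trans (cong₂ (λ a b → a ℚ.+ -1ℚ ℚ.* b) (sym (Finite.∑χ S)) (sym (Finite.∑χ T)))
         (trans (cong (∑ (allFin n) (χ S) ℚ.+_) (sym (Finite.∑-*ˡ (allFin n) -1ℚ (χ T))))
           (sym (Finite.∑-+ (allFin n) (χ S) (λ j → -1ℚ ℚ.* χ T j))))) ⟩
  ∑ (allFin n) (λ j → χ S j ℚ.+ -1ℚ ℚ.* χ T j) ℚ.* i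
    ≡⟨ Finite.∑-*ʳ (allFin n) i _ ⟨
  ∑ (allFin n) (λ j → (χ S j ℚ.+ -1ℚ ℚ.* χ T j) ℚ.* i)
    ≤⟨ Finite.∑-mono (allFin n) pointwise ⟩
  ∑ (allFin n) (λ j → ℚ.∣ uniform S j ℚ.- uniform T j ∣) ∎
  where
  open ℚ.≤-Reasoning
  s = ι ∣ S ∣
  t = ι ∣ T ∣
  i = inv ∣ S ∣
  -1ℚ = ℚ.- 1ℚ
  T/S≤½ : ι ∣ T ∣ ℚ.* inv ∣ S ∣ ℚ.≤ ½
  T/S≤½ = Finite.*-cancelˡ (Finite.0<ι {2} (s≤s z≤n)) (ℚ.≤-trans
    (ℚ.≤-reflexive (trans (sym (ℚ.*-assoc (ι 2) (ι ∣ T ∣) (inv ∣ S ∣))) (cong (ℚ._* inv ∣ S ∣) (sym (Finite.ι-* 2 ∣ T ∣)))))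
    (ℚ.≤-trans (Finite.*-monoʳ (Finite.0≤inv ∣ S ∣) (Finite.ι-mono 2T≤S))
      (ℚ.≤-reflexive (trans (Finite.ι*inv 0<S) (sym (cong (ℚ._* ½) (Finite.ι-def 2)))))))
  pointwise : ∀ j → (χ S j ℚ.+ -1ℚ ℚ.* χ T j) ℚ.* i ℚ.≤ ℚ.∣ uniform S j ℚ.- uniform T j ∣
  pointwise j with lookup T j | lookup S j
  ... | true  | true  = ℚ.≤-trans (ℚ.≤-reflexive (solve 1 (λ i → (con 1ℚ :+ (:- con 1ℚ) :* con 1ℚ) :* i := con 0ℚ) refl (inv ∣ S ∣))) (ℚ.0≤∣p∣ _)
  ... | true  | false = ℚ.≤-trans (≤-certificate (Finite.0≤inv ∣ S ∣)
                          (solve 1 (λ i → con 0ℚ := (con 0ℚ :+ (:- con 1ℚ) :* con 1ℚ) :* i :+ i) refl (inv ∣ S ∣))) (ℚ.0≤∣p∣ _)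
  ... | false | b     = ℚ.≤-trans (ℚ.≤-reflexive
                          (solve 3 (λ b i j → (b :+ (:- con 1ℚ) :* con 0ℚ) :* i := b :* i :- con 0ℚ :* j) refl (bit b) (inv ∣ S ∣) (inv ∣ T ∣)))
                          (proj₁ (∣∣-bounds {bit b ℚ.* (inv ∣ S ∣) ℚ.- 0ℚ ℚ.* (inv ∣ T ∣)} ℚ.≤-refl))

-- The larger of the two sets takes the first place in `uniform-distance`. The 1/4 is the 1/2
-- obtained there times the 1/2 in `distance`.
uniform-far : ∀ {n} (S : Subset n) ne s →
              (∀ κ → 2 ℕ.* s κ ℕ.≤ ∣ S ∣ ⊎ (2 ℕ.* ∣ S ∣ ℕ.≤ s κ)) →
              Far (fromℚ (+ 1 ℚ./ 4)) (scaled-property s) (uniformly-on S ne)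
uniform-far {n} S ne s separated ν (T , κ , size , ν≃) =
  ≤-trans {fromℚ (+ 1 ℚ./ 4)} {fromℚ ½ * sum gap} {distance μ ν}
    (pointwise-≤ {fromℚ (+ 1 ℚ./ 4)} {fromℚ ½ * sum gap} λ m → Finite.*-monoˡ {½} {½} (ℚ.nonNegative⁻¹ ½)
      (ℚ.≤-trans (rational (separated κ)) (ℚ.≤-reflexive (sym (approx-sum gap m)))))
    (*-monoˡ-≤ {fromℚ ½} {sum gap} {sum (λ i → ∣ pr μ i - pr ν i ∣ℝ)} (fromℚ-≤ (ℚ.nonNegative⁻¹ ½)) (sum-mono close))
  where
  μ = uniformly-on S ne
  gap : Fin n → ℝ
  gap i = fromℚ ℚ.∣ uniform S i ℚ.- uniform T i ∣
  rational : 2 ℕ.* s κ ℕ.≤ ∣ S ∣ ⊎ (2 ℕ.* ∣ S ∣ ℕ.≤ s κ) → ½ ℚ.≤ ∑ (allFin n) (λ i → ℚ.∣ uniform S i ℚ.- uniform T i ∣)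
  rational (inj₁ le) = uniform-distance S T (nonempty⇒0<∣∣ ne) (subst (λ k → 2 ℕ.* k ℕ.≤ ∣ S ∣) (sym size) le)
  rational (inj₂ le) = ℚ.≤-trans
    (uniform-distance T S (ℕ.<-≤-trans (nonempty⇒0<∣∣ ne) (ℕ.≤-trans (ℕ.m≤m+n ∣ S ∣ _) 2S≤T)) 2S≤T)
    (ℚ.≤-reflexive (Finite.∑-cong (allFin n) λ i → trans
      (cong ℚ.∣_∣ (solve 2 (λ x y → x :- y := :- (y :- x)) refl (uniform T i) (uniform S i)))
      (ℚ.∣-p∣≡∣p∣ (uniform S i ℚ.- uniform T i))))
    where
    2S≤T : 2 ℕ.* ∣ S ∣ ℕ.≤ ∣ T ∣
    2S≤T = subst (2 ℕ.* ∣ S ∣ ℕ.≤_) (sym size) le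
  close : ∀ i → gap i ≤ ∣ pr μ i - pr ν i ∣ℝ
  close i ε 0<ε =
    let N , p = ν≃ i ε 0<ε
        x = uniform S i
        y = uniform T i
    in N , λ m m≥ → let z = approx (pr ν i) m in begin
      ℚ.∣ x ℚ.- y ∣                             ≡⟨ cong ℚ.∣_∣ (solve 3 (λ x y z → x :- y := (x :- z) :+ (z :- y)) refl x y z) ⟩
      ℚ.∣ (x ℚ.- z) ℚ.+ (z ℚ.- y) ∣             ≤⟨ ℚ.∣p+q∣≤∣p∣+∣q∣ (x ℚ.- z) (z ℚ.- y) ⟩
      ℚ.∣ x ℚ.- z ∣ ℚ.+ ℚ.∣ z ℚ.- y ∣           ≤⟨ ℚ.+-monoʳ-≤ ℚ.∣ x ℚ.- z ∣ (p m m≥) ⟩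
      ℚ.∣ x ℚ.- z ∣ ℚ.+ ε                       ∎
    where open ℚ.≤-Reasoning

-- Choice of the scales

⅓ : ℚ
⅓ = + 1 / 3

loss-≤ : ∀ {n q} (T : Algorithm n q) {w : Weight {n}} → (∀ S b → 0ℚ ℚ.≤ w S b) →
         (∀ S b → w S b ≡ 0ℚ ⊎ outputProb (oracle S) T b ≤ fromℚ ⅓) →
         loss w T ≤ fromℚ ((∑ (subsets n) (λ S → w S true) ℚ.+ ∑ (subsets n) (λ S → w S false)) ℚ.* ⅓)
loss-≤ {n} {q} T {w} 0≤w err = ≤-trans {loss w T} {∑ℝ (subsets n) bound} {fromℚ total}
  (∑ℝ-mono (subsets n) (λ S → +-mono-≤
    {fromℚ (w S true) * out S true} {fromℚ (w S true ℚ.* ⅓)} {fromℚ (w S false) * out S false} {fromℚ (w S false ℚ.* ⅓)}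
    (term S true) (term S false)))
  (≡⇒≤ {∑ℝ (subsets n) bound} {fromℚ total} λ m → trans (approx-∑ℝ (subsets n) bound m)
    (trans (Finite.∑-+ (subsets n) (λ S → w S true ℚ.* ⅓) (λ S → w S false ℚ.* ⅓))
      (trans (cong₂ ℚ._+_ (Finite.∑-*ʳ (subsets n) ⅓ (λ S → w S true)) (Finite.∑-*ʳ (subsets n) ⅓ (λ S → w S false)))
        (sym (ℚ.*-distribʳ-+ ⅓ (∑ (subsets n) (λ S → w S true)) (∑ (subsets n) (λ S → w S false)))))))
  where
  total = (∑ (subsets n) (λ S → w S true) ℚ.+ ∑ (subsets n) (λ S → w S false)) ℚ.* ⅓
  out : Subset n → Bool → ℝ
  out S b = outputProb (oracle S) T b
  bound : Subset n → ℝ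
  bound S = fromℚ (w S true ℚ.* ⅓) + fromℚ (w S false ℚ.* ⅓)
  term : ∀ S b → fromℚ (w S b) * out S b ≤ fromℚ (w S b ℚ.* ⅓)
  term S b with err S b
  ... | inj₂ le = *-monoˡ-≤ {fromℚ (w S b)} {out S b} {fromℚ ⅓} (fromℚ-≤ (0≤w S b)) le
  ... | inj₁ eq = ≡⇒≤ {fromℚ (w S b) * out S b} {fromℚ (w S b ℚ.* ⅓)} λ m →
    trans (cong (ℚ._* approx (out S b) m) eq) (trans (ℚ.*-zeroˡ (approx (out S b) m))
      (sym (trans (cong (ℚ._* ⅓) eq) (ℚ.*-zeroˡ ⅓))))

complement-≤ : ∀ {x y} → x + y ≤ 1ℝ → 1ℝ - fromℚ ⅓ ≤ x → y ≤ fromℚ ⅓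
complement-≤ {x} {y} x+y≤1 ⅔≤x ε 0<ε =
  let M , p = x+y≤1 (½ ℚ.* ε) (half 0<ε)
      N , q = ⅔≤x (½ ℚ.* ε) (half 0<ε)
  in M ℕ.⊔ N , λ m m≥ → ≤-certificate
    (Finite.+-nonNeg (≤⇒0≤- (p m (⊔ˡ m≥))) (≤⇒0≤- (q m (⊔ʳ {M} m≥))))
    (solve 3 (λ x y e → con ⅓ :+ e := y :+ ((con 1ℚ :+ con ½ :* e :- (x :+ y)) :+ (x :+ con ½ :* e :- (con 1ℚ :- con ⅓)))) refl
      (approx x m) (approx y m) ε)

complement-≤′ : ∀ {x y} → x + y ≤ 1ℝ → 1ℝ - fromℚ ⅓ ≤ y → x ≤ fromℚ ⅓
complement-≤′ {x} {y} x+y≤1 = complement-≤ {y} {x}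
  (≤-trans {y + x} {x + y} {1ℝ} (≡⇒≤ {y + x} {x + y} (λ m → ℚ.+-comm (approx y m) (approx x m))) x+y≤1)

n<2^n : ∀ n → n ℕ.< 2 ℕ.^ n
n<2^n zero    = s≤s z≤n
n<2^n (suc n) = ℕ.≤-trans (s≤s (n<2^n n)) (ℕ.≤-trans (ℕ.+-monoˡ-≤ (2 ℕ.^ n) (ℕ.≤-trans (s≤s z≤n) (n<2^n n)))
  (ℕ.≤-reflexive (cong (2 ℕ.^ n ℕ.+_) (sym (ℕ.+-identityʳ (2 ℕ.^ n))))))

abstract
  -- This is 64 · 4^Q, which exceeds 64 Q² since Q < 2^Q. As a power of 2 it makes all sizes powers
  -- of 2, to be compared with 2^(2^e).
  base : ℕ → ℕ
  base Q = 2 ℕ.^ (6 ℕ.+ (Q ℕ.+ Q))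

  base-def : ∀ Q → base Q ≡ 2 ℕ.^ (6 ℕ.+ (Q ℕ.+ Q))
  base-def Q = refl

-- The period 3 is what `gap` requires: (3κ + 2) + 2 = 3(κ + 1) + 1.
exponent : ℕ → Bool → ℕ
exponent κ false = 1 ℕ.+ κ ℕ.* 3
exponent κ true  = 2 ℕ.+ κ ℕ.* 3

size : ℕ → ℕ → Bool → ℕ
size Q κ b = base Q ℕ.^ exponent κ b

base≡ : ∀ Q → base Q ≡ 64 ℕ.* (2 ℕ.^ Q ℕ.* 2 ℕ.^ Q)
base≡ Q = trans (base-def Q) (trans (ℕ.^-distribˡ-+-* 2 6 (Q ℕ.+ Q)) (cong (64 ℕ.*_) (ℕ.^-distribˡ-+-* 2 Q Q)))

2≤base : ∀ Q → 2 ℕ.≤ base Q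
2≤base Q = subst (2 ℕ.≤_) (sym (base-def Q)) (ℕ.^-monoʳ-≤ 2 {1} {6 ℕ.+ (Q ℕ.+ Q)} (s≤s z≤n))

base-mono : ∀ Q {i j} → i ℕ.≤ j → base Q ℕ.^ i ℕ.≤ base Q ℕ.^ j
base-mono Q = ℕ.^-monoʳ-≤ (base Q) {{ℕ.>-nonZero (ℕ.≤-trans (s≤s z≤n) (2≤base Q))}}

64Q²≤base : ∀ Q → 64 ℕ.* (Q ℕ.* Q) ℕ.≤ base Q
64Q²≤base Q = ℕ.≤-trans (ℕ.*-monoʳ-≤ 64 (ℕ.*-mono-≤ (ℕ.<⇒≤ (n<2^n Q)) (ℕ.<⇒≤ (n<2^n Q)))) (ℕ.≤-reflexive (sym (base≡ Q)))

size-mono : ∀ Q κ → size Q κ false ℕ.≤ size Q κ true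
size-mono Q κ = base-mono Q (ℕ.n≤1+n (1 ℕ.+ κ ℕ.* 3))

size-gap : ∀ Q {κ κ′} → κ ℕ.< κ′ → size Q κ true ℕ.* (base Q ℕ.* base Q) ℕ.≤ size Q κ′ false
size-gap Q {κ} {κ′} κ<κ′ = ℕ.≤-trans (ℕ.≤-reflexive (regroup (base Q) (base Q ℕ.^ (κ ℕ.* 3))))
  (base-mono Q {4 ℕ.+ κ ℕ.* 3} (s≤s (ℕ.*-monoˡ-≤ 3 κ<κ′)))
  where
  regroup : ∀ b c → b ℕ.* (b ℕ.* c) ℕ.* (b ℕ.* b) ≡ b ℕ.* (b ℕ.* (b ℕ.* (b ℕ.* c)))
  regroup = solve-∀

-- The exponents are 1 and 2 modulo 3, hence distinct, so the sizes differ at least by a factor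
-- `base Q` ≥ 2.
size-separated : ∀ Q κ κ′ → 2 ℕ.* size Q κ′ false ℕ.≤ size Q κ true ⊎ 2 ℕ.* size Q κ true ℕ.≤ size Q κ′ false
size-separated Q κ κ′ with κ′ ℕ.≤? κ
... | yes κ′≤κ = inj₁ (ℕ.≤-trans (ℕ.*-monoˡ-≤ (size Q κ′ false) (2≤base Q))
  (base-mono Q {2 ℕ.+ κ′ ℕ.* 3} (s≤s (s≤s (ℕ.*-monoˡ-≤ 3 κ′≤κ)))))
... | no  κ′≰κ = inj₂ (ℕ.≤-trans (ℕ.*-monoˡ-≤ (size Q κ true) (2≤base Q))
  (base-mono Q {3 ℕ.+ κ ℕ.* 3} (ℕ.≤-trans (ℕ.n≤1+n _) (s≤s (ℕ.*-monoˡ-≤ 3 (ℕ.≰⇒> κ′≰κ))))))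

-- As a power of 2 the size has exponent (6 + 2Q)(2 + 3κ), at most 8 · 2^Q times 24 · 2^Q. The
-- coefficient 192 is rounded up to 2^8.
size-≤ : ∀ Q {κ} → κ ℕ.< 8 ℕ.* 2 ℕ.^ Q → size Q κ true ℕ.≤ 2 ℕ.^ (2 ℕ.^ (8 ℕ.+ (Q ℕ.+ Q)))
size-≤ Q {κ} κ<L = ℕ.≤-trans (ℕ.≤-reflexive (trans (cong (ℕ._^ (2 ℕ.+ κ ℕ.* 3)) (base-def Q)) (ℕ.^-*-assoc 2 (6 ℕ.+ (Q ℕ.+ Q)) (2 ℕ.+ κ ℕ.* 3)))) (ℕ.^-monoʳ-≤ 2 (begin
  (6 ℕ.+ (Q ℕ.+ Q)) ℕ.* (2 ℕ.+ κ ℕ.* 3)  ≤⟨ ℕ.*-mono-≤ small (ℕ.≤-trans (ℕ.n≤1+n _) (ℕ.*-monoˡ-≤ 3 κ<L)) ⟩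
  (8 ℕ.* x) ℕ.* (8 ℕ.* x ℕ.* 3)          ≡⟨ regroup x ⟩
  192 ℕ.* (x ℕ.* x)                      ≤⟨ ℕ.*-monoˡ-≤ (x ℕ.* x) {192} {256} (ℕ.m≤m+n 192 64) ⟩
  256 ℕ.* (x ℕ.* x)                      ≡⟨ trans (ℕ.^-distribˡ-+-* 2 8 (Q ℕ.+ Q)) (cong (256 ℕ.*_) (ℕ.^-distribˡ-+-* 2 Q Q)) ⟨
  2 ℕ.^ (8 ℕ.+ (Q ℕ.+ Q))                ∎))
  where
  open ℕ.≤-Reasoning
  x = 2 ℕ.^ Q
  small : 6 ℕ.+ (Q ℕ.+ Q) ℕ.≤ 8 ℕ.* x
  small = ℕ.≤-trans (ℕ.+-mono-≤ {6} {6 ℕ.* x} (ℕ.*-monoʳ-≤ 6 {1} (ℕ.≤-trans (s≤s z≤n) (n<2^n Q)))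
      (ℕ.+-mono-≤ (ℕ.<⇒≤ (n<2^n Q)) (ℕ.<⇒≤ (n<2^n Q))))
    (ℕ.≤-reflexive (eight x))
    where
    eight : ∀ x → 6 ℕ.* x ℕ.+ (x ℕ.+ x) ≡ 8 ℕ.* x
    eight = solve-∀
  regroup : ∀ x → (8 ℕ.* x) ℕ.* (8 ℕ.* x ℕ.* 3) ≡ 192 ℕ.* (x ℕ.* x)
  regroup = solve-∀

∑δ-zero : ∀ (K : List ℕ) {s} {f : ℕ → ℕ} → ¬ Any (λ κ → s ≡ f κ) K → ∑ K (λ κ → δ s (f κ)) ≡ 0ℚ
∑δ-zero []      _    = refl
∑δ-zero (κ ∷ K) none = cong₂ ℚ._+_ (Finite.δ-zero (none ∘ here)) (∑δ-zero K (none ∘ there))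

0<∣∣⇒nonempty : ∀ {n} {X : Subset n} → 0 ℕ.< ∣ X ∣ → Nonempty X
0<∣∣⇒nonempty {n} {X} 0<X with nonempty? X
... | yes ne = ne
... | no em  = contradiction (sym (trans (cong ∣_∣ (Empty-unique em)) (∣⊥∣≡0 n))) (ℕ.<⇒≢ 0<X)

even-scales : ∀ Q n → Property n
even-scales Q n = scaled-property (λ κ → size Q κ false)

module _ {n Q q} (0<Q : 0 ℕ.< Q) (large-n : 2 ℕ.^ (2 ℕ.^ (8 ℕ.+ (Q ℕ.+ Q))) ℕ.≤ n) (q≤Q : q ℕ.≤ Q)
         (T : Algorithm n q) (tester : IsTester (even-scales Q n) (fromℚ (+ 1 / 4)) (fromℚ ⅓) T) where

  private
    open module G = Game {n} {Q} {base Q} (size Q) 0<Q (64Q²≤base Q) (size-mono Q) (λ {κ} {κ′} → size-gap Q {κ} {κ′})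
      using (state; weights; V; Inv; criticals)

    x = 2 ℕ.^ Q
    L = 8 ℕ.* x
    K = upTo L
    st = state Subset.⊥ Subset.⊤ []
    w = weights K st

    0<size : ∀ κ b → 0 ℕ.< size Q κ b
    0<size κ b = base-mono Q {0} {exponent κ b} z≤n

    wrong-output : ∀ S κ b → ∣ S ∣ ≡ size Q κ b → outputProb (oracle S) T b ≤ fromℚ ⅓
    wrong-output S κ false eq =
      let ne = 0<∣∣⇒nonempty {X = S} (subst (0 ℕ.<_) (sym eq) (0<size κ false))
      in complement-≤ {outputProb (oracle S) T true} {outputProb (oracle S) T false} (outputProb-total (oracle S) T)
        (IsTester.accepts tester (uniformly-on S ne) (oracle S) (oracle-correct S ne)
          (S , κ , eq , λ i → ≡⇒≃ {fromℚ (uniform S i)} {fromℚ (uniform S i)} (λ _ → refl)))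
    wrong-output S κ true eq =
      let ne = 0<∣∣⇒nonempty {X = S} (subst (0 ℕ.<_) (sym eq) (0<size κ true))
      in complement-≤′ {outputProb (oracle S) T true} {outputProb (oracle S) T false} (outputProb-total (oracle S) T)
        (IsTester.rejects tester (uniformly-on S ne) (oracle S) (oracle-correct S ne)
          (uniform-far S ne (λ κ′ → size Q κ′ false) λ κ′ →
            subst (λ s → 2 ℕ.* size Q κ′ false ℕ.≤ s ⊎ 2 ℕ.* s ℕ.≤ size Q κ′ false) (sym eq) (size-separated Q κ κ′)))

    error : ∀ S b → w S b ≡ 0ℚ ⊎ outputProb (oracle S) T b ≤ fromℚ ⅓
    error S b with any? (λ κ → ∣ S ∣ ℕ.≟ size Q κ b) K
    ... | no none  = inj₁ (trans (cong (ℚ._* V st S) (∑δ-zero K none)) (ℚ.*-zeroˡ (V st S)))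
    ... | yes some = let κ , eq = satisfied some in inj₂ (wrong-output S κ b eq)

    -- The initial state restricts nothing and has an empty history, so of `V` only the
    -- normalisation and the factor 9/8 remain.
    mean-V : ∀ {s} → s ℕ.≤ n → E n s (V st) ≡ + 9 / 8
    mean-V {s} s≤n = begin
      E n s (V st)
        ≡⟨ Finite.∑-cong (subsets n) (λ S → trans (sym (ℚ.*-assoc (δ ∣ S ∣ s) (c ∣ S ∣) _))
             (trans (cong₂ ℚ._*_ (Finite.δ-subst c ∣ S ∣ s) (indicator S)) (ℚ.*-assoc (δ ∣ S ∣ s) (c s) _))) ⟩
      E n s (λ S → c s ℚ.* ⟦ Subset.⊥ ⊑ S ⟧)
        ≡⟨ Finite.E-*ˡ n s (c s) ⟦ Subset.⊥ ⊑_⟧ ⟩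
      c s ℚ.* E n s ⟦ Subset.⊥ ⊑_⟧
        ≡⟨ cong (c s ℚ.*_) (subst (λ k → ∑ (subsets n) (λ S → δ ∣ S ∣ (k ℕ.+ s) ℚ.* ⟦ Subset.⊥ ⊑ S ⟧) ≡ ι ((n ℕ.∸ k) C s))
             (∣⊥∣≡0 n) (Finite.count-supersets (Subset.⊥ {n}) s)) ⟩
      + 9 / 8 ℚ.* inv (n C s) ℚ.* ι (n C s)
        ≡⟨ solve 3 (λ a i b → a :* i :* b := a :* (b :* i)) refl (+ 9 / 8) (inv (n C s)) (ι (n C s)) ⟩
      + 9 / 8 ℚ.* (ι (n C s) ℚ.* inv (n C s))
        ≡⟨ trans (cong (+ 9 / 8 ℚ.*_) (Finite.ι*inv (Finite.0<nCk s≤n))) (ℚ.*-identityʳ (+ 9 / 8)) ⟩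
      + 9 / 8 ∎
      where
      open ≡-Reasoning
      c : ℕ → ℚ
      c k = + 9 / 8 ℚ.* inv (n C k)
      indicator : ∀ S → ⟦ Subset.⊥ ⊑ S ⟧ ℚ.* ⟦ S ⊑ Subset.⊤ ⟧ ℚ.* 1ℚ ≡ ⟦ Subset.⊥ ⊑ S ⟧
      indicator S = trans (cong (λ t → ⟦ Subset.⊥ ⊑ S ⟧ ℚ.* t ℚ.* 1ℚ) (Finite.⊑-yes {X = S} ⊆⊤))
        (solve 1 (λ a → a :* con 1ℚ :* con 1ℚ := a) refl ⟦ Subset.⊥ ⊑ S ⟧)

    size≤n : ∀ {κ} → κ ℕ.< L → size Q κ true ℕ.≤ n
    size≤n κ<L = ℕ.≤-trans (size-≤ Q κ<L) large-n

    sizes≤n : All (λ κ → size Q κ true ℕ.≤ n) K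
    sizes≤n = applyUpTo⁺₁ id L size≤n

    total-weight : ∀ b → ∑ (subsets n) (λ S → w S b) ≡ ι L ℚ.* (+ 9 / 8)
    total-weight b = begin
      ∑ (subsets n) (λ S → w S b)
        ≡⟨ Finite.∑-cong (subsets n) (λ S → sym (Finite.∑-*ʳ K (V st S) (λ κ → δ ∣ S ∣ (size Q κ b)))) ⟩
      ∑ (subsets n) (λ S → ∑ K (λ κ → δ ∣ S ∣ (size Q κ b) ℚ.* V st S))
        ≡⟨ Finite.∑-swap (subsets n) K (λ S κ → δ ∣ S ∣ (size Q κ b) ℚ.* V st S) ⟩
      ∑ K (λ κ → E n (size Q κ b) (V st))
        ≡⟨ ∑-const-All K (All.map (λ {κ} le → mean-V (ℕ.≤-trans (G.size≤ κ b) le)) sizes≤n) ⟩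
      ι (length K) ℚ.* (+ 9 / 8)
        ≡⟨ cong (λ k → ι k ℚ.* (+ 9 / 8)) (length-upTo L) ⟩
      ι L ℚ.* (+ 9 / 8) ∎
      where
      open ≡-Reasoning
      ∑-const-All : ∀ (K : List ℕ) {f : ℕ → ℚ} {c} → All (λ κ → f κ ≡ c) K → ∑ K f ≡ ι (length K) ℚ.* c
      ∑-const-All K {f} {c} eqs = trans (go K eqs) (Finite.∑-const K c)
        where
        go : ∀ K → All (λ κ → f κ ≡ c) K → ∑ K f ≡ ∑ K (λ _ → c)
        go []      _                 = refl
        go (κ ∷ K) (eq All.∷ eqs) = cong₂ ℚ._+_ eq (go K eqs)

    inv-st : All (Inv 0 st) K
    inv-st = All.map (λ {κ} le → record
      { B≤size = ℕ.≤-trans (ℕ.≤-reflexive (sym (ℕ.^-identityʳ (base Q)))) (base-mono Q {1} {1 ℕ.+ κ ℕ.* 3} (s≤s z≤n))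
      ; size≤n = le ; ∣X∣≡ = ∣⊥∣≡0 n ; ∣X∣≤ = ℕ.≤-reflexive (∣⊥∣≡0 n) ; X⊆U = λ {i} → ⊥⊆ {p = Subset.⊤} {i}
      ; missing = ℕ.≤-reflexive (cong (λ k → k ℕ.* size Q κ true ℕ.* base Q)
          (trans (∣∁p∣≡n∸∣p∣ (Subset.⊤ {n})) (trans (cong (n ℕ.∸_) (∣⊤∣≡n n)) (ℕ.n∸n≡0 n))))
      ; large = λ () }) sizes≤n

    certificate : Cert q w (ι (L ℕ.∸ criticals q))
    certificate = subst (λ k → Cert q w (ι (k ℕ.∸ criticals q))) (length-upTo L)
      (G.certificate q {0} {st} {K} q≤Q (subst (ℕ._≤ Q) (sym (∣⊥∣≡0 n)) z≤n)
        (AllPairs.applyUpTo⁺₁ id L (λ i<j _ → i<j)) inv-st)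

    criticals< : ∀ k → criticals k ℕ.< 2 ℕ.^ k
    criticals< zero    = s≤s z≤n
    criticals< (suc k) = ℕ.≤-trans (s≤s (ℕ.≤-reflexive (sym (ℕ.+-suc (criticals k) (criticals k)))))
      (ℕ.≤-trans (ℕ.+-mono-≤ (criticals< k) (criticals< k))
        (ℕ.≤-reflexive (cong (2 ℕ.^ k ℕ.+_) (sym (ℕ.+-identityʳ (2 ℕ.^ k))))))

    seven : 7 ℕ.* x ℕ.≤ L ℕ.∸ criticals q
    seven = ℕ.m+n≤o⇒m≤o∸n (7 ℕ.* x) (ℕ.≤-trans
      (ℕ.+-monoʳ-≤ (7 ℕ.* x) (ℕ.≤-trans (ℕ.<⇒≤ (criticals< q)) (ℕ.^-monoʳ-≤ 2 q≤Q)))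
      (ℕ.≤-reflexive (eight x)))
      where
      eight : ∀ x → 7 ℕ.* x ℕ.+ x ≡ 8 ℕ.* x
      eight = solve-∀

    squeeze : ι (L ℕ.∸ criticals q) ℚ.≤ (ι L ℚ.* (+ 9 / 8) ℚ.+ ι L ℚ.* (+ 9 / 8)) ℚ.* ⅓ ℚ.+ ½
    squeeze =
      let N , le = ≤-trans {fromℚ (ι (L ℕ.∸ criticals q))} {loss w T} {fromℚ ((∑ (subsets n) (λ S → w S true) ℚ.+ ∑ (subsets n) (λ S → w S false)) ℚ.* ⅓)}
                     (Cert⇒loss T (Finite.0≤ι (L ℕ.∸ criticals q)) certificate)
                     (loss-≤ T (λ S b → G.0≤weights K st S b) error) ½ (ℚ.positive⁻¹ ½)
      in subst₂ (λ a b → ι (L ℕ.∸ criticals q) ℚ.≤ (a ℚ.+ b) ℚ.* ⅓ ℚ.+ ½) (total-weight true) (total-weight false) (le N ℕ.≤-refl)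

  -- The certificate and the error bound of the tester give 7x ≤ 6x + 1/2. The 1/2 is the tolerance
  -- at which the inequality of constant reals was read off in `squeeze`, and it is harmless because
  -- x ≥ 1.
  few-samples-fail : ⊥
  few-samples-fail = Finite.<⇒≱ (ℚ.*<* (ℤ.+<+ (s≤s (s≤s z≤n)))) (ℚ.≤-trans 1≤x (≤-certificate (≤⇒0≤- 7x≤6x+½)
    (solve 1 (λ x → con ½ := x :+ ((con (+ 8 / 1) :* x :* con (+ 9 / 8) :+ con (+ 8 / 1) :* x :* con (+ 9 / 8)) :* con ⅓ :+ con ½
      :- con (+ 7 / 1) :* x)) refl (ι x))))
    where
    1≤x : 1ℚ ℚ.≤ ι x
    1≤x = subst (ℚ._≤ ι x) Finite.ι-1 (Finite.ι-mono (ℕ.≤-trans (s≤s z≤n) (n<2^n Q)))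
    7x≤6x+½ : (+ 7 / 1) ℚ.* ι x ℚ.≤ ((+ 8 / 1) ℚ.* ι x ℚ.* (+ 9 / 8) ℚ.+ (+ 8 / 1) ℚ.* ι x ℚ.* (+ 9 / 8)) ℚ.* ⅓ ℚ.+ ½
    7x≤6x+½ = subst₂ (λ a b → a ℚ.≤ (b ℚ.* (+ 9 / 8) ℚ.+ b ℚ.* (+ 9 / 8)) ℚ.* ⅓ ℚ.+ ½)
      (trans (Finite.ι-* 7 x) (cong (ℚ._* ι x) (Finite.ι-def 7)))
      (trans (Finite.ι-* 8 x) (cong (ℚ._* ι x) (Finite.ι-def 8)))
      (ℚ.≤-trans (Finite.ι-mono seven) squeeze)

-- Iterated logarithms and the lower bound

loglog : ℕ → ℕ
loglog n = ⌈log₂ ⌈log₂ n ⌉ ⌉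

loglog-lower : ∀ {e n} → 2 ℕ.^ (2 ℕ.^ e) ℕ.≤ n → e ℕ.≤ loglog n
loglog-lower {e} {n} le = subst₂ ℕ._≤_ (⌈log₂2^n⌉≡n e) refl
  (⌈log₂⌉-mono-≤ (subst (ℕ._≤ ⌈log₂ n ⌉) (⌈log₂2^n⌉≡n (2 ℕ.^ e)) (⌈log₂⌉-mono-≤ le)))

loglog-upper : ∀ {e n} → e ℕ.< loglog n → 2 ℕ.^ (2 ℕ.^ e) ℕ.≤ n
loglog-upper {e} {n} e< with 2 ℕ.^ (2 ℕ.^ e) ℕ.≤? n
... | yes le = le
... | no  gt = contradiction
  (subst (loglog n ℕ.≤_) (⌈log₂2^n⌉≡n e) (⌈log₂⌉-mono-≤
    (subst (⌈log₂ n ⌉ ℕ.≤_) (⌈log₂2^n⌉≡n (2 ℕ.^ e)) (⌈log₂⌉-mono-≤ (ℕ.<⇒≤ (ℕ.≰⇒> gt))))))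
  (ℕ.<⇒≱ e<)

5≤⌊√⌋ : ∀ {m} → 25 ℕ.≤ m → 5 ℕ.≤ ⌊√ m ⌋
5≤⌊√⌋ {m} 25≤m = ℕ.≮⇒≥ λ r<5 → ℕ.<-irrefl refl
  (ℕ.≤-<-trans 25≤m (ℕ.<-≤-trans (⌊√⌋-upper m) (ℕ.*-mono-≤ r<5 r<5)))

-- The threshold 25 gives r ≥ 5, whence 9 + 2r ≤ 5r ≤ r². Strictness is what `loglog-upper` asks of
-- the exponent 8 + 2r.
9+2⌊√⌋≤ : ∀ {m} → 25 ℕ.≤ m → 8 ℕ.+ (⌊√ m ⌋ ℕ.+ ⌊√ m ⌋) ℕ.< m
9+2⌊√⌋≤ {m} 25≤m = begin
  9 ℕ.+ (r ℕ.+ r)               ≤⟨ ℕ.+-monoˡ-≤ (r ℕ.+ r) {9} {15} (ℕ.m≤m+n 9 6) ⟩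
  15 ℕ.+ (r ℕ.+ r)              ≤⟨ ℕ.+-monoˡ-≤ (r ℕ.+ r) (ℕ.*-monoʳ-≤ 3 5≤r) ⟩
  3 ℕ.* r ℕ.+ (r ℕ.+ r)         ≡⟨ five r ⟩
  5 ℕ.* r                       ≤⟨ ℕ.*-monoˡ-≤ r 5≤r ⟩
  r ℕ.* r                       ≤⟨ ⌊√⌋-lower m ⟩
  m                             ∎
  where
  open ℕ.≤-Reasoning
  r = ⌊√ m ⌋
  5≤r = 5≤⌊√⌋ 25≤m
  five : ∀ r → 3 ℕ.* r ℕ.+ (r ℕ.+ r) ≡ 5 ℕ.* r
  five = solve-∀

√-≤ : ∀ {m q} → m ℕ.≤ q ℕ.* q → √ m ≤ fromℕ q
√-≤ {m} {q} m≤q² = pointwise-≤ {√ m} {fromℕ q} λ k → ℚ.toℚᵘ-cancel-≤ (ℚᵘ.≤-respˡ-≃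
  (ℚᵘ.≃-sym (ℚ.toℚᵘ-fromℚᵘ (ℚᵘ.mkℚᵘ (+ r k) k)))
  (ℚᵘ.≤-respʳ-≃ (ℚᵘ.≃-sym (ℚ.toℚᵘ-fromℚᵘ (ℚᵘ.mkℚᵘ (+ q) 0)))
    (ℚᵘ.*≤* (subst₂ ℤ._≤_ (sym (ℤ.*-identityʳ (+ r k))) (ℤ.pos-* q (suc k)) (ℤ.+≤+ (r≤ k))))))
  where
  r : ℕ → ℕ
  r k = ⌊√ m ℕ.* (suc k ℕ.* suc k) ⌋
  r≤ : ∀ k → r k ℕ.≤ q ℕ.* suc k
  r≤ k = ℕ.≮⇒≥ λ lt → ℕ.<-irrefl refl (ℕ.<-≤-trans (ℕ.*-mono-< lt lt) (begin
    r k ℕ.* r k                              ≤⟨ ⌊√⌋-lower (m ℕ.* (suc k ℕ.* suc k)) ⟩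
    m ℕ.* (suc k ℕ.* suc k)                  ≤⟨ ℕ.*-monoˡ-≤ (suc k ℕ.* suc k) m≤q² ⟩
    q ℕ.* q ℕ.* (suc k ℕ.* suc k)            ≡⟨ interchange q (suc k) ⟩
    (q ℕ.* suc k) ℕ.* (q ℕ.* suc k)          ∎))
    where
    open ℕ.≤-Reasoning
    interchange : ∀ a b → a ℕ.* a ℕ.* (b ℕ.* b) ≡ (a ℕ.* b) ℕ.* (a ℕ.* b)
    interchange = solve-∀

-- Opaque, so that 2 ^ 2 ^ 25 is never evaluated.
abstract
  loglog-threshold : ℕ
  loglog-threshold = 25

  25≤loglog-threshold : 25 ℕ.≤ loglog-threshold
  25≤loglog-threshold = ℕ.≤-refl

theorem7p3p1 : ∃[ ε ] ∃[ c ] 0ℝ < ε × 0ℝ < c ×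
    Σ[ P ∈ (∀ n → Property n) ] (∀ n → LabelInvariant (P n)) ×
    ∃[ N ] ∀ n → n ≥ N → ∀ q (T : Algorithm n q) →
    IsTester (P n) ε (fromℚ (+ 1 / 3)) T → c * √loglog n ≤ fromℕ q
theorem7p3p1 = fromℚ (+ 1 / 4) , 1ℝ
  , (+ 1 / 4 , ℚ.positive⁻¹ (+ 1 / 4) , 0 , λ _ _ → ℚ.≤-refl)
  , (1ℚ , ℚ.positive⁻¹ 1ℚ , 0 , λ _ _ → ℚ.≤-refl)
  -- The number Q = ⌊√ loglog n⌋ of samples to be defeated fixes the base of the scales. A tester
  -- then has q ≥ Q + 1, so loglog n < (Q + 1)² ≤ q², which is why the constant can be 1.
  , (λ n → even-scales ⌊√ loglog n ⌋ n)
  , (λ n → scaled-property-invariant (λ κ → size ⌊√ loglog n ⌋ κ false))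
  , 2 ℕ.^ (2 ℕ.^ loglog-threshold) , bound
  where
  bound : ∀ n → n ≥ 2 ℕ.^ (2 ℕ.^ loglog-threshold) → ∀ q (T : Algorithm n q) →
    IsTester (even-scales ⌊√ loglog n ⌋ n) (fromℚ (+ 1 / 4)) (fromℚ (+ 1 / 3)) T → 1ℝ * √loglog n ≤ fromℕ q
  bound n n≥ q T tester with q ℕ.≤? ⌊√ loglog n ⌋
  ... | yes q≤Q = ⊥-elim (few-samples-fail {n} {⌊√ loglog n ⌋} {q}
        (ℕ.≤-trans (s≤s z≤n) (5≤⌊√⌋ 25≤)) (loglog-upper (9+2⌊√⌋≤ 25≤)) q≤Q T tester)
    where 25≤ = ℕ.≤-trans 25≤loglog-threshold (loglog-lower n≥)
  ... | no  q≰Q = ≤-trans {1ℝ * √loglog n} {√loglog n} {fromℕ q}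
    (≡⇒≤ {1ℝ * √loglog n} {√loglog n} (λ m → ℚ.*-identityˡ (approx (√loglog n) m)))
    (√-≤ {loglog n} {q} (ℕ.≤-trans (ℕ.<⇒≤ (⌊√⌋-upper (loglog n))) (ℕ.*-mono-≤ (ℕ.≰⇒> q≰Q) (ℕ.≰⇒> q≰Q))))
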